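{- Let $t:\mathbb{N}\to\mathbb{R}_{\geq0}$ be a function with $t(n)=o(n^{1/2})$. The following hold: 1. If there is a polynomial-time algorithm which, given any pair of cospectral graphs $G$ and $H$ on $n$ vertices each and each with maximum degree $d_{\max}$, decides whether $\delta_{\mathcal{E}}(G,H)\leq t(n)$, then there is a polynomial-time algorithm deciding the isomorphism of finite groups given as Cayley tables. 2. If there is a polynomial-time algorithm which, given any pair of cospectral graphs $G$ and $H$ on $n$ vertices each and each with maximum degree $d_{\max}$, decides whether $\delta_1(G,H)\leq d_{\max}/3-4$, then there is a polynomial-time algorithm deciding the isomorphism of finite groups given as Cayley tables.
   Context: All graphs are finite, simple and undirected; $A_G$ denotes the adjacency matrix of $G$. Two graphs are cospectral if their adjacency matrices have the same eigenvalue spectrum (with multiplicities). For graphs $G,H$ with the same number of vertices, $\mathrm{Inj}(G,H)$ is the set of injective (hence bijective) maps $\pi:V(G)\to V(H)$, and $G^\pi$ is the graph with vertex set $V(H)$ and edge set $\{(\pi(u),\pi(v))\mid (u,v)\in E(G)\}$. For graphs on the same vertex set, $\mu_{\mathcal{E}}(G,H)=|(E(G)\setminus E(H))\cup(E(H)\setminus E(G))|$ and $\mu_1(G,H)=\sup_{x\neq0}\|(A_G-A_H)x\|_1/\|x\|_1$, where $\|x\|_1=\sum_v|x_v|$. Set $\delta_{\mathcal{E}}(G,H)=\min_{\pi\in\mathrm{Inj}(G,H)}\mu_{\mathcal{E}}(G^\pi,H)$ and $\delta_1(G,H)=\min_{\pi\in\mathrm{Inj}(G,H)}\mu_1(G^\pi,H)$.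 The group isomorphism problem for Cayley tables: given the full multiplication tables of two finite groups, decide whether the groups are isomorphic. -}

module Defs where

open import Algebra.Bundles.Raw using (RawGroup)
open import Algebra.Core using (Op₁; Op₂)
open import Algebra.Morphism.Structures using (module GroupMorphisms)
open import Algebra.Structures using (IsGroup)
open import Data.Bool.Base using (Bool; true; false; if_then_else_; not; _∧_; _∨_)
import Data.Bool.Properties as Bool
open import Data.Fin.Base using (Fin; toℕ)
import Data.Fin.Properties as Fin
open import Data.Integer.Base using (+_)
open import Data.List.Base using (List; []; _∷_; length; map; allFin; filterᵇ; tabulate; cartesianProduct)
open import Data.List.Extrema.Nat using (max)
open import Data.Nat.Base as ℕ using (ℕ; suc)
import Data.Nat.Properties as ℕ
open import Data.Product.Base using (Σ; Σ-syntax; ∃; ∃-syntax; _×_; _,_; uncurry)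
open import Data.Rational.Base as ℚ using (ℚ; 0ℚ; 1ℚ; ½; _/_)
import Data.Rational.Properties as ℚ
open ℚ.≤-Reasoning
open import Data.Rational.Solver using (module +-*-Solver)
open import Data.Sum.Base using (inj₁; inj₂)
open import Data.Vec.Functional using (Vector; foldr)
open import Function.Bundles using (_↣_; _⇔_; mk⇔; module Injection)
open import Level using (0ℓ)
open import Relation.Binary.PropositionalEquality
  using (_≡_; refl; sym; trans; cong; cong₂; subst; subst₂)
open import Relation.Nullary.Decidable using (Dec; does; _×-dec_; does-⇔; dec-false)
open import Relation.Nullary.Negation.Core using (¬_)
open import Relation.Nullary.Reflects using (Reflects)

-- Real numbers: Cauchy sequences of rationals, each carrying its modulus
-- of convergence, considered up to _≈ℝ_.

IsCauchy : (ℕ → ℚ) → Set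
IsCauchy s = ∀ ε → 0ℚ ℚ.< ε →
  ∃[ N ] ∀ m n → N ℕ.≤ m → N ℕ.≤ n → ℚ.∣ s m ℚ.- s n ∣ ℚ.≤ ε

record ℝ : Set where
  constructor mkℝ
  field
    seq    : ℕ → ℚ
    cauchy : IsCauchy seq

open ℝ public

infix  4 _≈ℝ_ _≤ℝ_ _<ℝ_
infixl 6 _+ℝ_ _-ℝ_
infixl 7 _*ℝ_
infix  8 -ℝ_

_≈ℝ_ : ℝ → ℝ → Set
x ≈ℝ y = ∀ ε → 0ℚ ℚ.< ε → ∃[ N ] ∀ n → N ℕ.≤ n → ℚ.∣ seq x n ℚ.- seq y n ∣ ℚ.≤ ε

_≤ℝ_ : ℝ → ℝ → Set
x ≤ℝ y = ∀ ε → 0ℚ ℚ.< ε → ∃[ N ] ∀ n → N ℕ.≤ n → seq x n ℚ.≤ seq y n ℚ.+ ε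

_<ℝ_ : ℝ → ℝ → Set
x <ℝ y = ∃[ ε ] 0ℚ ℚ.< ε × ∃[ N ] ∀ n → N ℕ.≤ n → seq x n ℚ.+ ε ℚ.≤ seq y n

private
  module S = +-*-Solver
  open S using (_:+_; _:*_; _:-_; :-_; _:=_)

  abstract
    const-cauchy : ∀ q → IsCauchy λ _ → q
    const-cauchy q ε 0<ε = 0 , λ _ _ _ _ →
      subst (λ r → ℚ.∣ r ∣ ℚ.≤ ε) (sym (ℚ.+-inverseʳ q)) (ℚ.<⇒≤ 0<ε)

    half-pos : ∀ {ε} → 0ℚ ℚ.< ε → 0ℚ ℚ.< ε ℚ.* ½
    half-pos {ε} 0<ε = subst (ℚ._< ε ℚ.* ½) (ℚ.*-zeroˡ ½) (ℚ.*-monoˡ-<-pos ½ 0<ε)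

    halves : ∀ ε → ε ℚ.* ½ ℚ.+ ε ℚ.* ½ ≡ ε
    halves ε = trans (sym (ℚ.*-distribˡ-+ ε ½ ½)) (ℚ.*-identityʳ ε)

    ⊔-≤ˡ : ∀ {M N m} → M ℕ.⊔ N ℕ.≤ m → M ℕ.≤ m
    ⊔-≤ˡ {M} {N} = ℕ.≤-trans (ℕ.m≤m⊔n M N)

    ⊔-≤ʳ : ∀ {M N m} → M ℕ.⊔ N ℕ.≤ m → N ℕ.≤ m
    ⊔-≤ʳ {M} {N} = ℕ.≤-trans (ℕ.m≤n⊔m M N)

    +-rearrange : ∀ a b c d → (a ℚ.+ b) ℚ.- (c ℚ.+ d) ≡ (a ℚ.- c) ℚ.+ (b ℚ.- d)
    +-rearrange = S.solve 4 (λ a b c d → (a :+ b) :- (c :+ d) := (a :- c) :+ (b :- d)) refl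

    neg-rearrange : ∀ a b → ℚ.- a ℚ.- ℚ.- b ≡ b ℚ.- a
    neg-rearrange = S.solve 2 (λ a b → :- a :- :- b := b :- a) refl

    *-rearrange : ∀ a b c d → a ℚ.* b ℚ.- c ℚ.* d ≡ a ℚ.* (b ℚ.- d) ℚ.+ (a ℚ.- c) ℚ.* d
    *-rearrange = S.solve 4 (λ a b c d → a :* b :- c :* d := a :* (b :- d) :+ (a :- c) :* d) refl

    split : ∀ a b → (a ℚ.- b) ℚ.+ b ≡ a
    split = S.solve 2 (λ a b → (a :- b) :+ b := a) refl

    flip-sub : ∀ a b → a ℚ.- b ≡ ℚ.- (b ℚ.- a)
    flip-sub = S.solve 2 (λ a b → a :- b := :- (b :- a)) refl

    cancel-sub : ∀ a b → (a ℚ.+ b) ℚ.- b ≡ a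
    cancel-sub = S.solve 2 (λ a b → (a :+ b) :- b := a) refl

    ∣∣-swap : ∀ a b → ℚ.∣ a ℚ.- b ∣ ≡ ℚ.∣ b ℚ.- a ∣
    ∣∣-swap a b = trans (cong ℚ.∣_∣ (flip-sub a b)) (ℚ.∣-p∣≡∣p∣ (b ℚ.- a))

    ∣∣-triangle : ∀ a b → ℚ.∣ a ∣ ℚ.≤ ℚ.∣ a ℚ.- b ∣ ℚ.+ ℚ.∣ b ∣
    ∣∣-triangle a b = subst (λ r → ℚ.∣ r ∣ ℚ.≤ ℚ.∣ a ℚ.- b ∣ ℚ.+ ℚ.∣ b ∣) (split a b)
      (ℚ.∣p+q∣≤∣p∣+∣q∣ (a ℚ.- b) b)

    ∣∣-diff : ∀ a b → ℚ.∣ a ∣ ℚ.- ℚ.∣ b ∣ ℚ.≤ ℚ.∣ a ℚ.- b ∣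
    ∣∣-diff a b = subst (ℚ.∣ a ∣ ℚ.- ℚ.∣ b ∣ ℚ.≤_) (cancel-sub _ ℚ.∣ b ∣)
      (ℚ.+-monoˡ-≤ (ℚ.- ℚ.∣ b ∣) (∣∣-triangle a b))

    ∣∣-reverse : ∀ a b → ℚ.∣ ℚ.∣ a ∣ ℚ.- ℚ.∣ b ∣ ∣ ℚ.≤ ℚ.∣ a ℚ.- b ∣
    ∣∣-reverse a b with ℚ.∣p∣≡p∨∣p∣≡-p (ℚ.∣ a ∣ ℚ.- ℚ.∣ b ∣)
    ... | inj₁ e = subst (ℚ._≤ ℚ.∣ a ℚ.- b ∣) (sym e) (∣∣-diff a b)
    ... | inj₂ e = subst₂ ℚ._≤_ (trans (flip-sub ℚ.∣ b ∣ ℚ.∣ a ∣) (sym e)) (∣∣-swap b a) (∣∣-diff b a)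

    +-cauchy : ∀ s t → IsCauchy s → IsCauchy t → IsCauchy λ n → s n ℚ.+ t n
    +-cauchy s t cs ct ε 0<ε =
      let M , hM = cs (ε ℚ.* ½) (half-pos 0<ε)
          N , hN = ct (ε ℚ.* ½) (half-pos 0<ε)
      in M ℕ.⊔ N , λ m n m≥ n≥ → begin
        ℚ.∣ (s m ℚ.+ t m) ℚ.- (s n ℚ.+ t n) ∣
          ≡⟨ cong ℚ.∣_∣ (+-rearrange (s m) (t m) (s n) (t n)) ⟩
        ℚ.∣ (s m ℚ.- s n) ℚ.+ (t m ℚ.- t n) ∣
          ≤⟨ ℚ.∣p+q∣≤∣p∣+∣q∣ (s m ℚ.- s n) (t m ℚ.- t n) ⟩
        ℚ.∣ s m ℚ.- s n ∣ ℚ.+ ℚ.∣ t m ℚ.- t n ∣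
          ≤⟨ ℚ.+-mono-≤ (hM m n (⊔-≤ˡ {M} {N} m≥) (⊔-≤ˡ {M} {N} n≥))
                        (hN m n (⊔-≤ʳ {M} {N} m≥) (⊔-≤ʳ {M} {N} n≥)) ⟩
        ε ℚ.* ½ ℚ.+ ε ℚ.* ½
          ≡⟨ halves ε ⟩
        ε ∎

    neg-cauchy : ∀ s → IsCauchy s → IsCauchy λ n → ℚ.- s n
    neg-cauchy s cs ε 0<ε =
      let N , hN = cs ε 0<ε
      in N , λ m n m≥ n≥ →
        subst (ℚ._≤ ε) (cong ℚ.∣_∣ (sym (neg-rearrange (s m) (s n)))) (hN n m n≥ m≥)

    ∣∣-cauchy : ∀ s → IsCauchy s → IsCauchy λ n → ℚ.∣ s n ∣
    ∣∣-cauchy s cs ε 0<ε =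
      let N , hN = cs ε 0<ε
      in N , λ m n m≥ n≥ → ℚ.≤-trans (∣∣-reverse (s m) (s n)) (hN m n m≥ n≥)

    bounded : ∀ s → IsCauchy s →
      ∃[ B ] 0ℚ ℚ.< B × ∃[ N ] ∀ n → N ℕ.≤ n → ℚ.∣ s n ∣ ℚ.≤ B
    bounded s cs =
      let N , hN = cs 1ℚ (ℚ.positive⁻¹ 1ℚ)
      in 1ℚ ℚ.+ ℚ.∣ s N ∣
       , ℚ.+-mono-<-≤ (ℚ.positive⁻¹ 1ℚ) (ℚ.0≤∣p∣ (s N))
       , N , λ n n≥ → ℚ.≤-trans (∣∣-triangle (s n) (s N))
                                (ℚ.+-monoˡ-≤ ℚ.∣ s N ∣ (hN n N n≥ ℕ.≤-refl))

    *-mono-abs : ∀ a b {p q} → ℚ.∣ a ∣ ℚ.≤ p → ℚ.∣ b ∣ ℚ.≤ q → ℚ.∣ a ℚ.* b ∣ ℚ.≤ p ℚ.* q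
    *-mono-abs a b {p} {q} a≤p b≤q = begin
      ℚ.∣ a ℚ.* b ∣        ≡⟨ ℚ.∣p*q∣≡∣p∣*∣q∣ a b ⟩
      ℚ.∣ a ∣ ℚ.* ℚ.∣ b ∣  ≤⟨ ℚ.*-monoʳ-≤-nonNeg ℚ.∣ b ∣ {{ℚ.nonNegative (ℚ.0≤∣p∣ b)}} a≤p ⟩
      p ℚ.* ℚ.∣ b ∣        ≤⟨ ℚ.*-monoˡ-≤-nonNeg p {{ℚ.nonNegative (ℚ.≤-trans (ℚ.0≤∣p∣ a) a≤p)}} b≤q ⟩
      p ℚ.* q              ∎

    share : ∀ B → 0ℚ ℚ.< B → ∀ ε → 0ℚ ℚ.< ε → ∃[ δ ] 0ℚ ℚ.< δ × B ℚ.* δ ≡ ε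
    share B 0<B ε 0<ε = ℚ.1/ B ℚ.* ε
      , subst (ℚ._< ℚ.1/ B ℚ.* ε) (ℚ.*-zeroʳ (ℚ.1/ B))
          (ℚ.*-monoʳ-<-pos (ℚ.1/ B) {{ℚ.1/pos⇒pos B}} 0<ε)
      , trans (sym (ℚ.*-assoc B (ℚ.1/ B) ε))
          (trans (cong (ℚ._* ε) (ℚ.*-inverseʳ B)) (ℚ.*-identityˡ ε))
      where
      instance
        B-pos : ℚ.Positive B
        B-pos = ℚ.positive 0<B
        B-nonZero : ℚ.NonZero B
        B-nonZero = ℚ.pos⇒nonZero B

    *-close : ∀ a a′ b b′ {B C δ ε} →
      ℚ.∣ a ∣ ℚ.≤ B → ℚ.∣ b′ ∣ ℚ.≤ C → (B ℚ.+ C) ℚ.* δ ≡ ε →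
      ℚ.∣ a ℚ.- a′ ∣ ℚ.≤ δ → ℚ.∣ b ℚ.- b′ ∣ ℚ.≤ δ → ℚ.∣ a ℚ.* b ℚ.- a′ ℚ.* b′ ∣ ℚ.≤ ε
    *-close a a′ b b′ {B} {C} {δ} {ε} a≤B b′≤C eq a-a′ b-b′ = begin
      ℚ.∣ a ℚ.* b ℚ.- a′ ℚ.* b′ ∣
        ≡⟨ cong ℚ.∣_∣ (*-rearrange a b a′ b′) ⟩
      ℚ.∣ a ℚ.* (b ℚ.- b′) ℚ.+ (a ℚ.- a′) ℚ.* b′ ∣
        ≤⟨ ℚ.∣p+q∣≤∣p∣+∣q∣ (a ℚ.* (b ℚ.- b′)) ((a ℚ.- a′) ℚ.* b′) ⟩
      ℚ.∣ a ℚ.* (b ℚ.- b′) ∣ ℚ.+ ℚ.∣ (a ℚ.- a′) ℚ.* b′ ∣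
        ≤⟨ ℚ.+-mono-≤ (*-mono-abs a (b ℚ.- b′) a≤B b-b′) (*-mono-abs (a ℚ.- a′) b′ a-a′ b′≤C) ⟩
      B ℚ.* δ ℚ.+ δ ℚ.* C
        ≡⟨ cong (B ℚ.* δ ℚ.+_) (ℚ.*-comm δ C) ⟩
      B ℚ.* δ ℚ.+ C ℚ.* δ
        ≡⟨ sym (ℚ.*-distribʳ-+ δ B C) ⟩
      (B ℚ.+ C) ℚ.* δ
        ≡⟨ eq ⟩
      ε ∎

    *-cauchy : ∀ s t → IsCauchy s → IsCauchy t → IsCauchy λ n → s n ℚ.* t n
    *-cauchy s t cs ct ε 0<ε = bound (bounded s cs) (bounded t ct)
      where
      Bounded : (ℕ → ℚ) → Set
      Bounded s = ∃[ B ] 0ℚ ℚ.< B × ∃[ N ] ∀ n → N ℕ.≤ n → ℚ.∣ s n ∣ ℚ.≤ B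

      Within : (ℕ → ℚ) → ℚ → Set
      Within s δ = ∃[ N ] ∀ m n → N ℕ.≤ m → N ℕ.≤ n → ℚ.∣ s m ℚ.- s n ∣ ℚ.≤ δ

      combine : ∀ {B C δ K L} → (B ℚ.+ C) ℚ.* δ ≡ ε →
        (∀ n → K ℕ.≤ n → ℚ.∣ s n ∣ ℚ.≤ B) → (∀ n → L ℕ.≤ n → ℚ.∣ t n ∣ ℚ.≤ C) →
        Within s δ → Within t δ → Within (λ n → s n ℚ.* t n) ε
      combine {K = K} {L} eq hK hL (M , hM) (N , hN) =
        (K ℕ.⊔ L) ℕ.⊔ (M ℕ.⊔ N) , λ m n m≥ n≥ →
        *-close (s m) (s n) (t m) (t n)
          (hK m (⊔-≤ˡ {K} {L} (⊔-≤ˡ {K ℕ.⊔ L} {M ℕ.⊔ N} m≥)))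
          (hL n (⊔-≤ʳ {K} {L} (⊔-≤ˡ {K ℕ.⊔ L} {M ℕ.⊔ N} n≥)))
          eq
          (hM m n (⊔-≤ˡ {M} {N} (⊔-≤ʳ {K ℕ.⊔ L} {M ℕ.⊔ N} m≥))
                  (⊔-≤ˡ {M} {N} (⊔-≤ʳ {K ℕ.⊔ L} {M ℕ.⊔ N} n≥)))
          (hN m n (⊔-≤ʳ {M} {N} (⊔-≤ʳ {K ℕ.⊔ L} {M ℕ.⊔ N} m≥))
                  (⊔-≤ʳ {M} {N} (⊔-≤ʳ {K ℕ.⊔ L} {M ℕ.⊔ N} n≥)))

      close : ∀ {B C K L} → ∃[ δ ] 0ℚ ℚ.< δ × (B ℚ.+ C) ℚ.* δ ≡ ε →
        (∀ n → K ℕ.≤ n → ℚ.∣ s n ∣ ℚ.≤ B) → (∀ n → L ℕ.≤ n → ℚ.∣ t n ∣ ℚ.≤ C) →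
        Within (λ n → s n ℚ.* t n) ε
      close {K = K} {L} (δ , 0<δ , eq) hK hL = combine {K = K} {L} eq hK hL (cs δ 0<δ) (ct δ 0<δ)

      bound : Bounded s → Bounded t → Within (λ n → s n ℚ.* t n) ε
      bound (B , 0<B , K , hK) (C , 0<C , L , hL) =
        close {K = K} {L} (share (B ℚ.+ C) (ℚ.+-mono-< 0<B 0<C) ε 0<ε) hK hL

fromℚ : ℚ → ℝ
fromℚ q = mkℝ (λ _ → q) (const-cauchy q)

fromℕ : ℕ → ℝ
fromℕ n = fromℚ (+ n / 1)

0ℝ 1ℝ : ℝ
0ℝ = fromℚ 0ℚ
1ℝ = fromℚ 1ℚ

_+ℝ_ : ℝ → ℝ → ℝ
mkℝ s cs +ℝ mkℝ t ct = mkℝ (λ n → s n ℚ.+ t n) (+-cauchy s t cs ct)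

-ℝ_ : ℝ → ℝ
-ℝ mkℝ s cs = mkℝ (λ n → ℚ.- s n) (neg-cauchy s cs)

_-ℝ_ : ℝ → ℝ → ℝ
x -ℝ y = x +ℝ (-ℝ y)

_*ℝ_ : ℝ → ℝ → ℝ
mkℝ s cs *ℝ mkℝ t ct = mkℝ (λ n → s n ℚ.* t n) (*-cauchy s t cs ct)

∣_∣ℝ : ℝ → ℝ
∣ mkℝ s cs ∣ℝ = mkℝ (λ n → ℚ.∣ s n ∣) (∣∣-cauchy s cs)

IsSqrt : ℝ → ℝ → Set
IsSqrt x r = 0ℝ ≤ℝ r × r *ℝ r ≈ℝ x

LittleO√ : (ℕ → ℝ) → Set
LittleO√ t = ∀ ε → 0ℝ <ℝ ε →
  ∃[ N ] ∀ n → N ℕ.≤ n → ∀ √n → IsSqrt (fromℕ n) √n → t n ≤ℝ ε *ℝ √n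

IsSupremum : (ℝ → Set) → ℝ → Set
IsSupremum P s = (∀ q → P q → q ≤ℝ s) × (∀ u → (∀ q → P q → q ≤ℝ u) → s ≤ℝ u)

IsMinimum : {A : Set} → (A → A → Set) → (A → Set) → A → Set
IsMinimum _≤_ P d = P d × (∀ e → P e → d ≤ e)

Matrix : ℕ → Set
Matrix n = Fin n → Fin n → ℝ

∑ : ∀ {n} → Vector ℝ n → ℝ
∑ = foldr _+ℝ_ 0ℝ

_·_ : ∀ {n} → Matrix n → Vector ℝ n → Vector ℝ n
(A · x) u = ∑ λ v → A u v *ℝ x v

_⊖_ : ∀ {n} → Matrix n → Matrix n → Matrix n
(A ⊖ B) u v = A u v -ℝ B u v

_≋_ : ∀ {n} → Vector ℝ n → Vector ℝ n → Set
x ≋ y = ∀ v → x v ≈ℝ y v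

𝟎 : ∀ {n} → Vector ℝ n
𝟎 _ = 0ℝ

_⋆_ : ∀ {n} → ℝ → Vector ℝ n → Vector ℝ n
(c ⋆ x) v = c *ℝ x v

‖_‖₁ : ∀ {n} → Vector ℝ n → ℝ
‖ x ‖₁ = ∑ λ v → ∣ x v ∣ℝ

combination : ∀ {n k} → Vector ℝ k → Vector (Vector ℝ n) k → Vector ℝ n
combination c b v = ∑ λ i → c i *ℝ b i v

Eigenspace : ∀ {n} → Matrix n → ℝ → Vector ℝ n → Set
Eigenspace A λ′ x = (A · x) ≋ (λ′ ⋆ x)

HasDimension : ∀ {n} → (Vector ℝ n → Set) → ℕ → Set
HasDimension {n} S k = Σ[ b ∈ Vector (Vector ℝ n) k ]
  (∀ i → S (b i)) ×
  (∀ c → combination c b ≋ 𝟎 → c ≋ 𝟎) ×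
  (∀ x → S x → ∃[ c ] x ≋ combination c b)

-- Two symmetric real matrices have the same spectrum with multiplicities.
-- For these all eigenvalues are real and the multiplicity of λ is the
-- dimension of its eigenspace; k = 0 says that λ is not an eigenvalue.
SameSpectrum : ∀ {n} → Matrix n → Matrix n → Set
SameSpectrum A B = ∀ λ′ k →
  HasDimension (Eigenspace A λ′) k ⇔ HasDimension (Eigenspace B λ′) k

record Graph (n : ℕ) : Set where
  field
    adj         : Fin n → Fin n → Bool
    symmetric   : ∀ u v → adj u v ≡ adj v u
    irreflexive : ∀ v → adj v v ≡ false

open Graph public

adjacencyMatrix : ∀ {n} → Graph n → Matrix n
adjacencyMatrix G u v = if adj G u v then 1ℝ else 0ℝ

Cospectral : ∀ {n} → Graph n → Graph n → Set
Cospectral G H = SameSpectrum (adjacencyMatrix G) (adjacencyMatrix H)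

degree : ∀ {n} → Graph n → Fin n → ℕ
degree {n} G v = length (filterᵇ (adj G v) (allFin n))

maxDegree : ∀ {n} → Graph n → ℕ
maxDegree {n} G = max 0 (map (degree G) (allFin n))

Hit : ∀ {n} → Graph n → Fin n ↣ Fin n → Fin n → Fin n → Set
Hit G π x y = ∃[ u ] ∃[ v ] Injection.to π u ≡ x × Injection.to π v ≡ y × adj G u v ≡ true

hit? : ∀ {n} (G : Graph n) π x y → Dec (Hit G π x y)
hit? G π x y = Fin.any? λ u → Fin.any? λ v →
  (Injection.to π u Fin.≟ x) ×-dec ((Injection.to π v Fin.≟ y) ×-dec (adj G u v Bool.≟ true))

hit-swap : ∀ {n} (G : Graph n) π {x y} → Hit G π x y → Hit G π y x
hit-swap G π (u , v , p , q , e) = v , u , q , p , trans (symmetric G v u) e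

hit-irrefl : ∀ {n} (G : Graph n) π x → ¬ Hit G π x x
hit-irrefl G π x (u , v , p , q , e)
  with refl ← Injection.injective π (trans p (sym q))
  with () ← trans (sym (irreflexive G u)) e

_^_ : ∀ {n} → Graph n → Fin n ↣ Fin n → Graph n
adj         (G ^ π) x y = does (hit? G π x y)
symmetric   (G ^ π) x y = does-⇔ (mk⇔ (hit-swap G π) (hit-swap G π)) (hit? G π x y) (hit? G π y x)
irreflexive (G ^ π) x   = dec-false (hit? G π x x) (hit-irrefl G π x)

-- Unordered pairs of vertices are counted once, as the (u , v) with u < v.
μE : ∀ {n} → Graph n → Graph n → ℕ
μE {n} G H = length (filterᵇ (uncurry inExactlyOne) (cartesianProduct (allFin n) (allFin n)))
  where
  inExactlyOne : Fin n → Fin n → Bool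
  inExactlyOne u v = does (u Fin.<? v) ∧
    ((adj G u v ∧ not (adj H u v)) ∨ (adj H u v ∧ not (adj G u v)))

-- q = ‖(A_G - A_H)x‖₁ / ‖x‖₁ for some x ≠ 0, the division multiplied out.
IsRatio : ∀ {n} → Graph n → Graph n → ℝ → Set
IsRatio {n} G H q = Σ[ x ∈ Vector ℝ n ] ¬ (x ≋ 𝟎) ×
  q *ℝ ‖ x ‖₁ ≈ℝ ‖ (adjacencyMatrix G ⊖ adjacencyMatrix H) · x ‖₁

Isμ₁ : ∀ {n} → Graph n → Graph n → ℝ → Set
Isμ₁ G H = IsSupremum (IsRatio G H)

IsδE : ∀ {n} → Graph n → Graph n → ℕ → Set
IsδE {n} G H = IsMinimum ℕ._≤_ λ d → Σ[ π ∈ Fin n ↣ Fin n ] μE (G ^ π) H ≡ d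

Isδ₁ : ∀ {n} → Graph n → Graph n → ℝ → Set
Isδ₁ {n} G H = IsMinimum _≤ℝ_ λ d → Σ[ π ∈ Fin n ↣ Fin n ] Isμ₁ (G ^ π) H d

δE[_,_]≤_ : ∀ {n} → Graph n → Graph n → ℝ → Set
δE[ G , H ]≤ r = ∃[ d ] IsδE G H d × fromℕ d ≤ℝ r

δ₁[_,_]≤_ : ∀ {n} → Graph n → Graph n → ℝ → Set
δ₁[ G , H ]≤ r = ∃[ d ] Isδ₁ G H d × d ≤ℝ r

record FiniteGroup : Set where
  field
    order   : ℕ
    _∙_     : Op₂ (Fin order)
    ε       : Fin order
    _⁻¹     : Op₁ (Fin order)
    isGroup : IsGroup _≡_ _∙_ ε _⁻¹

  rawGroup : RawGroup 0ℓ 0ℓ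
  rawGroup = record { Carrier = Fin order ; _≈_ = _≡_ ; _∙_ = _∙_ ; ε = ε ; _⁻¹ = _⁻¹ }

Isomorphic : FiniteGroup → FiniteGroup → Set
Isomorphic Γ Δ = ∃ (GroupMorphisms.IsGroupIsomorphism (FiniteGroup.rawGroup Γ) (FiniteGroup.rawGroup Δ))

-- Algorithms: Jones's WHILE language over binary trees.  A tree is held as
-- a pointer to an immutable cell, so assigning, consing and taking a
-- component are constant-time operations, and there is no other test than
-- for nil; polynomial time is then the same as on Turing machines.

data Tree : Set where
  nil  : Tree
  cons : Tree → Tree → Tree

size : Tree → ℕ
size nil        = 1
size (cons s t) = suc (size s ℕ.+ size t)

head tail : Tree → Tree
head nil        = nil
head (cons s _) = s
tail nil        = nil
tail (cons _ t) = t

isCons : Tree → Bool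
isCons nil        = false
isCons (cons _ _) = true

Var : Set
Var = ℕ

data Expr : Set where
  var  : Var → Expr
  nil  : Expr
  cons : Expr → Expr → Expr
  hd   : Expr → Expr
  tl   : Expr → Expr

infix  6 _≔_
infixr 5 _⨾_

data Command : Set where
  skip            : Command
  _≔_             : Var → Expr → Command
  _⨾_             : Command → Command → Command
  when_then_else_ : Expr → Command → Command → Command
  while_loop_     : Expr → Command → Command

Store : Set
Store = Var → Tree

_[_↦_] : Store → Var → Tree → Store
(σ [ x ↦ t ]) y = if does (x ℕ.≟ y) then t else σ y

eval : Store → Expr → Tree
eval σ (var x)    = σ x
eval σ nil        = nil
eval σ (cons e f) = cons (eval σ e) (eval σ f)
eval σ (hd e)     = head (eval σ e)
eval σ (tl e)     = tail (eval σ e)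

cost : Expr → ℕ
cost (var x)    = 1
cost nil        = 1
cost (cons e f) = suc (cost e ℕ.+ cost f)
cost (hd e)     = suc (cost e)
cost (tl e)     = suc (cost e)

-- ⟨ C , σ ⟩⇓[ T ] τ : started in σ, C halts in τ after T time units.
data ⟨_,_⟩⇓[_]_ : Command → Store → ℕ → Store → Set where
  ⇓-skip   : ∀ {σ} → ⟨ skip , σ ⟩⇓[ 1 ] σ
  ⇓-assign : ∀ {σ x e} → ⟨ x ≔ e , σ ⟩⇓[ suc (cost e) ] (σ [ x ↦ eval σ e ])
  ⇓-seq    : ∀ {C D σ τ ρ S T} →
             ⟨ C , σ ⟩⇓[ S ] τ → ⟨ D , τ ⟩⇓[ T ] ρ → ⟨ C ⨾ D , σ ⟩⇓[ S ℕ.+ T ] ρ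
  ⇓-then   : ∀ {e C D σ τ T} → isCons (eval σ e) ≡ true →
             ⟨ C , σ ⟩⇓[ T ] τ → ⟨ when e then C else D , σ ⟩⇓[ suc (cost e ℕ.+ T) ] τ
  ⇓-else   : ∀ {e C D σ τ T} → isCons (eval σ e) ≡ false →
             ⟨ D , σ ⟩⇓[ T ] τ → ⟨ when e then C else D , σ ⟩⇓[ suc (cost e ℕ.+ T) ] τ
  ⇓-stop   : ∀ {e C σ} → isCons (eval σ e) ≡ false →
             ⟨ while e loop C , σ ⟩⇓[ suc (cost e) ] σ
  ⇓-loop   : ∀ {e C σ τ ρ S T} → isCons (eval σ e) ≡ true →
             ⟨ C , σ ⟩⇓[ S ] τ → ⟨ while e loop C , τ ⟩⇓[ T ] ρ →
             ⟨ while e loop C , σ ⟩⇓[ suc (cost e ℕ.+ (S ℕ.+ T)) ] ρ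

-- Variable 0 holds the input and, on halting, the answer (nil means no).
initial : Tree → Store
initial t = (λ _ → nil) [ 0 ↦ t ]

_on_answers_within_ : Command → Tree → Bool → ℕ → Set
C on t answers b within T = ∃[ S ] ∃[ τ ]
  ⟨ C , initial t ⟩⇓[ S ] τ × isCons (τ 0) ≡ b × S ℕ.≤ T

-- The instances are the inputs satisfying the promise of the problem; the
-- behaviour of the algorithm on other inputs is not constrained.
record DecisionProblem : Set₁ where
  field
    Instance : Set
    encode   : Instance → Tree
    Yes      : Instance → Set

DecidableInPolyTime : DecisionProblem → Set
DecidableInPolyTime P = Σ[ C ∈ Command ] ∃[ c ] ∃[ d ] ∀ (i : Instance) → ∃[ b ]
  C on encode i answers b within (c ℕ.* size (encode i) ℕ.^ d) × Reflects (Yes i) b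
  where open DecisionProblem P

encodeList : List Tree → Tree
encodeList []       = nil
encodeList (t ∷ ts) = cons t (encodeList ts)

encodeTable : ∀ {n} → (Fin n → Fin n → Tree) → Tree
encodeTable T = encodeList (tabulate λ i → encodeList (tabulate λ j → T i j))

encodeBool : Bool → Tree
encodeBool false = nil
encodeBool true  = cons nil nil

-- Unary.  A Cayley table of order n has n² entries, so this is within a
-- polynomial of the binary encoding.
encodeℕ : ℕ → Tree
encodeℕ 0       = nil
encodeℕ (suc n) = cons nil (encodeℕ n)

encodeGraph : ∀ {n} → Graph n → Tree
encodeGraph G = encodeTable λ u v → encodeBool (adj G u v)

cayleyTable : FiniteGroup → Tree
cayleyTable Γ = encodeTable λ a b → encodeℕ (toℕ (a ∙ b))
  where open FiniteGroup Γ

record CospectralPair : Set where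
  field
    n          : ℕ
    G H        : Graph n
    cospectral : Cospectral G H
    dmax       : ℕ
    maxDegreeG : maxDegree G ≡ dmax
    maxDegreeH : maxDegree H ≡ dmax

encodePair : CospectralPair → Tree
encodePair p = cons (encodeGraph G) (encodeGraph H)
  where open CospectralPair p

EditDistanceAtMost : (ℕ → ℝ) → DecisionProblem
EditDistanceAtMost t = record
  { Instance = CospectralPair
  ; encode   = encodePair
  ; Yes      = λ p → let open CospectralPair p in δE[ G , H ]≤ t n
  }

-- Graphs with no vertex have no x ≠ 0, so μ₁ is then the supremum of the
-- empty set and the answer is no, as it also is under sup ∅ = 0.
OperatorDistanceSmall : DecisionProblem
OperatorDistanceSmall = record
  { Instance = CospectralPair
  ; encode   = encodePair
  ; Yes      = λ p → let open CospectralPair p in δ₁[ G , H ]≤ fromℚ (+ dmax / 3 ℚ.- + 4 / 1)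
  }

GroupIsomorphism : DecisionProblem
GroupIsomorphism = record
  { Instance = FiniteGroup × FiniteGroup
  ; encode   = λ (Γ , Δ) → cons (cayleyTable Γ) (cayleyTable Δ)
  ; Yes      = λ (Γ , Δ) → Isomorphic Γ Δ
  }

-- A group of order n is turned into the graph on its n² pairs (a , b) in which
-- two pairs are adjacent when they agree in a, in b or in a ∙ b.  These graphs
-- are regular of degree 3(n - 1); adjacent vertices have at least n common
-- neighbours and nonadjacent ones at most 6.  An edge present in only one of two
-- such graphs therefore forces more than n - 5 changes at one of its ends, so
-- that graphs differing in at most n - 5 = d_max/3 - 4 places at every vertex
-- are equal; the edit distance bounds the changes at each vertex, and t(n²) is
-- eventually at most n/2.  An isomorphism of the graphs permutes the three
-- classes of lines, which makes the groups isotopic or anti-isotopic, and hence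
-- isomorphic.
--
-- A + 3I is the sum of l lᵀ over the indicator vectors l of the lines.  Their
-- Gram matrix depends on n only, so by Witt's theorem a rational orthogonal
-- matrix carries the lines of one graph to those of the other, and the two
-- graphs are cospectral.
--
-- The graph is computed from the Cayley table in polynomial time; the finitely
-- many groups that are too small for t are compared by a table built into the
-- program.

module Submission where

open import Defs
open import Algebra.Bundles using (CommutativeRing; Group)
import Algebra.Properties.Group as GroupProperties
import Algebra.Properties.Semiring.Sum as SemiringSum
open import Algebra.Morphism.Structures using (module GroupMorphisms)
open import Algebra.Structures using (IsGroup)
open import Data.Bool.Base using (Bool; true; false; if_then_else_; not; _∧_; _∨_; T)
import Data.Bool.Properties as Bool
open import Data.Empty using (⊥; ⊥-elim)
open import Data.Fin.Base as Fin′ using (Fin; zero; suc; toℕ; combine; remQuot; punchIn; punchOut; finToFun; funToFin)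
open import Data.Fin.Patterns using (0F; 1F; 2F)
import Data.Fin.Properties as Fin
open import Data.Integer.Base as ℤ using (ℤ)
import Data.Integer.Properties as ℤ
open import Data.List.Base as List using (List; []; _∷_; length; filterᵇ; allFin; tabulate; cartesianProduct)
open import Data.List.Membership.Propositional using (_∈_)
open import Data.List.Membership.Propositional.Properties
  using (∈-filter⁺; ∈-filter⁻; ∈-allFin; ∈-cartesianProduct⁺; ∈-lookup; ∈-map⁺)
import Data.List.Properties as List
import Data.List.Relation.Unary.Any as Any
open import Data.List.Relation.Unary.Any.Properties using (lookup-index)
import Data.List.Relation.Unary.All as All
open import Data.List.Relation.Unary.Unique.Propositional using (Unique; _∷_; [])
import Data.List.Relation.Unary.Unique.Propositional.Properties as Unique
open import Data.Nat.Base as ℕ using (ℕ; zero; suc; _+_; _*_; _∸_; _≤_; _<_; z≤n; s≤s; NonZero)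
import Data.Nat.Properties as ℕ
open import Data.List.Extrema.Nat using (max≤v⁺; v≤max⁺)
import Data.List.Relation.Unary.All.Properties as All
import Data.Rational.Unnormalised.Base as ℚᵘ
open import Data.Nat.Coprimality using (1-coprimeTo) renaming (sym to coprime-sym)
open import Data.Nat.Solver using (module +-*-Solver)
open import Data.Product.Base using (∃-syntax; Σ-syntax; _×_; _,_; proj₁; proj₂; uncurry)
open import Data.Rational.Base as ℚ using (ℚ; 0ℚ; 1ℚ; ½)
import Data.Rational.Properties as ℚ
import Data.Rational.Solver as ℚSolver
open import Data.Sum.Base using (_⊎_; inj₁; inj₂)
open import Data.Unit.Base using (⊤; tt)
open import Data.Vec.Functional using (Vector)
open import Function.Base using (_∘_; id)
open import Function.Bundles using (_↣_; mk↣; _⇔_; mk⇔; module Injection; module Equivalence)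
open import Relation.Binary.Definitions using (tri<; tri≈; tri>)
open import Relation.Binary.PropositionalEquality
  using (_≡_; _≢_; refl; sym; trans; cong; cong₂; subst; subst₂; module ≡-Reasoning)
open import Relation.Nullary.Decidable
  using (Dec; proof; from-yes; yes; no; does; dec-true; dec-false; does-⇔; map′; _×-dec_; _→-dec_; ¬?)
open import Relation.Nullary.Negation.Core using (¬_; contradiction)
open import Relation.Nullary.Reflects using (Reflects; ofʸ; ofⁿ)

-- Counting neighbours

-- Equality and order of the reals, as Cauchy sequences, are undecidable, so eigenvalues,
-- orthonormal bases and minima over real numbers cannot simply be computed. This is why the graphs
-- are related by an orthogonal matrix with rational entries: the case distinctions of Witt's
-- theorem fall on rationals, and the matrix acts on a real vector separately at each term of its
-- sequences, where rational identities suffice. It carries any given basis of an eigenspace to a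
-- basis of the other one, and no eigenvalue is ever computed. The constant 5 comes from regularity.
-- Equal degrees make the edges lost at a vertex as many as those gained, so the changes there are
-- twice the losses; with a and b losses at the ends of a lost edge, n + 2 ≤ 6 + a + b, where the 2
-- stands for the two ends themselves. On the side of programs, the assumed algorithm is guaranteed
-- only on an initial store, and compositions have to control sizes as well as times. Each building
-- block therefore states which variables it leaves alone and how much its output can grow.

module ℕ-Sum = SemiringSum ℕ.+-*-semiring
open ℕ-Sum public using () renaming (sum to sumℕ)

𝟙 : Bool → ℕ
𝟙 b = if b then 1 else 0

count : ∀ {n} → (Fin n → Bool) → ℕ
count {n} p = length (filterᵇ p (allFin n))

length-filter-tabulate : ∀ {A : Set} {n} (p : A → Bool) (f : Fin n → A) →
  length (filterᵇ p (tabulate f)) ≡ sumℕ (𝟙 ∘ p ∘ f)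
length-filter-tabulate {n = zero}  p f = refl
length-filter-tabulate {n = suc n} p f with p (f zero)
... | true  = cong suc (length-filter-tabulate p (f ∘ suc))
... | false = length-filter-tabulate p (f ∘ suc)

count≡sum : ∀ {n} (p : Fin n → Bool) → count p ≡ sumℕ (𝟙 ∘ p)
count≡sum p = length-filter-tabulate p id

sumℕ-mono-≤ : ∀ {n} {f g : Fin n → ℕ} → (∀ i → f i ≤ g i) → sumℕ f ≤ sumℕ g
sumℕ-mono-≤ {zero}  f≤g = z≤n
sumℕ-mono-≤ {suc n} f≤g = ℕ.+-mono-≤ (f≤g zero) (sumℕ-mono-≤ (f≤g ∘ suc))

T⇒≡ : ∀ {b} → T b → b ≡ true
T⇒≡ {true} _ = refl

≡⇒T : ∀ {b} → b ≡ true → T b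
≡⇒T refl = tt

lookup-injective : ∀ {A : Set} {xs : List A} → Unique xs →
  ∀ i j → List.lookup xs i ≡ List.lookup xs j → i ≡ j
lookup-injective (x ∷ u) zero    zero    eq = refl
lookup-injective (x ∷ u) zero    (suc j) eq = contradiction eq (All.lookup x (∈-lookup j))
lookup-injective (x ∷ u) (suc i) zero    eq = contradiction (sym eq) (All.lookup x (∈-lookup i))
lookup-injective (x ∷ u) (suc i) (suc j) eq = cong suc (lookup-injective u i j eq)

injection⇒≤length : ∀ {A : Set} {k} (xs : List A) (f : Fin k → A) →
  (∀ {i j} → f i ≡ f j → i ≡ j) → (∀ i → f i ∈ xs) → k ≤ length xs
injection⇒≤length xs f inj f∈ = Fin.injective⇒≤ {f = Any.index ∘ f∈} λ {i} {j} eq →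
  inj (trans (lookup-index (f∈ i)) (trans (cong (List.lookup xs) eq) (sym (lookup-index (f∈ j)))))

injection⇒≤count : ∀ {k n} {p : Fin n → Bool} (f : Fin k → Fin n) →
  (∀ {i j} → f i ≡ f j → i ≡ j) → (∀ i → p (f i) ≡ true) → k ≤ count p
injection⇒≤count f inj pf = injection⇒≤length _ f inj λ i →
  ∈-filter⁺ _ (∈-allFin (f i)) (≡⇒T (pf i))

cover⇒count≤ : ∀ {k n} {p : Fin n → Bool} (f : Fin k → Fin n) →
  (∀ v → p v ≡ true → ∃[ x ] f x ≡ v) → count p ≤ k
cover⇒count≤ {k} {n} {p} f cov = Fin.injective⇒≤ {f = proj₁ ∘ pre} λ {i} {j} eq →
  lookup-injective (Unique.filter⁺ (Bool.T? ∘ p) (Unique.allFin⁺ n)) i j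
    (trans (sym (proj₂ (pre i))) (trans (cong f eq) (proj₂ (pre j))))
  where
  pre : ∀ i → ∃[ x ] f x ≡ List.lookup (filterᵇ p (allFin n)) i
  pre i = cov _ (T⇒≡ (proj₂ (∈-filter⁻ (Bool.T? ∘ p) {xs = allFin n} (∈-lookup i))))

count-≡ : ∀ {k n} {p : Fin n → Bool} (f : Fin k → Fin n) →
  (∀ {i j} → f i ≡ f j → i ≡ j) → (∀ i → p (f i) ≡ true) →
  (∀ v → p v ≡ true → ∃[ x ] f x ≡ v) → count p ≡ k
count-≡ f inj pf cov = ℕ.≤-antisym (cover⇒count≤ f cov) (injection⇒≤count f inj pf)

does-true : ∀ {P : Set} (P? : Dec P) → does P? ≡ true → P
does-true (yes p) _ = p

does-false : ∀ {P : Set} (P? : Dec P) → does P? ≡ false → ¬ P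
does-false (no ¬p) _ = ¬p

count-singleton : ∀ {n} (u : Fin n) → count (λ w → does (w Fin.≟ u)) ≡ 1
count-singleton u = count-≡ {k = 1} (λ _ → u) (λ { {zero} {zero} _ → refl })
  (λ _ → dec-true (u Fin.≟ u) refl) (λ v eq → zero , sym (does-true (v Fin.≟ u) eq))

-- Rigidity of Latin square graphs under few changes

both : ∀ {N} → Graph N → Fin N → Fin N → Fin N → Bool
both G u v w = adj G u w ∧ adj G v w

common : ∀ {N} → Graph N → Fin N → Fin N → ℕ
common G u v = count (both G u v)

differ : ∀ {N} → Graph N → Graph N → Fin N → Fin N → Bool
differ G H u v = (adj G u v ∧ not (adj H u v)) ∨ (adj H u v ∧ not (adj G u v))

distanceAt : ∀ {N} → Graph N → Graph N → Fin N → ℕ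
distanceAt G H v = count (differ G H v)

private
  lost : ∀ {N} → Graph N → Graph N → Fin N → Fin N → Bool
  lost G H v w = adj G v w ∧ not (adj H v w)

  missing : ∀ {N} → Graph N → Graph N → Fin N → ℕ
  missing G H v = count (lost G H v)

  sum₂ : ∀ {N} (p q : Fin N → Bool) → sumℕ (λ w → 𝟙 (p w) + 𝟙 (q w)) ≡ count p + count q
  sum₂ p q = trans (ℕ-Sum.∑-distrib-+ (𝟙 ∘ p) (𝟙 ∘ q))
    (sym (cong₂ _+_ (count≡sum p) (count≡sum q)))

  sum₃ : ∀ {N} (p q r : Fin N → Bool) →
    sumℕ (λ w → 𝟙 (p w) + 𝟙 (q w) + 𝟙 (r w)) ≡ count p + count q + count r
  sum₃ p q r = trans (ℕ-Sum.∑-distrib-+ (λ w → 𝟙 (p w) + 𝟙 (q w)) (𝟙 ∘ r))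
    (cong₂ _+_ (sum₂ p q) (sym (count≡sum r)))

  𝟙-balance : ∀ a c → 𝟙 (a ∧ not c) + 𝟙 c ≡ 𝟙 (c ∧ not a) + 𝟙 a
  𝟙-balance true  true  = refl
  𝟙-balance true  false = refl
  𝟙-balance false true  = refl
  𝟙-balance false false = refl

  𝟙-split : ∀ a c → 𝟙 ((a ∧ not c) ∨ (c ∧ not a)) ≡ 𝟙 (a ∧ not c) + 𝟙 (c ∧ not a)
  𝟙-split true  true  = refl
  𝟙-split true  false = refl
  𝟙-split false true  = refl
  𝟙-split false false = refl

  𝟙-lost : ∀ a b c d → 𝟙 (a ∧ b) ≤ 𝟙 (c ∧ d) + 𝟙 (a ∧ not c) + 𝟙 (b ∧ not d)
  𝟙-lost false b     c     d     = z≤n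
  𝟙-lost true  false c     d     = z≤n
  𝟙-lost true  true  true  true  = ℕ.≤-refl
  𝟙-lost true  true  true  false = ℕ.≤-refl
  𝟙-lost true  true  false true  = ℕ.≤-refl
  𝟙-lost true  true  false false = s≤s z≤n

distanceAt≡ : ∀ {N} (G H : Graph N) v → distanceAt G H v ≡ missing G H v + missing H G v
distanceAt≡ G H v = trans (count≡sum (differ G H v))
  (trans (ℕ-Sum.sum-cong-≗ λ w → 𝟙-split (adj G v w) (adj H v w)) (sum₂ (lost G H v) (lost H G v)))

-- The edges at `v` that both graphs have cancel from the two degrees; what remains is lost on one
-- side and gained on the other.
missing-symmetric : ∀ {N} (G H : Graph N) v → degree G v ≡ degree H v → missing G H v ≡ missing H G v
missing-symmetric G H v eq = ℕ.+-cancelʳ-≡ (degree H v) _ _ (begin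
  missing G H v + degree H v  ≡⟨ sum₂ (lost G H v) (adj H v) ⟨
  sumℕ (λ w → 𝟙 (lost G H v w) + 𝟙 (adj H v w))
                              ≡⟨ ℕ-Sum.sum-cong-≗ (λ w → 𝟙-balance (adj G v w) (adj H v w)) ⟩
  sumℕ (λ w → 𝟙 (lost H G v w) + 𝟙 (adj G v w))
                              ≡⟨ sum₂ (lost H G v) (adj G v) ⟩
  missing H G v + degree G v  ≡⟨ cong (missing H G v +_) eq ⟩
  missing H G v + degree H v  ∎)
  where open ≡-Reasoning

-- A common neighbour of u and v in G is one in H unless its edge to u or to v
-- is missing; v and u themselves are such missing neighbours of each other.
common-lost : ∀ {N} (G H : Graph N) {u v} → adj G u v ≡ true → adj H u v ≡ false →
  common G u v + 2 ≤ common H u v + missing G H u + missing G H v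
common-lost {N} G H {u} {v} Guv Huv = subst₂ _≤_ left (sum₃ (both H u v) (lost G H u) (lost G H v)) (sumℕ-mono-≤ pointwise)
  where
  is : Fin N → Fin N → Bool
  is x w = does (w Fin.≟ x)

  left : sumℕ (λ w → 𝟙 (both G u v w) + 𝟙 (is u w) + 𝟙 (is v w)) ≡ common G u v + 2
  left = trans (sum₃ (both G u v) (is u) (is v)) (trans (cong₂ (λ a b → common G u v + a + b) (count-singleton u) (count-singleton v))
    (ℕ.+-assoc _ 1 1))

  Gvu : adj G v u ≡ true
  Gvu = trans (symmetric G v u) Guv

  Hvu : adj H v u ≡ false
  Hvu = trans (symmetric H v u) Huv

  pointwise : ∀ w → 𝟙 (both G u v w) + 𝟙 (is u w) + 𝟙 (is v w) ≤
    𝟙 (both H u v w) + 𝟙 (lost G H u w) + 𝟙 (lost G H v w)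
  pointwise w with w Fin.≟ u | w Fin.≟ v
  ... | yes refl | yes refl = contradiction (trans (sym Guv) (irreflexive G u)) λ ()
  ... | yes refl | no _ rewrite irreflexive G u | irreflexive H u | Gvu | Hvu = ℕ.≤-refl
  ... | no _ | yes refl rewrite irreflexive G v | irreflexive H v | Guv | Huv = ℕ.≤-refl
  ... | no _ | no _ = ℕ.≤-trans (ℕ.≤-reflexive (trans (ℕ.+-identityʳ _) (ℕ.+-identityʳ (𝟙 (both G u v w)))))
    (𝟙-lost (adj G u w) (adj G v w) (adj H u w) (adj H v w))

private
  -- Twice the first inequality, combined with the other two, reads 2n + 4 ≤ 2n + 2.
  arithmetic : ∀ n a b → n + 2 ≤ 6 + a + b → 5 + (a + a) ≤ n → 5 + (b + b) ≤ n → ⊥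
  arithmetic n a b h ha hb = ℕ.<-irrefl {n + n + 4} refl (begin-strict
    n + n + 4                                ≡⟨ solve 1 (λ n → n :+ n :+ con 4 := (n :+ con 2) :+ (n :+ con 2)) refl n ⟩
    (n + 2) + (n + 2)                        ≤⟨ ℕ.+-mono-≤ h h ⟩
    (6 + a + b) + (6 + a + b)                ≡⟨ solve 2 (λ a b → (con 6 :+ a :+ b) :+ (con 6 :+ a :+ b)
                                                  := con 2 :+ ((con 5 :+ (a :+ a)) :+ (con 5 :+ (b :+ b)))) refl a b ⟩
    2 + ((5 + (a + a)) + (5 + (b + b)))      ≤⟨ ℕ.+-monoʳ-≤ 2 (ℕ.+-mono-≤ ha hb) ⟩
    2 + (n + n)                              <⟨ ℕ.m<n+m (2 + (n + n)) {2} (s≤s z≤n) ⟩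
    2 + (2 + (n + n))                        ≡⟨ solve 1 (λ n → con 2 :+ (con 2 :+ (n :+ n)) := n :+ n :+ con 4) refl n ⟩
    n + n + 4                                ∎)
    where
    open ℕ.≤-Reasoning
    open +-*-Solver

-- With k = 3(n - 1) these are the parameters (n², 3(n - 1), n, 6) of the strongly regular Latin
-- square graph, the two counts of common neighbours being kept as inequalities.
record LatinLike (n k : ℕ) {N} (G : Graph N) : Set where
  field
    regular     : ∀ v → degree G v ≡ k
    adjacent    : ∀ {u v} → adj G u v ≡ true → n ≤ common G u v
    nonadjacent : ∀ {u v} → u ≢ v → adj G u v ≡ false → common G u v ≤ 6

open LatinLike public

-- The at least n common neighbours of a lost edge fall to at most 6. By `common-lost` the
-- difference is paid for by edges missing at the two ends, more than both ends together may lose.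
rigid : ∀ {n k N} {G H : Graph N} → LatinLike n k G → LatinLike n k H →
  (∀ v → 5 + distanceAt G H v ≤ n) → ∀ {u v} → adj G u v ≡ true → adj H u v ≡ true
rigid {n} {k} {N} {G} {H} g h close {u} {v} Guv with adj H u v in Huv
... | true  = refl
... | false = ⊥-elim (arithmetic n (missing G H u) (missing G H v)
  (ℕ.≤-trans (ℕ.+-monoˡ-≤ 2 (adjacent g Guv))
    (ℕ.≤-trans (common-lost G H Guv Huv)
      (ℕ.+-monoˡ-≤ _ (ℕ.+-monoˡ-≤ _ (nonadjacent h u≢v Huv)))))
  (half u) (half v))
  where
  u≢v : u ≢ v
  u≢v refl = contradiction (trans (sym Guv) (irreflexive G u)) λ ()

  -- By regularity as many edges are gained at `w` as lost, so the distance there is twice the loss.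
  half : ∀ w → 5 + (missing G H w + missing G H w) ≤ n
  half w = subst (λ m → 5 + m ≤ n)
    (trans (distanceAt≡ G H w) (cong (missing G H w +_)
      (sym (missing-symmetric G H w (trans (regular g w) (sym (regular h w)))))))
    (close w)

distanceAt-comm : ∀ {N} (G H : Graph N) v → distanceAt G H v ≡ distanceAt H G v
distanceAt-comm G H v = trans (distanceAt≡ G H v) (trans (ℕ.+-comm (missing G H v) _) (sym (distanceAt≡ H G v)))

rigid-≡ : ∀ {n k N} {G H : Graph N} → LatinLike n k G → LatinLike n k H →
  (∀ v → 5 + distanceAt G H v ≤ n) → ∀ u v → adj G u v ≡ adj H u v
rigid-≡ {n} {G = G} {H} g h close u v with adj G u v in Guv | adj H u v in Huv
... | true  | true  = refl
... | false | false = refl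
... | true  | false = trans (sym (rigid g h close Guv)) Huv
... | false | true  = trans (sym Guv) (rigid h g (λ w → subst (λ m → 5 + m ≤ n) (distanceAt-comm G H w) (close w)) Huv)

-- The graph of a 3-net

-- The lines of the i-th parallel class are the fibres of `coord i`. The total function `point`
-- gives the meet of two lines from different classes; for i = j its value is left open.
record Net (n N : ℕ) : Set where
  field
    coord        : Fin 3 → Fin N → Fin n
    point        : Fin 3 → Fin 3 → Fin n → Fin n → Fin N
    coord-pointˡ : ∀ {i j} x y → i ≢ j → coord i (point i j x y) ≡ x
    coord-pointʳ : ∀ {i j} x y → i ≢ j → coord j (point i j x y) ≡ y
    coord-unique : ∀ {i j u v} → i ≢ j → coord i u ≡ coord i v → coord j u ≡ coord j v → u ≡ v

next : Fin 3 → Fin 3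
next 0F = 1F
next 1F = 2F
next 2F = 0F

next≢ : ∀ i → i ≢ next i
next≢ 0F ()
next≢ 1F ()
next≢ 2F ()

next²≢ : ∀ i → i ≢ next (next i)
next²≢ 0F ()
next²≢ 1F ()
next²≢ 2F ()

module NetGraph {n N} (M : Net n N) where
  open Net M

  Collinear : Fin N → Fin N → Set
  Collinear u v = ∃[ i ] coord i u ≡ coord i v

  collinear? : ∀ u v → Dec (Collinear u v)
  collinear? u v = Fin.any? λ i → coord i u Fin.≟ coord i v

  Adjacent : Fin N → Fin N → Set
  Adjacent u v = u ≢ v × Collinear u v

  adjacent? : ∀ u v → Dec (Adjacent u v)
  adjacent? u v = ¬? (u Fin.≟ v) ×-dec collinear? u v

  Adjacent-sym : ∀ {u v} → Adjacent u v → Adjacent v u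
  Adjacent-sym (u≢v , i , eq) = u≢v ∘ sym , i , sym eq

  graph : Graph N
  adj         graph u v = does (adjacent? u v)
  symmetric   graph u v = does-⇔ (mk⇔ Adjacent-sym Adjacent-sym) (adjacent? u v) (adjacent? v u)
  irreflexive graph v = dec-false (adjacent? v v) λ (v≢v , _) → v≢v refl

  adj⇒ : ∀ {u v} → adj graph u v ≡ true → Adjacent u v
  adj⇒ {u} {v} = does-true (adjacent? u v)

  ⇒adj : ∀ {u v} → Adjacent u v → adj graph u v ≡ true
  ⇒adj {u} {v} = dec-true (adjacent? u v)

  both⇒ : ∀ {u v w} → both graph u v w ≡ true → Adjacent u w × Adjacent v w
  both⇒ {u} {v} {w} eq with adj graph u w in eu | adj graph v w in ev
  ... | true | true = adj⇒ eu , adj⇒ ev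

  ⇒both : ∀ {u v w} → Adjacent u w → Adjacent v w → both graph u v w ≡ true
  ⇒both au av = cong₂ _∧_ (⇒adj au) (⇒adj av)

  coord-distinct : ∀ {i j u v} → i ≢ j → u ≢ v → coord i u ≡ coord i v → coord j u ≢ coord j v
  coord-distinct i≢j u≢v eq eq′ = u≢v (coord-unique i≢j eq eq′)

  module _ {u v i} (u≢v : u ≢ v) (uv : coord i u ≡ coord i v) where
    private
      j k : Fin 3
      j = next i
      k = next j

      i≢j : i ≢ j
      i≢j = next≢ i

      k≢j : k ≢ j
      k≢j = next≢ j ∘ sym

      k≢i : k ≢ i
      k≢i = next²≢ i ∘ sym

    -- On the common line of u and v every j-coordinate y occurs once, but for two values the point
    -- is u or v itself. These values are served off the line, where the k-line of one end meets the
    -- j-line of the other.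
    commonNeighbour : Fin n → Fin N
    commonNeighbour y with y Fin.≟ coord j u | y Fin.≟ coord j v
    ... | yes _ | _     = point k j (coord k v) y
    ... | no _  | yes _ = point k j (coord k u) y
    ... | no _  | no _  = point i j (coord i u) y

    coord-commonNeighbour : ∀ y → coord j (commonNeighbour y) ≡ y
    coord-commonNeighbour y with y Fin.≟ coord j u | y Fin.≟ coord j v
    ... | yes _ | _     = coord-pointʳ (coord k v) y k≢j
    ... | no _  | yes _ = coord-pointʳ (coord k u) y k≢j
    ... | no _  | no _  = coord-pointʳ (coord i u) y i≢j

    commonNeighbour-adjacent : ∀ y → Adjacent u (commonNeighbour y) × Adjacent v (commonNeighbour y)
    commonNeighbour-adjacent y with y Fin.≟ coord j u | y Fin.≟ coord j v
    ... | yes refl | _ =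
      ((λ eq → coord-distinct (k≢i ∘ sym) u≢v uv (trans (cong (coord k) eq) (coord-pointˡ _ _ k≢j)))
        , j , sym (coord-pointʳ _ _ k≢j)) ,
      ((λ eq → coord-distinct i≢j u≢v uv (sym (trans (cong (coord j) eq) (coord-pointʳ _ _ k≢j))))
        , k , sym (coord-pointˡ _ _ k≢j))
    ... | no y≢ | yes refl =
      ((λ eq → y≢ (sym (trans (cong (coord j) eq) (coord-pointʳ _ _ k≢j)))) , k , sym (coord-pointˡ _ _ k≢j)) ,
      ((λ eq → coord-distinct (k≢i ∘ sym) u≢v uv (sym (trans (cong (coord k) eq) (coord-pointˡ _ _ k≢j))))
        , j , sym (coord-pointʳ _ _ k≢j))
    ... | no y≢u | no y≢v =
      ((λ eq → y≢u (sym (trans (cong (coord j) eq) (coord-pointʳ _ _ i≢j)))) , i , sym (coord-pointˡ _ _ i≢j)) ,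
      ((λ eq → y≢v (sym (trans (cong (coord j) eq) (coord-pointʳ _ _ i≢j)))) , i , trans (sym uv) (sym (coord-pointˡ _ _ i≢j)))

    common≥ : n ≤ common graph u v
    common≥ = injection⇒≤count commonNeighbour
      (λ {y} {y′} eq → trans (sym (coord-commonNeighbour y)) (trans (cong (coord j) eq) (coord-commonNeighbour y′)))
      (λ y → let au , av = commonNeighbour-adjacent y in ⇒both au av)

  -- A common neighbour is the meet of a line through u and a line through v. Their classes differ,
  -- as u and v are not collinear, which leaves 3 · 2 pairs of classes.
  common≤ : ∀ {u v} → u ≢ v → adj graph u v ≡ false → common graph u v ≤ 6
  common≤ {u} {v} u≢v non = cover⇒count≤ {k = 6} candidate covered
    where
    not-collinear : ∀ i → coord i u ≢ coord i v
    not-collinear i eq = does-false (adjacent? u v) non (u≢v , i , eq)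

    meet : Fin 3 × Fin 2 → Fin N
    meet (i , b) = point i (punchIn i b) (coord i u) (coord (punchIn i b) v)

    candidate : Fin 6 → Fin N
    candidate = meet ∘ remQuot 2

    covered : ∀ w → both graph u v w ≡ true → ∃[ x ] candidate x ≡ w
    covered w eq with both⇒ eq
    ... | (_ , i , uw) , (_ , j , vw) = combine i b , trans (cong meet (Fin.remQuot-combine i b)) meet≡w
      where
      i≢j : i ≢ j
      i≢j refl = not-collinear i (trans uw (sym vw))

      b : Fin 2
      b = punchOut i≢j

      meet≡w : meet (i , b) ≡ w
      meet≡w = coord-unique i≢j
        (trans (coord-pointˡ _ _ (Fin.punchInᵢ≢i i b ∘ sym)) uw)
        (trans (subst (λ h → coord j (point i h (coord i u) (coord h v)) ≡ coord j v)
          (sym (Fin.punchIn-punchOut i≢j)) (coord-pointʳ _ _ i≢j)) vw)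

module _ {m N} (M : Net (suc m) N) where
  open Net M
  open NetGraph M

  private
    neighbour : Fin N → Fin 3 × Fin m → Fin N
    neighbour u (i , x) = point i (next i) (coord i u) (punchIn (coord (next i) u) x)

    shared : ∀ u i x → coord i (neighbour u (i , x)) ≡ coord i u
    shared u i x = coord-pointˡ _ _ (next≢ i)

    other : ∀ u i x → coord (next i) (neighbour u (i , x)) ≡ punchIn (coord (next i) u) x
    other u i x = coord-pointʳ _ _ (next≢ i)

    neighbour≢ : ∀ u i x → neighbour u (i , x) ≢ u
    neighbour≢ u i x eq = Fin.punchInᵢ≢i (coord (next i) u) x
      (trans (sym (other u i x)) (cong (coord (next i)) eq))

    neighbour-injective : ∀ u {p q} → neighbour u p ≡ neighbour u q → p ≡ q
    neighbour-injective u {i , x} {j , y} eq with i Fin.≟ j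
    ... | yes refl = cong (i ,_) (Fin.punchIn-injective (coord (next i) u) x y
      (trans (sym (other u i x)) (trans (cong (coord (next i)) eq) (other u i y))))
    ... | no i≢j = ⊥-elim (neighbour≢ u i x (coord-unique i≢j (shared u i x)
      (trans (cong (coord j) eq) (shared u j y))))

  netGraph-degree : ∀ u → degree graph u ≡ 3 * m
  netGraph-degree u = count-≡ (neighbour u ∘ remQuot m)
    (λ {a} {b} eq → trans (sym (Fin.combine-remQuot {3} m a))
      (trans (cong (uncurry combine) (neighbour-injective u {remQuot m a} {remQuot m b} eq)) (Fin.combine-remQuot {3} m b)))
    (λ a → let i , x = remQuot {3} m a in ⇒adj (neighbour≢ u i x ∘ sym , i , sym (shared u i x)))
    covered
    where
    covered : ∀ v → adj graph u v ≡ true → ∃[ a ] neighbour u (remQuot m a) ≡ v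
    covered v eq with adj⇒ eq
    ... | u≢v , i , uv = combine i x , trans (cong (neighbour u) (Fin.remQuot-combine i x))
      (coord-unique (next≢ i) (trans (shared u i x) uv)
        (trans (other u i x) (Fin.punchIn-punchOut differs)))
      where
      differs : coord (next i) u ≢ coord (next i) v
      differs = coord-distinct (next≢ i) u≢v uv

      x : Fin m
      x = punchOut differs

  netGraph-latinLike : LatinLike (suc m) (3 * m) graph
  LatinLike.regular     netGraph-latinLike = netGraph-degree
  LatinLike.adjacent    netGraph-latinLike eq = let u≢v , i , uv = adj⇒ eq in common≥ u≢v uv
  LatinLike.nonadjacent netGraph-latinLike = common≤

-- Isomorphisms of net graphs

avoid : ∀ {n} (xs : List (Fin n)) → length xs < n → ∃[ y ] ¬ (y ∈ xs)
avoid {n} xs short with Fin.any? (λ y → ¬? (Any.any? (y Fin.≟_) xs))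
... | yes (y , y∉) = y , y∉
... | no none = contradiction (injection⇒≤length xs id id λ y → member y) (ℕ.<⇒≱ short)
  where
  member : ∀ y → y ∈ xs
  member y with Any.any? (y Fin.≟_) xs
  ... | yes y∈ = y∈
  ... | no y∉ = contradiction (y , y∉) none

abstract
  third : ∀ (i j : Fin 3) → i ≢ j → ∃[ l ] l ≢ i × l ≢ j × (∀ k → k ≢ i → k ≢ j → k ≡ l)
  third = from-yes (Fin.all? {n = 3} λ i → Fin.all? λ j → ¬? (i Fin.≟ j) →-dec Fin.any? λ l →
    ¬? (l Fin.≟ i) ×-dec (¬? (l Fin.≟ j) ×-dec Fin.all? λ k →
    ¬? (k Fin.≟ i) →-dec (¬? (k Fin.≟ j) →-dec (k Fin.≟ l))))

module NetIsomorphism {n N} (5≤n : 5 ≤ n) (M M′ : Net n N) (ψ : Fin N → Fin N)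
  (ψ-injective : ∀ {u v} → ψ u ≡ ψ v → u ≡ v)
  (preserves : ∀ {u v} → NetGraph.Adjacent M u v → NetGraph.Adjacent M′ (ψ u) (ψ v))
  (reflects : ∀ {u v} → NetGraph.Adjacent M′ (ψ u) (ψ v) → NetGraph.Adjacent M u v) where

  open Net M
  open Net M′ using () renaming (coord to coord′; coord-unique to coord-unique′)
  open NetGraph M using (Adjacent)
  open NetGraph M′ using () renaming (Adjacent to Adjacent′)

  private
    _-pointed : ∀ {k} → k ≤ 4 → k < n
    h -pointed = ℕ.≤-trans (s≤s h) 5≤n

  -- Hence three points with two further common neighbours must be collinear.
  triangle : ∀ {a b c x y w z} → a ≢ b → b ≢ c → a ≢ c → x ≢ y → x ≢ w →
    coord′ a x ≡ coord′ a y → coord′ b y ≡ coord′ b w → coord′ c x ≡ coord′ c w →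
    Adjacent′ x z → Adjacent′ y z → Adjacent′ w z →
    coord′ a z ≡ coord′ a w × coord′ b z ≡ coord′ b x
  triangle {a} {b} {c} {x} {y} {w} {z} a≢b b≢c a≢c x≢y x≢w xy yw xw
    (x≢z , i , xz) (y≢z , j , yz) (w≢z , k , wz) = result
    where
    split : ∀ h → h ≡ a ⊎ h ≡ b ⊎ h ≡ c
    split h with h Fin.≟ a | h Fin.≟ b
    ... | yes eq | _ = inj₁ eq
    ... | no _ | yes eq = inj₂ (inj₁ eq)
    ... | no h≢a | no h≢b = let l , _ , _ , u = third a b a≢b in
      inj₂ (inj₂ (trans (u h h≢a h≢b) (sym (u c (a≢c ∘ sym) (b≢c ∘ sym)))))

    result : coord′ a z ≡ coord′ a w × coord′ b z ≡ coord′ b x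
    result with split i
    result | inj₁ refl with split k
    ... | inj₁ refl = contradiction (coord-unique′ a≢c (trans xz (sym wz)) xw) x≢w
    ... | inj₂ (inj₁ refl) = contradiction (coord-unique′ a≢b (trans (sym xy) xz) (trans yw wz)) y≢z
    ... | inj₂ (inj₂ refl) = contradiction (coord-unique′ a≢c xz (trans xw wz)) x≢z
    result | inj₂ (inj₂ refl) with split j
    ... | inj₁ refl = contradiction (coord-unique′ a≢c (trans xy yz) xz) x≢z
    ... | inj₂ (inj₁ refl) = contradiction (coord-unique′ b≢c (trans (sym yw) yz) (trans (sym xw) xz)) w≢z
    ... | inj₂ (inj₂ refl) = contradiction (coord-unique′ a≢c xy (trans xz (sym yz))) x≢y
    result | inj₂ (inj₁ refl) with split k
    -- The only consistent case: z completes the triangle opposite to its side in class c, and is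
    -- unique.
    ... | inj₁ refl = sym wz , sym xz
    ... | inj₂ (inj₁ refl) = contradiction (coord-unique′ b≢c (trans xz (sym wz)) xw) x≢w
    ... | inj₂ (inj₂ refl) = contradiction (coord-unique′ b≢c xz (trans xw wz)) x≢z

  -- Otherwise the images form a triangle with sides in three different classes, and `triangle`
  -- forces every common neighbour of all three corners to one place. Since 5 ≤ n, the original line
  -- has two points p and q besides u, v and w, whose images would then coincide.
  onLine : ∀ {i u v w} → u ≢ v → u ≢ w → v ≢ w → coord i u ≡ coord i v → coord i u ≡ coord i w →
    ∃[ j ] coord′ j (ψ u) ≡ coord′ j (ψ v) × coord′ j (ψ u) ≡ coord′ j (ψ w)
  onLine {i} {u} {v} {w} u≢v u≢w v≢w uv uw
    with preserves (u≢v , i , uv) | preserves (v≢w , i , trans (sym uv) uw) | preserves (u≢w , i , uw)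
  ... | ψu≢ψv , a , ea | _ , b , eb | ψu≢ψw , c , ec with a Fin.≟ b | b Fin.≟ c | a Fin.≟ c
  ... | yes refl | _ | _ = a , ea , trans ea eb
  ... | _ | yes refl | _ = b , trans ec (sym eb) , ec
  ... | _ | _ | yes refl = a , ea , ec
  ... | no a≢b | no b≢c | no a≢c = contradiction p≡q p≢q
    where
    k : Fin 3
    k = next i

    known : List (Fin n)
    known = coord k u ∷ coord k v ∷ coord k w ∷ []

    y : ∃[ y ] ¬ (y ∈ known)
    y = avoid known (s≤s (s≤s (s≤s z≤n)) -pointed)

    y′ : ∃[ y′ ] ¬ (y′ ∈ (proj₁ y ∷ known))
    y′ = avoid (proj₁ y ∷ known) (s≤s (s≤s (s≤s (s≤s z≤n))) -pointed)

    p q : Fin N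
    p = point i k (coord i u) (proj₁ y)
    q = point i k (coord i u) (proj₁ y′)

    meets : ∀ {z x} → ¬ (z ∈ known) → x ∈ (u ∷ v ∷ w ∷ []) → coord i x ≡ coord i u →
      Adjacent x (point i k (coord i u) z)
    meets {z} {x} z∉ x∈ xu =
      (λ eq → z∉ (subst (_∈ known) (trans (cong (coord k) eq) (coord-pointʳ _ _ (next≢ i))) (known∈ x∈))) ,
      i , trans xu (sym (coord-pointˡ _ _ (next≢ i)))
      where
      known∈ : x ∈ (u ∷ v ∷ w ∷ []) → coord k x ∈ known
      known∈ (Any.here refl) = Any.here refl
      known∈ (Any.there (Any.here refl)) = Any.there (Any.here refl)
      known∈ (Any.there (Any.there (Any.here refl))) = Any.there (Any.there (Any.here refl))

    apex : ∀ z → ¬ (z ∈ known) → let r = ψ (point i k (coord i u) z) in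
      coord′ a r ≡ coord′ a (ψ w) × coord′ b r ≡ coord′ b (ψ u)
    apex z z∉ = triangle a≢b b≢c a≢c ψu≢ψv ψu≢ψw ea eb ec
      (preserves (meets z∉ (Any.here refl) refl))
      (preserves (meets z∉ (Any.there (Any.here refl)) (sym uv)))
      (preserves (meets z∉ (Any.there (Any.there (Any.here refl))) (sym uw)))

    p≡q : p ≡ q
    p≡q = let pa , pb = apex _ (proj₂ y)
              qa , qb = apex _ (proj₂ y′ ∘ Any.there)
          in ψ-injective (coord-unique′ a≢b (trans pa (sym qa)) (trans pb (sym qb)))

    p≢q : p ≢ q
    p≢q eq = proj₂ y′ (Any.here (trans (sym (coord-pointʳ _ _ (next≢ i)))
      (trans (cong (coord k) (sym eq)) (coord-pointʳ _ _ (next≢ i)))))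

  Line : Fin N → Fin 3 → Fin 3 → Set
  Line u i j = ∀ v → coord i u ≡ coord i v → coord′ j (ψ u) ≡ coord′ j (ψ v)

  anotherPoint : ∀ u i → ∃[ v ] u ≢ v × coord i u ≡ coord i v
  anotherPoint u i with avoid (coord (next i) u ∷ []) (s≤s z≤n -pointed)
  ... | y , y∉ = point i (next i) (coord i u) y
    , (λ eq → y∉ (Any.here (sym (trans (cong (coord (next i)) eq) (coord-pointʳ _ _ (next≢ i))))))
    , sym (coord-pointˡ _ _ (next≢ i))

  same-index : ∀ {u v i j} → u ≢ v → coord′ i (ψ u) ≡ coord′ i (ψ v) → coord′ j (ψ u) ≡ coord′ j (ψ v) → i ≡ j
  same-index {i = i} {j} u≢v ei ej with i Fin.≟ j
  ... | yes eq = eq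
  ... | no i≢j = contradiction (ψ-injective (coord-unique′ i≢j ei ej)) u≢v

  -- The class j is read off at a second point of the line. By `onLine` a third point shares some
  -- class with both, and it is again j because two distinct points share at most one.
  line : ∀ u i → ∃[ j ] Line u i j
  line u i with anotherPoint u i
  ... | v , u≢v , uv with preserves (u≢v , i , uv)
  ... | _ , j , ej = j , along
    where
    along : Line u i j
    along w uw with u Fin.≟ w | v Fin.≟ w
    ... | yes refl | _ = refl
    ... | no _ | yes refl = ej
    ... | no u≢w | no v≢w with onLine u≢v u≢w v≢w uv uw
    ... | j′ , ev , ew = subst (λ j → coord′ j (ψ u) ≡ coord′ j (ψ w)) (same-index u≢v ev ej) ew

  -- If lines of two classes through u went to one line, a point v of the first and a point w of the
  -- second would have adjacent images. The coordinate z is chosen so that w is neither u nor on the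
  -- third line through v, hence v and w are not collinear, against `reflects`.
  line-injective : ∀ {u i j k} → i ≢ j → Line u i k → ¬ Line u j k
  line-injective {u} {i} {j} {k} i≢j li lj with third i j i≢j | anotherPoint u i
  ... | l , l≢i , l≢j , only | v , u≢v , uv with avoid (coord l u ∷ coord l v ∷ []) (s≤s (s≤s z≤n) -pointed)
  ... | z , z∉ = not-collinear (proj₂ (reflects (v≢w ∘ ψ-injective , k , trans (sym (li v uv)) (lj w uw))))
    where
    w : Fin N
    w = point j l (coord j u) z

    uw : coord j u ≡ coord j w
    uw = sym (coord-pointˡ _ _ (l≢j ∘ sym))

    wl : coord l w ≡ z
    wl = coord-pointʳ _ _ (l≢j ∘ sym)

    not-collinear : ¬ (∃[ h ] coord h v ≡ coord h w)
    not-collinear (h , eq) with h Fin.≟ i | h Fin.≟ j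
    ... | yes refl | _ = z∉ (Any.here (trans (sym wl) (cong (coord l) (sym (coord-unique i≢j (trans uv eq) uw)))))
    ... | no _ | yes refl = u≢v (coord-unique i≢j uv (trans uw (sym eq)))
    ... | no h≢i | no h≢j with refl ← only h h≢i h≢j = z∉ (Any.there (Any.here (sym (trans eq wl))))

    v≢w : v ≢ w
    v≢w eq = not-collinear (i , cong (coord i) eq)

  along-line : ∀ {u v i j} → coord i u ≡ coord i v → Line u i j → Line v i j
  along-line uv l w vw = trans (sym (l _ uv)) (l w (trans uv vw))

  -- Suppose that the class of the image changes from j to j′ between u and v. Their common k-line
  -- has one image class t, so the third class h at u and the class i at v both go to the class
  -- other than j and t. At the meet of the h-line of u with the i-line of v two classes then have
  -- the same image.
  across-line : ∀ {u v i j k} → i ≢ k → coord k u ≡ coord k v → Line u i j → Line v i j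
  across-line {u} {v} {i} {j} {k} i≢k uv l with line v i
  ... | j′ , l′ with j Fin.≟ j′
  ... | yes refl = l′
  ... | no j≢j′ with third i k i≢k | line u k
  ... | h , h≢i , h≢k , _ | t , lk with line u h
  ... | s , lh = contradiction Lwh (line-injective (h≢i ∘ sym) Lwi)
    where
    differs : ∀ {x a b p q} → a ≢ b → Line x a p → Line x b q → p ≢ q
    differs a≢b la lb refl = line-injective a≢b la lb

    w : Fin N
    w = point i h (coord i v) (coord h u)

    s≡j′ : s ≡ j′
    s≡j′ = let x , _ , _ , only = third j t (differs i≢k l lk) in
      trans (only s (differs h≢i lh l) (differs h≢k lh lk))
            (sym (only j′ (j≢j′ ∘ sym) (differs i≢k l′ (along-line uv lk))))

    Lwi : Line w i j′
    Lwi = along-line (sym (coord-pointˡ _ _ (h≢i ∘ sym))) l′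

    Lwh : Line w h j′
    Lwh = subst (Line w h) s≡j′ (along-line (sym (coord-pointʳ _ _ (h≢i ∘ sym))) lh)

  -- Any two points are joined through the point on the `next i`-line of u and the i-line of v.
  everywhere : ∀ {u i j} v → Line u i j → Line v i j
  everywhere {u} {i} v l = along-line (coord-pointˡ _ _ (next≢ i))
    (across-line (next≢ i) (sym (coord-pointʳ _ _ (next≢ i))) l)

  abstract
    coordinate-permutation : Fin N → Σ[ σ ∈ (Fin 3 → Fin 3) ] (∀ {i j : Fin 3} → σ i ≡ σ j → i ≡ j) ×
      (∀ i {u v} → coord i u ≡ coord i v → coord′ (σ i) (ψ u) ≡ coord′ (σ i) (ψ v))
    coordinate-permutation u = σ , σ-injective , λ i {v} {w} → everywhere v (proj₂ (line u i)) w
      where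
      σ : Fin 3 → Fin 3
      σ i = proj₁ (line u i)

      σ-injective : ∀ {i j} → σ i ≡ σ j → i ≡ j
      σ-injective {i} {j} eq with i Fin.≟ j
      ... | yes i≡j = i≡j
      ... | no i≢j = contradiction (subst (Line u j) (sym eq) (proj₂ (line u j)))
        (line-injective i≢j (proj₂ (line u i)))

-- Cayley tables as 3-nets

-- A `FiniteGroup` with its order as an index, so that two groups of equal order share the carrier
-- `Fin n` without transport.
record GroupOn (n : ℕ) : Set where
  field
    _∙_     : Fin n → Fin n → Fin n
    ε       : Fin n
    _⁻¹     : Fin n → Fin n
    isGroup : IsGroup _≡_ _∙_ ε _⁻¹

  finite : FiniteGroup
  finite = record { isGroup = isGroup }

  group : Group _ _
  group = record { isGroup = isGroup }

  open IsGroup isGroup public using (assoc; identityˡ; identityʳ; inverseˡ; inverseʳ)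
  open GroupProperties group public
    using (identityˡ-unique; inverseˡ-unique; ⁻¹-injective; ⁻¹-anti-homo-∙; ∙-cancelˡ; ∙-cancelʳ)

  x⁻¹[xy]≡y : ∀ x y → (x ⁻¹) ∙ (x ∙ y) ≡ y
  x⁻¹[xy]≡y = GroupProperties.\\-leftDividesʳ group

  x[x⁻¹y]≡y : ∀ x y → x ∙ ((x ⁻¹) ∙ y) ≡ y
  x[x⁻¹y]≡y = GroupProperties.\\-leftDividesˡ group

  [yx]x⁻¹≡y : ∀ x y → (y ∙ x) ∙ (x ⁻¹) ≡ y
  [yx]x⁻¹≡y = GroupProperties.//-rightDividesʳ group

  [yx⁻¹]x≡y : ∀ x y → (y ∙ (x ⁻¹)) ∙ x ≡ y
  [yx⁻¹]x≡y = GroupProperties.//-rightDividesˡ group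

module _ {n} (Γ : GroupOn n) where
  open GroupOn Γ

  private
    pair : Fin n → Fin n → Fin (n * n)
    pair = combine

    coordinate : Fin 3 → Fin n × Fin n → Fin n
    coordinate 0F (a , b) = a
    coordinate 1F (a , b) = b
    coordinate 2F (a , b) = a ∙ b

    meet : Fin 3 → Fin 3 → Fin n → Fin n → Fin n × Fin n
    meet 0F 1F x y = x , y
    meet 1F 0F x y = y , x
    meet 0F 2F x y = x , ((x ⁻¹) ∙ y)
    meet 2F 0F x y = y , ((y ⁻¹) ∙ x)
    meet 1F 2F x y = (y ∙ (x ⁻¹)) , x
    meet 2F 1F x y = (x ∙ (y ⁻¹)) , y
    -- A default for i = j, where `Net` asks nothing.
    meet _  _  x y = x , y

    meetˡ : ∀ i j x y → i ≢ j → coordinate i (meet i j x y) ≡ x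
    meetˡ 0F 0F x y i≢j = contradiction refl i≢j
    meetˡ 0F 1F x y i≢j = refl
    meetˡ 0F 2F x y i≢j = refl
    meetˡ 1F 0F x y i≢j = refl
    meetˡ 1F 1F x y i≢j = contradiction refl i≢j
    meetˡ 1F 2F x y i≢j = refl
    meetˡ 2F 0F x y i≢j = x[x⁻¹y]≡y y x
    meetˡ 2F 1F x y i≢j = [yx⁻¹]x≡y y x
    meetˡ 2F 2F x y i≢j = contradiction refl i≢j

    meetʳ : ∀ i j x y → i ≢ j → coordinate j (meet i j x y) ≡ y
    meetʳ 0F 0F x y i≢j = contradiction refl i≢j
    meetʳ 0F 1F x y i≢j = refl
    meetʳ 0F 2F x y i≢j = x[x⁻¹y]≡y x y
    meetʳ 1F 0F x y i≢j = refl
    meetʳ 1F 1F x y i≢j = contradiction refl i≢j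
    meetʳ 1F 2F x y i≢j = [yx⁻¹]x≡y x y
    meetʳ 2F 0F x y i≢j = refl
    meetʳ 2F 1F x y i≢j = refl
    meetʳ 2F 2F x y i≢j = contradiction refl i≢j

    unique : ∀ i j {p q} → i ≢ j → coordinate i p ≡ coordinate i q → coordinate j p ≡ coordinate j q → p ≡ q
    unique 0F 0F i≢j eq eq′ = contradiction refl i≢j
    unique 0F 1F i≢j refl refl = refl
    unique 0F 2F i≢j refl eq′ = cong (_ ,_) (∙-cancelˡ _ _ _ eq′)
    unique 1F 0F i≢j refl refl = refl
    unique 1F 1F i≢j eq eq′ = contradiction refl i≢j
    unique 1F 2F i≢j refl eq′ = cong (_, _) (∙-cancelʳ _ _ _ eq′)
    unique 2F 0F i≢j eq refl = cong (_ ,_) (∙-cancelˡ _ _ _ eq)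
    unique 2F 1F i≢j eq refl = cong (_, _) (∙-cancelʳ _ _ _ eq)
    unique 2F 2F i≢j eq eq′ = contradiction refl i≢j

    remQuot-injective : ∀ {u v : Fin (n * n)} → remQuot {n} n u ≡ remQuot n v → u ≡ v
    remQuot-injective {u} {v} eq = trans (sym (Fin.combine-remQuot {n} n u))
      (trans (cong (uncurry combine) eq) (Fin.combine-remQuot {n} n v))

  cayleyNet : Net n (n * n)
  Net.coord        cayleyNet i u = coordinate i (remQuot n u)
  Net.point        cayleyNet i j x y = uncurry combine (meet i j x y)
  Net.coord-pointˡ cayleyNet {i} {j} x y i≢j =
    trans (cong (coordinate i) (Fin.remQuot-combine {n} _ _)) (meetˡ i j x y i≢j)
  Net.coord-pointʳ cayleyNet {i} {j} x y i≢j =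
    trans (cong (coordinate j) (Fin.remQuot-combine {n} _ _)) (meetʳ i j x y i≢j)
  Net.coord-unique cayleyNet {i} {j} i≢j eq eq′ = remQuot-injective (unique i j i≢j eq eq′)

  coord-combine : ∀ a b → let open Net cayleyNet in
    coord 0F (combine a b) ≡ a × coord 1F (combine a b) ≡ b × coord 2F (combine a b) ≡ a ∙ b
  coord-combine a b = cong (coordinate 0F) eq , cong (coordinate 1F) eq , cong (coordinate 2F) eq
    where eq = Fin.remQuot-combine {n} {n} a b

-- A missed value could be added to the image, giving an injection of `Fin (suc n)` into `Fin n`.
injective⇒surjective : ∀ {n} (f : Fin n → Fin n) → (∀ {x y} → f x ≡ f y → x ≡ y) → ∀ y → ∃[ x ] f x ≡ y
injective⇒surjective {n} f f-injective y with Fin.any? (λ x → f x Fin.≟ y)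
... | yes hit = hit
... | no miss = contradiction (Fin.injective⇒≤ {f = g} (λ {a} {b} → g-injective a b)) (ℕ.<⇒≱ ℕ.≤-refl)
  where
  g : Fin (suc n) → Fin n
  g zero    = y
  g (suc x) = f x

  g-injective : ∀ a b → g a ≡ g b → a ≡ b
  g-injective zero    zero    eq = refl
  g-injective zero    (suc b) eq = contradiction (b , sym eq) miss
  g-injective (suc a) zero    eq = contradiction (a , eq) miss
  g-injective (suc a) (suc b) eq = cong suc (f-injective eq)

adj-^ : ∀ {N} (G : Graph N) π u v → adj (G ^ π) (Injection.to π u) (Injection.to π v) ≡ adj G u v
adj-^ G π u v with adj G u v in eq
... | true  = dec-true (hit? G π _ _) (u , v , refl , refl , eq)
... | false = dec-false (hit? G π _ _) λ (u′ , v′ , p , q , e) → contradiction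
  (trans (sym (subst₂ (λ u v → adj G u v ≡ true) (Injection.injective π p) (Injection.injective π q) e)) eq) λ ()

-- Isotopy, anti-isotopy and isomorphism of groups

module _ {n} (Γ Δ : GroupOn n) where
  private
    module Γ = GroupOn Γ
    module Δ = GroupOn Δ

  open Γ using (_∙_)
  open Δ using () renaming (_∙_ to _∘′_; _⁻¹ to inv)
  open ≡-Reasoning

  injectiveHomomorphism⇒Isomorphic : (f : Fin n → Fin n) → (∀ {x y} → f x ≡ f y → x ≡ y) →
    (∀ a b → f (a ∙ b) ≡ f a ∘′ f b) → Isomorphic Γ.finite Δ.finite
  injectiveHomomorphism⇒Isomorphic f f-injective homo = f , record
    { isGroupMonomorphism = record
      { isGroupHomomorphism = record
        { isMonoidHomomorphism = record
          { isMagmaHomomorphism = record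
            { isRelHomomorphism = record { cong = cong f }
            ; homo = homo
            }
          ; ε-homo = ε-homo
          }
        ; ⁻¹-homo = λ x → Δ.inverseˡ-unique _ _
            (trans (sym (homo _ x)) (trans (cong f (Γ.inverseˡ x)) ε-homo))
        }
      ; injective = f-injective
      }
    ; surjective = λ y → let x , eq = injective⇒surjective f f-injective y in x , λ z≡x → trans (cong f z≡x) eq
    }
    where
    ε-homo : f Γ.ε ≡ Δ.ε
    ε-homo = Δ.identityˡ-unique (f Γ.ε) (f Γ.ε) (trans (sym (homo Γ.ε Γ.ε)) (cong f (Γ.identityˡ Γ.ε)))

  module _ (p q r : Fin n → Fin n) (p-injective : ∀ {x y} → p x ≡ p y → x ≡ y) where
    private
      f : Fin n → Fin n
      f a = inv (p Γ.ε) ∘′ p a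

      f-injective : ∀ {a b} → f a ≡ f b → a ≡ b
      f-injective eq = p-injective (Δ.∙-cancelˡ _ _ _ eq)

    -- Albert's theorem on isotopic groups. The isotopy is normalised by p(ε)⁻¹; specialising the
    -- hypothesis to the identity in either argument expresses q through f, and then p of a product
    -- through p and f.
    isotopic⇒Isomorphic : (∀ a b → p a ∘′ q b ≡ r (a ∙ b)) → Isomorphic Γ.finite Δ.finite
    isotopic⇒Isomorphic h = injectiveHomomorphism⇒Isomorphic f f-injective λ a b →
      trans (cong (inv (p Γ.ε) ∘′_) (p-homo a b)) (sym (Δ.assoc _ _ _))
      where
      shift : ∀ b → q b ≡ f b ∘′ q Γ.ε
      shift b = begin
        q b                              ≡⟨ Δ.x⁻¹[xy]≡y _ _ ⟨
        inv (p Γ.ε) ∘′ (p Γ.ε ∘′ q b)    ≡⟨ cong (_ ∘′_) (h Γ.ε b) ⟩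
        inv (p Γ.ε) ∘′ r (Γ.ε ∙ b)       ≡⟨ cong (λ x → _ ∘′ r x) (trans (Γ.identityˡ b) (sym (Γ.identityʳ b))) ⟩
        inv (p Γ.ε) ∘′ r (b ∙ Γ.ε)       ≡⟨ cong (_ ∘′_) (h b Γ.ε) ⟨
        inv (p Γ.ε) ∘′ (p b ∘′ q Γ.ε)    ≡⟨ Δ.assoc _ _ _ ⟨
        f b ∘′ q Γ.ε                     ∎

      p-homo : ∀ a b → p (a ∙ b) ≡ p a ∘′ f b
      p-homo a b = Δ.∙-cancelʳ (q Γ.ε) _ _ (begin
        p (a ∙ b) ∘′ q Γ.ε    ≡⟨ h (a ∙ b) Γ.ε ⟩
        r ((a ∙ b) ∙ Γ.ε)     ≡⟨ cong r (Γ.identityʳ _) ⟩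
        r (a ∙ b)             ≡⟨ h a b ⟨
        p a ∘′ q b            ≡⟨ cong (p a ∘′_) (shift b) ⟩
        p a ∘′ (f b ∘′ q Γ.ε) ≡⟨ Δ.assoc _ _ _ ⟨
        (p a ∘′ f b) ∘′ q Γ.ε ∎)

    -- The opposite group is isomorphic to the group by inversion.
    antiIsotopic⇒Isomorphic : (∀ a b → q b ∘′ p a ≡ r (a ∙ b)) → Isomorphic Γ.finite Δ.finite
    antiIsotopic⇒Isomorphic h = injectiveHomomorphism⇒Isomorphic (inv ∘ g) (g-injective ∘ Δ.⁻¹-injective) λ a b →
      trans (cong inv (g-anti a b)) (Δ.⁻¹-anti-homo-∙ (g b) (g a))
      where
      g : Fin n → Fin n
      g a = p a ∘′ inv (p Γ.ε)

      g-injective : ∀ {a b} → g a ≡ g b → a ≡ b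
      g-injective eq = p-injective (Δ.∙-cancelʳ _ _ _ eq)

      shift : ∀ b → q b ≡ q Γ.ε ∘′ g b
      shift b = begin
        q b                              ≡⟨ Δ.[yx]x⁻¹≡y _ _ ⟨
        (q b ∘′ p Γ.ε) ∘′ inv (p Γ.ε)    ≡⟨ cong (_∘′ _) (h Γ.ε b) ⟩
        r (Γ.ε ∙ b) ∘′ inv (p Γ.ε)       ≡⟨ cong (λ x → r x ∘′ _) (trans (Γ.identityˡ b) (sym (Γ.identityʳ b))) ⟩
        r (b ∙ Γ.ε) ∘′ inv (p Γ.ε)       ≡⟨ cong (_∘′ _) (h b Γ.ε) ⟨
        (q Γ.ε ∘′ p b) ∘′ inv (p Γ.ε)    ≡⟨ Δ.assoc _ _ _ ⟩
        q Γ.ε ∘′ g b                     ∎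

      p-anti : ∀ a b → p (a ∙ b) ≡ g b ∘′ p a
      p-anti a b = Δ.∙-cancelˡ (q Γ.ε) _ _ (begin
        q Γ.ε ∘′ p (a ∙ b)    ≡⟨ h (a ∙ b) Γ.ε ⟩
        r ((a ∙ b) ∙ Γ.ε)     ≡⟨ cong r (Γ.identityʳ _) ⟩
        r (a ∙ b)             ≡⟨ h a b ⟨
        q b ∘′ p a            ≡⟨ cong (_∘′ p a) (shift b) ⟩
        (q Γ.ε ∘′ g b) ∘′ p a ≡⟨ Δ.assoc _ _ _ ⟩
        q Γ.ε ∘′ (g b ∘′ p a) ∎)

      g-anti : ∀ a b → g (a ∙ b) ≡ g b ∘′ g a
      g-anti a b = trans (cong (_∘′ _) (p-anti a b)) (Δ.assoc _ _ _)

  private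
    M  = cayleyNet Γ
    M′ = cayleyNet Δ
    open Net M using (coord; coord-unique)
    open Net M′ using () renaming (coord to coord′; coord-unique to coord-unique′)
    open NetGraph using (graph; Adjacent; adj⇒; ⇒adj)

  module _ (σ : Fin 3 → Fin 3) (σ-injective : ∀ {i j} → σ i ≡ σ j → i ≡ j) (ψ : Fin (n * n) → Fin (n * n))
    (ψ-injective : ∀ {u v} → ψ u ≡ ψ v → u ≡ v)
    (lines : ∀ i {u v} → coord i u ≡ coord i v → coord′ (σ i) (ψ u) ≡ coord′ (σ i) (ψ v)) where

    private
      e : Fin n
      e = Γ.ε

      -- The action of ψ on the lines of each class, read off at one point per line; `combine c e`
      -- lies on the line of the pairs with product c.
      p q r : Fin n → Fin n
      p a = coord′ (σ 0F) (ψ (combine a e))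
      q b = coord′ (σ 1F) (ψ (combine e b))
      r c = coord′ (σ 2F) (ψ (combine c e))

      onP : ∀ a b → coord′ (σ 0F) (ψ (combine a b)) ≡ p a
      onP a b = lines 0F (trans (proj₁ (coord-combine Γ a b)) (sym (proj₁ (coord-combine Γ a e))))

      onQ : ∀ a b → coord′ (σ 1F) (ψ (combine a b)) ≡ q b
      onQ a b = lines 1F (trans (proj₁ (proj₂ (coord-combine Γ a b))) (sym (proj₁ (proj₂ (coord-combine Γ e b)))))

      onR : ∀ a b → coord′ (σ 2F) (ψ (combine a b)) ≡ r (a ∙ b)
      onR a b = lines 2F (trans (proj₂ (proj₂ (coord-combine Γ a b)))
        (trans (sym (Γ.identityʳ _)) (sym (proj₂ (proj₂ (coord-combine Γ (a ∙ b) e))))))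

      p-injective : ∀ {a b} → p a ≡ p b → a ≡ b
      p-injective {a} {b} eq = trans (sym (proj₁ (coord-combine Γ a e))) (trans (cong (coord 0F)
        (ψ-injective (coord-unique′ {σ 0F} {σ 1F} (λ eq → contradiction (σ-injective eq) λ ()) eq
          (trans (onQ a e) (sym (onQ b e)))))) (proj₁ (coord-combine Γ b e)))

      distinct : ∀ {i j} → i ≢ j → σ i ≢ σ j
      distinct i≢j eq = i≢j (σ-injective eq)

      -- The six arrangements are the conjugates of the Latin square of Δ: the relation among p a, q
      -- b and r(ab) may have any of the three as the product. Solving it for r(ab) gives an isotopy
      -- or an anti-isotopy, after inverting p or q in the four cases where r is a factor.
      byType : ∀ i j k → i ≢ j → i ≢ k → j ≢ k →
        (∀ a b → ∃[ u ] coord′ i u ≡ p a × coord′ j u ≡ q b × coord′ k u ≡ r (a ∙ b)) →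
        Isomorphic Γ.finite Δ.finite
      byType 0F 1F 2F _ _ _ h = isotopic⇒Isomorphic p q r p-injective λ a b →
        let u , eᵖ , eᑫ , eʳ = h a b in
        trans (cong₂ _∘′_ (sym eᵖ) (sym eᑫ)) eʳ
      byType 1F 0F 2F _ _ _ h = antiIsotopic⇒Isomorphic p q r p-injective λ a b →
        let u , eᵖ , eᑫ , eʳ = h a b in
        trans (cong₂ _∘′_ (sym eᑫ) (sym eᵖ)) eʳ
      byType 0F 2F 1F _ _ _ h = isotopic⇒Isomorphic (inv ∘ p) q r (p-injective ∘ Δ.⁻¹-injective) λ a b →
        let u , eᵖ , eᑫ , eʳ = h a b in
        trans (cong₂ (λ x y → inv x ∘′ y) (sym eᵖ) (sym eᑫ)) (trans (Δ.x⁻¹[xy]≡y _ _) eʳ)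
      byType 2F 0F 1F _ _ _ h = antiIsotopic⇒Isomorphic p (inv ∘ q) r p-injective λ a b →
        let u , eᵖ , eᑫ , eʳ = h a b in
        trans (cong₂ (λ x y → inv y ∘′ x) (sym eᵖ) (sym eᑫ)) (trans (Δ.x⁻¹[xy]≡y _ _) eʳ)
      byType 1F 2F 0F _ _ _ h = antiIsotopic⇒Isomorphic (inv ∘ p) q r (p-injective ∘ Δ.⁻¹-injective) λ a b →
        let u , eᵖ , eᑫ , eʳ = h a b in
        trans (cong₂ (λ x y → y ∘′ inv x) (sym eᵖ) (sym eᑫ)) (trans (Δ.[yx]x⁻¹≡y _ _) eʳ)
      byType 2F 1F 0F _ _ _ h = isotopic⇒Isomorphic p (inv ∘ q) r p-injective λ a b →
        let u , eᵖ , eᑫ , eʳ = h a b in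
        trans (cong₂ (λ x y → x ∘′ inv y) (sym eᵖ) (sym eᑫ)) (trans (Δ.[yx]x⁻¹≡y _ _) eʳ)
      byType 0F 0F _  i≢j _ _ _ = contradiction refl i≢j
      byType 1F 1F _  i≢j _ _ _ = contradiction refl i≢j
      byType 2F 2F _  i≢j _ _ _ = contradiction refl i≢j
      byType 0F 1F 0F _ i≢k _ _ = contradiction refl i≢k
      byType 0F 2F 0F _ i≢k _ _ = contradiction refl i≢k
      byType 1F 0F 1F _ i≢k _ _ = contradiction refl i≢k
      byType 1F 2F 1F _ i≢k _ _ = contradiction refl i≢k
      byType 2F 0F 2F _ i≢k _ _ = contradiction refl i≢k
      byType 2F 1F 2F _ i≢k _ _ = contradiction refl i≢k
      byType 0F 1F 1F _ _ j≢k _ = contradiction refl j≢k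
      byType 0F 2F 2F _ _ j≢k _ = contradiction refl j≢k
      byType 1F 0F 0F _ _ j≢k _ = contradiction refl j≢k
      byType 1F 2F 2F _ _ j≢k _ = contradiction refl j≢k
      byType 2F 0F 0F _ _ j≢k _ = contradiction refl j≢k
      byType 2F 1F 1F _ _ j≢k _ = contradiction refl j≢k

    conjugate⇒Isomorphic : Isomorphic Γ.finite Δ.finite
    conjugate⇒Isomorphic = byType (σ 0F) (σ 1F) (σ 2F)
      (distinct λ ()) (distinct λ ()) (distinct λ ())
      λ a b → ψ (combine a b) , onP a b , onQ a b , onR a b

  cayleyGraphs-isomorphic⇒ : 5 ≤ n → (π : Fin (n * n) ↣ Fin (n * n)) →
    (∀ x y → adj (graph M ^ π) x y ≡ adj (graph M′) x y) → Isomorphic Γ.finite Δ.finite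
  cayleyGraphs-isomorphic⇒ 5≤n π eq = conjugate⇒Isomorphic σ σ-injective ψ ψ-injective lines
    where
    ψ = Injection.to π
    ψ-injective = Injection.injective π

    transfer : ∀ u v → adj (graph M) u v ≡ adj (graph M′) (ψ u) (ψ v)
    transfer u v = trans (sym (adj-^ (graph M) π u v)) (eq (ψ u) (ψ v))

    open NetIsomorphism 5≤n M M′ ψ ψ-injective
      (λ {u} {v} a → adj⇒ M′ (trans (sym (transfer u v)) (⇒adj M a)))
      (λ {u} {v} a → adj⇒ M (trans (transfer u v) (⇒adj M′ a)))

    permutation = coordinate-permutation (combine Γ.ε Γ.ε)
    σ = proj₁ permutation
    σ-injective = proj₁ (proj₂ permutation)
    lines = proj₂ (proj₂ permutation)

  cayleyGraphs-isomorphic⇐ : Isomorphic Γ.finite Δ.finite →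
    Σ[ π ∈ Fin (n * n) ↣ Fin (n * n) ] (∀ x y → adj (graph M ^ π) x y ≡ adj (graph M′) x y)
  cayleyGraphs-isomorphic⇐ (f , iso) = π , λ x y →
    let u , ψu≡x = injective⇒surjective ψ ψ-injective x
        v , ψv≡y = injective⇒surjective ψ ψ-injective y
    in subst₂ (λ x y → adj (graph M ^ π) x y ≡ adj (graph M′) x y) ψu≡x ψv≡y
         (trans (adj-^ (graph M) π u v) (transfer u v))
    where
    open GroupMorphisms.IsGroupIsomorphism iso using (∙-homo) renaming (injective to f-injective)

    ψ : Fin (n * n) → Fin (n * n)
    ψ u = combine (f (coord 0F u)) (f (coord 1F u))

    coord-ψ : ∀ i u → coord′ i (ψ u) ≡ f (coord i u)
    coord-ψ 0F u = proj₁ (coord-combine Δ _ _)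
    coord-ψ 1F u = proj₁ (proj₂ (coord-combine Δ _ _))
    coord-ψ 2F u = trans (proj₂ (proj₂ (coord-combine Δ _ _))) (sym (∙-homo _ _))

    coord-cancel : ∀ i {u v} → coord′ i (ψ u) ≡ coord′ i (ψ v) → coord i u ≡ coord i v
    coord-cancel i {u} {v} eq = f-injective (trans (sym (coord-ψ i u)) (trans eq (coord-ψ i v)))

    ψ-injective : ∀ {u v} → ψ u ≡ ψ v → u ≡ v
    ψ-injective eq = coord-unique {0F} {1F} (λ ())
      (coord-cancel 0F (cong (coord′ 0F) eq)) (coord-cancel 1F (cong (coord′ 1F) eq))

    π : Fin (n * n) ↣ Fin (n * n)
    π = mk↣ ψ-injective

    transfer : ∀ u v → adj (graph M) u v ≡ adj (graph M′) (ψ u) (ψ v)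
    transfer u v = does-⇔ (mk⇔
      (λ (u≢v , i , eq) → u≢v ∘ ψ-injective , i , trans (coord-ψ i u) (trans (cong f eq) (sym (coord-ψ i v))))
      (λ (u≢v , i , eq) → (λ u≡v → u≢v (cong ψ u≡v)) , i , coord-cancel i eq))
      (NetGraph.adjacent? M u v) (NetGraph.adjacent? M′ (ψ u) (ψ v))

-- Orthogonal matrices over ℚ

module ℚ-Sum = SemiringSum (CommutativeRing.semiring ℚ.+-*-commutativeRing)
module ℚS = ℚSolver.+-*-Solver

abstract
  -- Abstract, so that sums are treated only by the laws of this block and do not unfold into nested
  -- additions.
  sumℚ : ∀ {N} → (Fin N → ℚ) → ℚ
  sumℚ = ℚ-Sum.sum

  sumℚ-nil : (f : Fin 0 → ℚ) → sumℚ f ≡ 0ℚ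
  sumℚ-nil f = refl

  sumℚ-suc : ∀ {N} (f : Fin (suc N) → ℚ) → sumℚ f ≡ f zero ℚ.+ sumℚ (f ∘ suc)
  sumℚ-suc f = refl

  sumℚ-cong : ∀ {N} {f g : Fin N → ℚ} → (∀ i → f i ≡ g i) → sumℚ f ≡ sumℚ g
  sumℚ-cong = ℚ-Sum.sum-cong-≗

  sumℚ-+ : ∀ {N} (f g : Fin N → ℚ) → sumℚ (λ i → f i ℚ.+ g i) ≡ sumℚ f ℚ.+ sumℚ g
  sumℚ-+ = ℚ-Sum.∑-distrib-+

  sumℚ-*ˡ : ∀ {N} c (f : Fin N → ℚ) → c ℚ.* sumℚ f ≡ sumℚ (λ i → c ℚ.* f i)
  sumℚ-*ˡ = ℚ-Sum.*-distribˡ-sum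

  sumℚ-*ʳ : ∀ {N} c (f : Fin N → ℚ) → sumℚ f ℚ.* c ≡ sumℚ (λ i → f i ℚ.* c)
  sumℚ-*ʳ = ℚ-Sum.*-distribʳ-sum

  sumℚ-comm : ∀ {M N} (f : Fin M → Fin N → ℚ) → sumℚ (λ i → sumℚ (f i)) ≡ sumℚ (λ j → sumℚ λ i → f i j)
  sumℚ-comm = ℚ-Sum.∑-comm

  sumℚ-zero : ∀ {N} → sumℚ {N} (λ _ → 0ℚ) ≡ 0ℚ
  sumℚ-zero {N} = ℚ-Sum.sum-replicate-zero N

infixr 7 _⊡_

_⊡_ : ∀ {N} → (Fin N → Fin N → ℚ) → (Fin N → ℚ) → Fin N → ℚ
(Q ⊡ x) u = sumℚ λ v → Q u v ℚ.* x v

_ᵀ : ∀ {N} → (Fin N → Fin N → ℚ) → Fin N → Fin N → ℚ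
(Q ᵀ) u v = Q v u

inner : ∀ {N} → (Fin N → ℚ) → (Fin N → ℚ) → ℚ
inner x y = sumℚ λ u → x u ℚ.* y u

δ : ∀ {N} → Fin N → Fin N → ℚ
δ u v = if does (u Fin.≟ v) then 1ℚ else 0ℚ

sum-δ : ∀ {N} u (f : Fin N → ℚ) → sumℚ (λ v → δ u v ℚ.* f v) ≡ f u
sum-δ {suc N} zero f = begin
  sumℚ (λ v → δ zero v ℚ.* f v)
    ≡⟨ sumℚ-suc (λ v → δ zero v ℚ.* f v) ⟩
  1ℚ ℚ.* f zero ℚ.+ sumℚ (λ v → 0ℚ ℚ.* f (suc v))
    ≡⟨ cong₂ ℚ._+_ (ℚ.*-identityˡ (f zero)) (trans (sumℚ-cong λ v → ℚ.*-zeroˡ (f (suc v))) sumℚ-zero) ⟩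
  f zero ℚ.+ 0ℚ
    ≡⟨ ℚ.+-identityʳ (f zero) ⟩
  f zero ∎
  where open ≡-Reasoning
sum-δ {suc N} (suc u) f = begin
  sumℚ (λ v → δ (suc u) v ℚ.* f v)
    ≡⟨ sumℚ-suc (λ v → δ (suc u) v ℚ.* f v) ⟩
  0ℚ ℚ.* f zero ℚ.+ sumℚ (λ v → δ u v ℚ.* f (suc v))
    ≡⟨ cong₂ ℚ._+_ (ℚ.*-zeroˡ (f zero)) (sum-δ u (f ∘ suc)) ⟩
  0ℚ ℚ.+ f (suc u)
    ≡⟨ ℚ.+-identityˡ (f (suc u)) ⟩
  f (suc u) ∎
  where open ≡-Reasoning

⊡-cong : ∀ {N} (Q : Fin N → Fin N → ℚ) {x y} → (∀ v → x v ≡ y v) → ∀ u → (Q ⊡ x) u ≡ (Q ⊡ y) u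
⊡-cong Q eq u = sumℚ-cong λ v → cong (Q u v ℚ.*_) (eq v)

⊡-+ : ∀ {N} (Q : Fin N → Fin N → ℚ) x y u → (Q ⊡ (λ v → x v ℚ.+ y v)) u ≡ (Q ⊡ x) u ℚ.+ (Q ⊡ y) u
⊡-+ Q x y u = trans (sumℚ-cong λ v → ℚ.*-distribˡ-+ (Q u v) (x v) (y v)) (sumℚ-+ _ _)

⊡-scale : ∀ {N} (Q : Fin N → Fin N → ℚ) c x u → (Q ⊡ (λ v → c ℚ.* x v)) u ≡ c ℚ.* (Q ⊡ x) u
⊡-scale Q c x u = trans
  (sumℚ-cong λ v → ℚS.solve 3 (λ q c x → q ℚS.:* (c ℚS.:* x) ℚS.:= c ℚS.:* (q ℚS.:* x)) refl (Q u v) c (x v))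
  (sym (sumℚ-*ˡ c _))

⊡-sum : ∀ {N k} (Q : Fin N → Fin N → ℚ) (f : Fin k → Fin N → ℚ) u →
  (Q ⊡ (λ v → sumℚ λ i → f i v)) u ≡ sumℚ λ i → (Q ⊡ f i) u
⊡-sum Q f u = trans (sumℚ-cong λ v → sumℚ-*ˡ (Q u v) _) (sumℚ-comm _)

inner-congʳ : ∀ {N} (x : Fin N → ℚ) {y y′ : Fin N → ℚ} → (∀ v → y v ≡ y′ v) → inner x y ≡ inner x y′
inner-congʳ x eq = sumℚ-cong λ v → cong (x v ℚ.*_) (eq v)

inner-comm : ∀ {N} (x y : Fin N → ℚ) → inner x y ≡ inner y x
inner-comm x y = sumℚ-cong λ v → ℚ.*-comm (x v) (y v)

inner-⊡ : ∀ {N} (Q : Fin N → Fin N → ℚ) x y → inner (Q ⊡ x) y ≡ inner x (Q ᵀ ⊡ y)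
inner-⊡ Q x y = begin
  sumℚ (λ u → sumℚ (λ v → Q u v ℚ.* x v) ℚ.* y u)  ≡⟨ sumℚ-cong (λ u → sumℚ-*ʳ (y u) _) ⟩
  sumℚ (λ u → sumℚ (λ v → Q u v ℚ.* x v ℚ.* y u))  ≡⟨ sumℚ-comm _ ⟩
  sumℚ (λ v → sumℚ (λ u → Q u v ℚ.* x v ℚ.* y u))  ≡⟨ sumℚ-cong (λ v → sumℚ-cong λ u →
    ℚS.solve 3 (λ q x y → q ℚS.:* x ℚS.:* y ℚS.:= x ℚS.:* (q ℚS.:* y)) refl (Q u v) (x v) (y u)) ⟩
  sumℚ (λ v → sumℚ (λ u → x v ℚ.* (Q u v ℚ.* y u)))  ≡⟨ sumℚ-cong (λ v → sumℚ-*ˡ (x v) _) ⟨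
  sumℚ (λ v → x v ℚ.* sumℚ (λ u → Q u v ℚ.* y u))  ∎
  where open ≡-Reasoning

⊡-assoc : ∀ {N} (P Q : Fin N → Fin N → ℚ) x u →
  ((λ u v → (P ⊡ (λ w → Q w v)) u) ⊡ x) u ≡ (P ⊡ (Q ⊡ x)) u
⊡-assoc P Q x u = begin
  sumℚ (λ v → sumℚ (λ w → P u w ℚ.* Q w v) ℚ.* x v)    ≡⟨ sumℚ-cong (λ v → sumℚ-*ʳ (x v) _) ⟩
  sumℚ (λ v → sumℚ (λ w → P u w ℚ.* Q w v ℚ.* x v))    ≡⟨ sumℚ-comm _ ⟩
  sumℚ (λ w → sumℚ (λ v → P u w ℚ.* Q w v ℚ.* x v))    ≡⟨ sumℚ-cong (λ w → sumℚ-cong λ v →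
    ℚ.*-assoc (P u w) (Q w v) (x v)) ⟩
  sumℚ (λ w → sumℚ (λ v → P u w ℚ.* (Q w v ℚ.* x v)))  ≡⟨ sumℚ-cong (λ w → sumℚ-*ˡ (P u w) _) ⟨
  sumℚ (λ w → P u w ℚ.* sumℚ (λ v → Q w v ℚ.* x v))    ∎
  where open ≡-Reasoning

0≤square : ∀ q → 0ℚ ℚ.≤ q ℚ.* q
0≤square q with ℚ.≤-total 0ℚ q
... | inj₁ 0≤q = subst (ℚ._≤ q ℚ.* q) (ℚ.*-zeroˡ q) (ℚ.*-monoʳ-≤-nonNeg q {{ℚ.nonNegative 0≤q}} 0≤q)
... | inj₂ q≤0 = subst (ℚ._≤ q ℚ.* q) (ℚ.*-zeroˡ q) (ℚ.*-monoʳ-≤-nonPos q {{ℚ.nonPositive q≤0}} q≤0)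

inner≥0 : ∀ {N} (x : Fin N → ℚ) → 0ℚ ℚ.≤ inner x x
inner≥0 {zero}  x = subst (0ℚ ℚ.≤_) (sym (sumℚ-nil (λ u → x u ℚ.* x u))) ℚ.≤-refl
inner≥0 {suc N} x = subst (0ℚ ℚ.≤_) (sym (sumℚ-suc (λ u → x u ℚ.* x u)))
  (ℚ.+-mono-≤ (0≤square (x zero)) (inner≥0 (x ∘ suc)))

inner≡0⇒ : ∀ {N} (x : Fin N → ℚ) → inner x x ≡ 0ℚ → ∀ u → x u ≡ 0ℚ
inner≡0⇒ {suc N} x eq = λ { zero → head≡0 ; (suc u) → inner≡0⇒ (x ∘ suc) tail≡0 u }
  where
  rest : ℚ
  rest = inner (x ∘ suc) (x ∘ suc)

  split : x zero ℚ.* x zero ℚ.+ rest ≡ 0ℚ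
  split = trans (sym (sumℚ-suc (λ u → x u ℚ.* x u))) eq

  square-pos : ∀ q → q ≢ 0ℚ → 0ℚ ℚ.< q ℚ.* q
  square-pos q q≢0 with ℚ.<-cmp 0ℚ q
  ... | tri< 0<q _ _ = subst (ℚ._< q ℚ.* q) (ℚ.*-zeroˡ q) (ℚ.*-monoˡ-<-pos q {{ℚ.positive 0<q}} 0<q)
  ... | tri≈ _ 0≡q _ = contradiction (sym 0≡q) q≢0
  ... | tri> _ _ q<0 = subst (ℚ._< q ℚ.* q) (ℚ.*-zeroˡ q) (ℚ.*-monoˡ-<-neg q {{ℚ.negative q<0}} q<0)

  head≡0 : x zero ≡ 0ℚ
  head≡0 with x zero ℚ.≟ 0ℚ
  ... | yes e = e
  ... | no ne = contradiction split (λ e → ℚ.<-irrefl (sym e)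
    (ℚ.+-mono-<-≤ (square-pos (x zero) ne) (inner≥0 (x ∘ suc))))

  tail≡0 : rest ≡ 0ℚ
  tail≡0 = trans (sym (ℚ.+-identityˡ rest)) (trans (cong (ℚ._+ rest)
    (sym (trans (cong (λ h → h ℚ.* h) head≡0) (ℚ.*-zeroˡ 0ℚ)))) split)

-- Both one-sided laws are kept, which makes the transpose orthogonal by exchanging them.
record Orthogonal (N : ℕ) : Set where
  field
    matrix   : Fin N → Fin N → ℚ
    inverseˡ : ∀ x u → (matrix ᵀ ⊡ (matrix ⊡ x)) u ≡ x u
    inverseʳ : ∀ x u → (matrix ⊡ (matrix ᵀ ⊡ x)) u ≡ x u

  isometry : ∀ x y → inner (matrix ⊡ x) (matrix ⊡ y) ≡ inner x y
  isometry x y = trans (inner-⊡ matrix x (matrix ⊡ y)) (inner-congʳ x (inverseˡ y))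

open Orthogonal public using (matrix)

identity : ∀ {N} → Orthogonal N
identity = record
  { matrix   = δ
  ; inverseˡ = λ x u → trans (⊡-cong (δ ᵀ) (λ v → sum-δ v x) u) (transpose x u)
  ; inverseʳ = λ x u → trans (sum-δ u (δ ᵀ ⊡ x)) (transpose x u)
  }
  where
  δ-sym : ∀ {N} (u v : Fin N) → δ v u ≡ δ u v
  δ-sym u v = cong (λ b → if b then 1ℚ else 0ℚ) (does-⇔ (mk⇔ sym sym) (v Fin.≟ u) (u Fin.≟ v))

  transpose : ∀ {N} (x : Fin N → ℚ) u → (δ ᵀ ⊡ x) u ≡ x u
  transpose x u = trans (sumℚ-cong λ v → cong (ℚ._* x v) (δ-sym u v)) (sum-δ u x)

_⊙_ : ∀ {N} → Orthogonal N → Orthogonal N → Orthogonal N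
_⊙_ {N} P Q = record
  { matrix   = PQ
  ; inverseˡ = λ x u → trans (transposed (PQ ⊡ x) u) (trans
      (⊡-cong (matrix Q ᵀ) (λ v → trans (⊡-cong (matrix P ᵀ) (⊡-assoc (matrix P) (matrix Q) x) v)
        (Orthogonal.inverseˡ P (matrix Q ⊡ x) v)) u)
      (Orthogonal.inverseˡ Q x u))
  ; inverseʳ = λ x u → trans (⊡-assoc (matrix P) (matrix Q) (PQ ᵀ ⊡ x) u) (trans
      (⊡-cong (matrix P) (λ v → trans (⊡-cong (matrix Q) (transposed x) v)
        (Orthogonal.inverseʳ Q (matrix P ᵀ ⊡ x) v)) u)
      (Orthogonal.inverseʳ P x u))
  }
  where
  PQ : Fin N → Fin N → ℚ
  PQ u v = (matrix P ⊡ (λ w → matrix Q w v)) u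

  transposed : ∀ x u → (PQ ᵀ ⊡ x) u ≡ (matrix Q ᵀ ⊡ (matrix P ᵀ ⊡ x)) u
  transposed x u = trans
    (sumℚ-cong λ v → cong (ℚ._* x v) (sumℚ-cong λ w → ℚ.*-comm (matrix P v w) (matrix Q w u)))
    (⊡-assoc (matrix Q ᵀ) (matrix P ᵀ) x u)

⊙-⊡ : ∀ {N} (P Q : Orthogonal N) x u → (matrix (P ⊙ Q) ⊡ x) u ≡ (matrix P ⊡ (matrix Q ⊡ x)) u
⊙-⊡ P Q = ⊡-assoc (matrix P) (matrix Q)

-- Reflections and Witt's theorem

module Reflection {N} (d : Fin N → ℚ) (c : ℚ) (c-eq : c ℚ.* inner d d ≡ 1ℚ ℚ.+ 1ℚ) where

  -- The factor c is 2 / ⟨d, d⟩. Dividing by the squared norm instead of normalising d avoids a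
  -- square root and stays within the rationals.
  reflection : Fin N → Fin N → ℚ
  reflection u v = δ u v ℚ.- c ℚ.* (d u ℚ.* d v)

  reflect : ∀ x u → (reflection ⊡ x) u ≡ x u ℚ.- c ℚ.* inner d x ℚ.* d u
  reflect x u = begin
    sumℚ (λ v → (δ u v ℚ.- c ℚ.* (d u ℚ.* d v)) ℚ.* x v)
      ≡⟨ sumℚ-cong (λ v → ℚS.solve 5 (λ e c a b x →
           (e ℚS.:- c ℚS.:* (a ℚS.:* b)) ℚS.:* x ℚS.:= e ℚS.:* x ℚS.:+ (ℚS.:- (c ℚS.:* a)) ℚS.:* (b ℚS.:* x))
           refl (δ u v) c (d u) (d v) (x v)) ⟩
    sumℚ (λ v → δ u v ℚ.* x v ℚ.+ (ℚ.- (c ℚ.* d u)) ℚ.* (d v ℚ.* x v))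
      ≡⟨ sumℚ-+ _ _ ⟩
    sumℚ (λ v → δ u v ℚ.* x v) ℚ.+ sumℚ (λ v → (ℚ.- (c ℚ.* d u)) ℚ.* (d v ℚ.* x v))
      ≡⟨ cong₂ ℚ._+_ (sum-δ u x) (sym (sumℚ-*ˡ (ℚ.- (c ℚ.* d u)) (λ v → d v ℚ.* x v))) ⟩
    x u ℚ.+ (ℚ.- (c ℚ.* d u)) ℚ.* inner d x
      ≡⟨ ℚS.solve 4 (λ x c a i → x ℚS.:+ (ℚS.:- (c ℚS.:* a)) ℚS.:* i ℚS.:= x ℚS.:- c ℚS.:* i ℚS.:* a)
           refl (x u) c (d u) (inner d x) ⟩
    x u ℚ.- c ℚ.* inner d x ℚ.* d u ∎
    where open ≡-Reasoning

  inner-reflect : ∀ x → inner d (reflection ⊡ x) ≡ ℚ.- inner d x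
  inner-reflect x = begin
    inner d (reflection ⊡ x)
      ≡⟨ sumℚ-cong (λ v → trans (cong (d v ℚ.*_) (reflect x v))
           (ℚS.solve 3 (λ a x t → a ℚS.:* (x ℚS.:- t ℚS.:* a) ℚS.:= a ℚS.:* x ℚS.:+ (ℚS.:- t) ℚS.:* (a ℚS.:* a))
             refl (d v) (x v) (c ℚ.* inner d x))) ⟩
    sumℚ (λ v → d v ℚ.* x v ℚ.+ (ℚ.- (c ℚ.* inner d x)) ℚ.* (d v ℚ.* d v))
      ≡⟨ sumℚ-+ _ _ ⟩
    inner d x ℚ.+ sumℚ (λ v → (ℚ.- (c ℚ.* inner d x)) ℚ.* (d v ℚ.* d v))
      ≡⟨ cong (inner d x ℚ.+_) (sym (sumℚ-*ˡ (ℚ.- (c ℚ.* inner d x)) (λ v → d v ℚ.* d v))) ⟩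
    inner d x ℚ.+ (ℚ.- (c ℚ.* inner d x)) ℚ.* inner d d
      ≡⟨ ℚS.solve 3 (λ i c s → i ℚS.:+ (ℚS.:- (c ℚS.:* i)) ℚS.:* s ℚS.:= i ℚS.:- (c ℚS.:* s) ℚS.:* i)
           refl (inner d x) c (inner d d) ⟩
    inner d x ℚ.- (c ℚ.* inner d d) ℚ.* inner d x
      ≡⟨ cong (λ t → inner d x ℚ.- t ℚ.* inner d x) c-eq ⟩
    inner d x ℚ.- (1ℚ ℚ.+ 1ℚ) ℚ.* inner d x
      ≡⟨ ℚS.solve 1 (λ i → i ℚS.:- (ℚS.con 1ℚ ℚS.:+ ℚS.con 1ℚ) ℚS.:* i ℚS.:= ℚS.:- i) refl (inner d x) ⟩
    ℚ.- inner d x ∎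
    where open ≡-Reasoning

  involutive : ∀ x u → (reflection ⊡ (reflection ⊡ x)) u ≡ x u
  involutive x u = begin
    (reflection ⊡ (reflection ⊡ x)) u
      ≡⟨ reflect (reflection ⊡ x) u ⟩
    (reflection ⊡ x) u ℚ.- c ℚ.* inner d (reflection ⊡ x) ℚ.* d u
      ≡⟨ cong₂ (λ a b → a ℚ.- c ℚ.* b ℚ.* d u) (reflect x u) (inner-reflect x) ⟩
    x u ℚ.- c ℚ.* inner d x ℚ.* d u ℚ.- c ℚ.* (ℚ.- inner d x) ℚ.* d u
      ≡⟨ ℚS.solve 4 (λ x c i a → x ℚS.:- c ℚS.:* i ℚS.:* a ℚS.:- c ℚS.:* (ℚS.:- i) ℚS.:* a ℚS.:= x)
           refl (x u) c (inner d x) (d u) ⟩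
    x u ∎
    where open ≡-Reasoning

  transposed : ∀ x u → (reflection ᵀ ⊡ x) u ≡ (reflection ⊡ x) u
  transposed x u = sumℚ-cong λ v → cong (ℚ._* x v) (cong₂ (λ a b → a ℚ.- c ℚ.* b)
    (cong (λ b → if b then 1ℚ else 0ℚ) (does-⇔ (mk⇔ sym sym) (v Fin.≟ u) (u Fin.≟ v)))
    (ℚ.*-comm (d v) (d u)))

  reflector : Orthogonal N
  reflector = record
    { matrix   = reflection
    ; inverseˡ = λ x u → trans (transposed (reflection ⊡ x) u) (involutive x u)
    ; inverseʳ = λ x u → trans (⊡-cong reflection (transposed x) u) (involutive x u)
    }

inner-difference : ∀ {N} (w v x : Fin N → ℚ) → inner (λ u → w u ℚ.- v u) x ≡ inner w x ℚ.- inner v x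
inner-difference w v x = begin
  sumℚ (λ u → (w u ℚ.- v u) ℚ.* x u)
    ≡⟨ sumℚ-cong (λ u → ℚS.solve 3 (λ w v x → (w ℚS.:- v) ℚS.:* x
         ℚS.:= w ℚS.:* x ℚS.:+ (ℚS.:- ℚS.con 1ℚ) ℚS.:* (v ℚS.:* x)) refl (w u) (v u) (x u)) ⟩
  sumℚ (λ u → w u ℚ.* x u ℚ.+ (ℚ.- 1ℚ) ℚ.* (v u ℚ.* x u))
    ≡⟨ sumℚ-+ _ _ ⟩
  inner w x ℚ.+ sumℚ (λ u → (ℚ.- 1ℚ) ℚ.* (v u ℚ.* x u))
    ≡⟨ cong (inner w x ℚ.+_) (sym (sumℚ-*ˡ (ℚ.- 1ℚ) (λ u → v u ℚ.* x u))) ⟩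
  inner w x ℚ.+ (ℚ.- 1ℚ) ℚ.* inner v x
    ≡⟨ ℚS.solve 2 (λ a b → a ℚS.:+ (ℚS.:- ℚS.con 1ℚ) ℚS.:* b ℚS.:= a ℚS.:- b) refl (inner w x) (inner v x) ⟩
  inner w x ℚ.- inner v x ∎
  where open ≡-Reasoning

-- By the reflection along w - v, unless w = v.
swapping : ∀ {N} (w v : Fin N → ℚ) → inner w w ≡ inner v v →
  Σ[ R ∈ Orthogonal N ] (∀ u → (matrix R ⊡ w) u ≡ v u) ×
    (∀ x → inner w x ≡ inner v x → ∀ u → (matrix R ⊡ x) u ≡ x u)
swapping {N} w v norm with inner (λ u → w u ℚ.- v u) (λ u → w u ℚ.- v u) ℚ.≟ 0ℚ
... | yes dd≡0 = identity , (λ u → trans (sum-δ u w) (w≡v u)) , λ x _ u → sum-δ u x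
  where
  w≡v : ∀ u → w u ≡ v u
  w≡v u = trans (ℚS.solve 2 (λ w v → w ℚS.:= (w ℚS.:- v) ℚS.:+ v) refl (w u) (v u))
    (trans (cong (ℚ._+ v u) (inner≡0⇒ (λ u → w u ℚ.- v u) dd≡0 u)) (ℚ.+-identityˡ (v u)))
... | no dd≢0 = reflector , swapped , fixed
  where
  d : Fin N → ℚ
  d u = w u ℚ.- v u

  instance
    dd-nonZero : ℚ.NonZero (inner d d)
    dd-nonZero = ℚ.≢-nonZero dd≢0

  c : ℚ
  c = (1ℚ ℚ.+ 1ℚ) ℚ.* ℚ.1/ inner d d

  c-eq : c ℚ.* inner d d ≡ 1ℚ ℚ.+ 1ℚ
  c-eq = trans (ℚ.*-assoc (1ℚ ℚ.+ 1ℚ) (ℚ.1/ inner d d) (inner d d)) (trans (cong ((1ℚ ℚ.+ 1ℚ) ℚ.*_) (ℚ.*-inverseˡ (inner d d))) (ℚ.*-identityʳ _))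

  open Reflection d c c-eq

  -- Equal norms of w and v make ⟨d, d⟩ = 2⟨d, w⟩, so the reflection subtracts exactly d from w.
  dd : inner d d ≡ inner d w ℚ.+ inner d w
  dd = begin
    inner d d
      ≡⟨ inner-difference w v d ⟩
    inner w d ℚ.- inner v d
      ≡⟨ cong₂ ℚ._-_ (trans (inner-comm w d) (inner-difference w v w)) (trans (inner-comm v d) (inner-difference w v v)) ⟩
    (inner w w ℚ.- inner v w) ℚ.- (inner w v ℚ.- inner v v)
      ≡⟨ cong₂ (λ a b → (inner w w ℚ.- inner v w) ℚ.- (a ℚ.- b)) (inner-comm w v) (sym norm) ⟩
    (inner w w ℚ.- inner v w) ℚ.- (inner v w ℚ.- inner w w)
      ≡⟨ ℚS.solve 2 (λ a b → (a ℚS.:- b) ℚS.:- (b ℚS.:- a) ℚS.:= (a ℚS.:- b) ℚS.:+ (a ℚS.:- b)) refl (inner w w) (inner v w) ⟩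
    (inner w w ℚ.- inner v w) ℚ.+ (inner w w ℚ.- inner v w)
      ≡⟨ cong (λ t → t ℚ.+ t) (sym (inner-difference w v w)) ⟩
    inner d w ℚ.+ inner d w ∎
    where open ≡-Reasoning

  c-dw : c ℚ.* inner d w ≡ 1ℚ
  c-dw = begin
    c ℚ.* inner d w
      ≡⟨ ℚS.solve 2 (λ c i → c ℚS.:* i ℚS.:= ℚS.con ½ ℚS.:* (c ℚS.:* (i ℚS.:+ i))) refl c (inner d w) ⟩
    ½ ℚ.* (c ℚ.* (inner d w ℚ.+ inner d w))
      ≡⟨ cong (λ t → ½ ℚ.* (c ℚ.* t)) (sym dd) ⟩
    ½ ℚ.* (c ℚ.* inner d d)
      ≡⟨ cong (½ ℚ.*_) c-eq ⟩
    1ℚ ∎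
    where open ≡-Reasoning

  swapped : ∀ u → (reflection ⊡ w) u ≡ v u
  swapped u = trans (reflect w u) (trans (cong (λ t → w u ℚ.- t ℚ.* d u) c-dw)
    (ℚS.solve 2 (λ w v → w ℚS.:- ℚS.con 1ℚ ℚS.:* (w ℚS.:- v) ℚS.:= v) refl (w u) (v u)))

  fixed : ∀ x → inner w x ≡ inner v x → ∀ u → (reflection ⊡ x) u ≡ x u
  fixed x eq u = trans (reflect x u) (trans
    (cong (λ t → x u ℚ.- c ℚ.* t ℚ.* d u) (trans (inner-difference w v x)
      (trans (cong (ℚ._- inner v x) eq) (ℚ.+-inverseʳ (inner v x)))))
    (ℚS.solve 3 (λ x c d → x ℚS.:- c ℚS.:* ℚS.con 0ℚ ℚS.:* d ℚS.:= x) refl (x u) c (d u)))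

-- By induction all vectors but the first are already placed by Q. A reflection then moves the image
-- of the first to its target, and it fixes each placed vector because the Gram matrices give it the
-- same inner product with that image and with the target. The vectors may be dependent, as the
-- lines of a net are.
witt : ∀ {N} k (a b : Fin k → Fin N → ℚ) → (∀ i j → inner (a i) (a j) ≡ inner (b i) (b j)) →
  Σ[ Q ∈ Orthogonal N ] (∀ i u → (matrix Q ⊡ a i) u ≡ b i u)
witt zero    a b gram = identity , λ ()
witt {N} (suc k) a b gram = extend (witt k (a ∘ suc) (b ∘ suc) λ i j → gram (suc i) (suc j))
  where
  extend : Σ[ Q ∈ Orthogonal N ] (∀ i u → (matrix Q ⊡ a (suc i)) u ≡ b (suc i) u) →
    Σ[ Q ∈ Orthogonal N ] (∀ i u → (matrix Q ⊡ a i) u ≡ b i u)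
  extend (Q , Qa≡b) = attach (swapping (matrix Q ⊡ a zero) (b zero)
      (trans (Orthogonal.isometry Q (a zero) (a zero)) (gram zero zero)))
    where
    attach : Σ[ R ∈ Orthogonal N ] (∀ u → (matrix R ⊡ (matrix Q ⊡ a zero)) u ≡ b zero u) ×
      (∀ x → inner (matrix Q ⊡ a zero) x ≡ inner (b zero) x → ∀ u → (matrix R ⊡ x) u ≡ x u) →
      Σ[ Q ∈ Orthogonal N ] (∀ i u → (matrix Q ⊡ a i) u ≡ b i u)
    attach (R , swaps , fixes) = R ⊙ Q , λ
      { zero    u → trans (⊙-⊡ R Q (a zero) u) (swaps u)
      ; (suc i) u → trans (⊙-⊡ R Q (a (suc i)) u) (trans (⊡-cong (matrix R) (Qa≡b i) u)
          (fixes (b (suc i)) (trans (inner-congʳ (matrix Q ⊡ a zero) (λ v → sym (Qa≡b i v)))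
            (trans (Orthogonal.isometry Q (a zero) (a (suc i))) (gram zero (suc i)))) u))
      }

-- Line indicators and the adjacency matrix of a net

[_]ℚ : Bool → ℚ
[ b ]ℚ = if b then 1ℚ else 0ℚ

-- Defined by recursion so that inductions on ℕ compute; `castℚ≡` identifies it with the fraction
-- used in the statement.
castℚ : ℕ → ℚ
castℚ zero    = 0ℚ
castℚ (suc n) = 1ℚ ℚ.+ castℚ n

sumℚ-[] : ∀ {N} (p : Fin N → Bool) → sumℚ (λ u → [ p u ]ℚ) ≡ castℚ (count p)
sumℚ-[] p = trans (indicator p) (cong castℚ (sym (count≡sum p)))
  where
  step : ∀ b m → [ b ]ℚ ℚ.+ castℚ m ≡ castℚ (𝟙 b + m)
  step true  m = refl
  step false m = ℚ.+-identityˡ (castℚ m)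

  indicator : ∀ {N} (p : Fin N → Bool) → sumℚ (λ u → [ p u ]ℚ) ≡ castℚ (sumℕ (𝟙 ∘ p))
  indicator {zero}  p = sumℚ-nil (λ u → [ p u ]ℚ)
  indicator {suc N} p = trans (sumℚ-suc (λ u → [ p u ]ℚ))
    (trans (cong ([ p zero ]ℚ ℚ.+_) (indicator (p ∘ suc))) (step (p zero) (sumℕ (𝟙 ∘ p ∘ suc))))

[]ℚ-∧ : ∀ a b → [ a ]ℚ ℚ.* [ b ]ℚ ≡ [ a ∧ b ]ℚ
[]ℚ-∧ true  b = ℚ.*-identityˡ [ b ]ℚ
[]ℚ-∧ false b = ℚ.*-zeroˡ [ b ]ℚ

adjℚ : ∀ {N} → Graph N → Fin N → Fin N → ℚ
adjℚ G u v = [ adj G u v ]ℚ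

module Lines {n N} (M : Net n N) where
  open Net M
  open NetGraph M

  indicator : Fin 3 → Fin n → Fin N → ℚ
  indicator i y u = δ (coord i u) y

  -- The formula mentions nothing of the net but its order n, hence two nets of the same order have
  -- the same Gram matrix of lines.
  intersection : Fin 3 → Fin 3 → Fin n → Fin n → ℕ
  intersection i j x y with i Fin.≟ j | x Fin.≟ y
  ... | no _  | _     = 1
  ... | yes _ | yes _ = n
  ... | yes _ | no _  = 0

  private
    onBoth : Fin 3 → Fin 3 → Fin n → Fin n → Fin N → Bool
    onBoth i j x y u = does (coord i u Fin.≟ x) ∧ does (coord j u Fin.≟ y)

    onBoth⇒ : ∀ {i j x y} u → onBoth i j x y u ≡ true → coord i u ≡ x × coord j u ≡ y
    onBoth⇒ {i} {j} {x} {y} u eq with coord i u Fin.≟ x | coord j u Fin.≟ y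
    ... | yes p | yes q = p , q

    ⇒onBoth : ∀ {i j x y} u → coord i u ≡ x → coord j u ≡ y → onBoth i j x y u ≡ true
    ⇒onBoth u p q = cong₂ _∧_ (dec-true (coord _ u Fin.≟ _) p) (dec-true (coord _ u Fin.≟ _) q)

    count-onBoth : ∀ i j x y → count (onBoth i j x y) ≡ intersection i j x y
    count-onBoth i j x y with i Fin.≟ j | x Fin.≟ y
    ... | no i≢j | _ = count-≡ {k = 1} (λ _ → point i j x y) (λ { {zero} {zero} _ → refl })
      (λ _ → ⇒onBoth _ (coord-pointˡ x y i≢j) (coord-pointʳ x y i≢j))
      (λ v eq → let p , q = onBoth⇒ v eq in
        zero , coord-unique i≢j (trans (coord-pointˡ x y i≢j) (sym p)) (trans (coord-pointʳ x y i≢j) (sym q)))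
    ... | yes refl | yes refl = count-≡ (point i (next i) x)
      (λ {a} {b} eq → trans (sym (coord-pointʳ x a (next≢ i)))
        (trans (cong (coord (next i)) eq) (coord-pointʳ x b (next≢ i))))
      (λ a → ⇒onBoth _ (coord-pointˡ x a (next≢ i)) (coord-pointˡ x a (next≢ i)))
      (λ v eq → coord (next i) v , coord-unique (next≢ i)
        (trans (coord-pointˡ x _ (next≢ i)) (sym (proj₁ (onBoth⇒ v eq)))) (coord-pointʳ x _ (next≢ i)))
    ... | yes refl | no x≢y = ℕ.n≤0⇒n≡0 (cover⇒count≤ {k = 0} (λ ())
      (λ v eq → let p , q = onBoth⇒ v eq in contradiction (trans (sym p) q) x≢y))

  gram : ∀ i j x y → inner (indicator i x) (indicator j y) ≡ castℚ (intersection i j x y)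
  gram i j x y = trans (sumℚ-cong λ u → []ℚ-∧ (does (coord i u Fin.≟ x)) (does (coord j u Fin.≟ y)))
    (trans (sumℚ-[] (onBoth i j x y)) (cong castℚ (count-onBoth i j x y)))

  3ℚ : ℚ
  3ℚ = 1ℚ ℚ.+ (1ℚ ℚ.+ (1ℚ ℚ.+ 0ℚ))

  sum₃-unfold : (f : Fin 3 → ℚ) → sumℚ f ≡ f 0F ℚ.+ (f 1F ℚ.+ (f 2F ℚ.+ 0ℚ))
  sum₃-unfold f = trans (sumℚ-suc f) (cong (f 0F ℚ.+_) (trans (sumℚ-suc (λ (i : Fin 2) → f (suc i)))
    (cong (f 1F ℚ.+_) (trans (sumℚ-suc (λ (i : Fin 1) → f (suc (suc i)))) (cong (f 2F ℚ.+_) (sumℚ-nil (λ (i : Fin 0) → f (suc (suc (suc i))))))))))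

  -- Two distinct points share at most one line, and exactly one if they are adjacent, while a point
  -- shares three lines with itself.
  entry : ∀ u v → adjℚ graph u v ℚ.+ 3ℚ ℚ.* δ u v ≡ sumℚ λ i → indicator i (coord i u) v
  entry u v = trans (computed u v) (sym (sum₃-unfold (λ i → indicator i (coord i u) v)))
    where
    computed : ∀ u v → adjℚ graph u v ℚ.+ 3ℚ ℚ.* δ u v ≡
      δ (coord 0F v) (coord 0F u) ℚ.+ (δ (coord 1F v) (coord 1F u) ℚ.+ (δ (coord 2F v) (coord 2F u) ℚ.+ 0ℚ))
    computed u v with u Fin.≟ v
    computed u v | yes refl
      rewrite dec-true (coord 0F u Fin.≟ coord 0F u) refl
            | dec-true (coord 1F u Fin.≟ coord 1F u) refl
            | dec-true (coord 2F u Fin.≟ coord 2F u) refl = refl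
    computed u v | no u≢v = trans (ℚ.+-identityʳ _) (cases
      (coord 0F u Fin.≟ coord 0F v) (coord 1F u Fin.≟ coord 1F v) (coord 2F u Fin.≟ coord 2F v)
      (coord 0F v Fin.≟ coord 0F u) (coord 1F v Fin.≟ coord 1F u) (coord 2F v Fin.≟ coord 2F u))
      where
      cases : ∀ (a : Dec (coord 0F u ≡ coord 0F v)) (b : Dec (coord 1F u ≡ coord 1F v))
        (c : Dec (coord 2F u ≡ coord 2F v)) (a′ : Dec (coord 0F v ≡ coord 0F u))
        (b′ : Dec (coord 1F v ≡ coord 1F u)) (c′ : Dec (coord 2F v ≡ coord 2F u)) →
        [ does a ∨ (does b ∨ (does c ∨ false)) ]ℚ ≡
        [ does a′ ]ℚ ℚ.+ ([ does b′ ]ℚ ℚ.+ ([ does c′ ]ℚ ℚ.+ 0ℚ))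
      cases (yes a) (yes b) _ _ _ _ = contradiction (coord-unique {0F} {1F} (λ ()) a b) u≢v
      cases (yes a) (no _) (yes c) _ _ _ = contradiction (coord-unique {0F} {2F} (λ ()) a c) u≢v
      cases (no _) (yes b) (yes c) _ _ _ = contradiction (coord-unique {1F} {2F} (λ ()) b c) u≢v
      cases (yes a) (no b) (no c) a′ b′ c′
        rewrite dec-true a′ (sym a) | dec-false b′ (b ∘ sym) | dec-false c′ (c ∘ sym) = refl
      cases (no a) (yes b) (no c) a′ b′ c′
        rewrite dec-false a′ (a ∘ sym) | dec-true b′ (sym b) | dec-false c′ (c ∘ sym) = refl
      cases (no a) (no b) (yes c) a′ b′ c′
        rewrite dec-false a′ (a ∘ sym) | dec-false b′ (b ∘ sym) | dec-true c′ (sym c) = refl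
      cases (no a) (no b) (no c) a′ b′ c′
        rewrite dec-false a′ (a ∘ sym) | dec-false b′ (b ∘ sym) | dec-false c′ (c ∘ sym) = refl

  -- A + 3I is the sum over all lines of l lᵀ, l the indicator vector of the line.
  adjacency-by-lines : ∀ x u → (adjℚ graph ⊡ x) u ℚ.+ 3ℚ ℚ.* x u ≡
    sumℚ λ i → sumℚ λ y → inner (indicator i y) x ℚ.* indicator i y u
  adjacency-by-lines x u = begin
    (adjℚ graph ⊡ x) u ℚ.+ 3ℚ ℚ.* x u
      ≡⟨ cong (λ t → (adjℚ graph ⊡ x) u ℚ.+ 3ℚ ℚ.* t) (sym (sum-δ u x)) ⟩
    (adjℚ graph ⊡ x) u ℚ.+ 3ℚ ℚ.* sumℚ (λ v → δ u v ℚ.* x v)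
      ≡⟨ cong ((adjℚ graph ⊡ x) u ℚ.+_) (sumℚ-*ˡ 3ℚ (λ v → δ u v ℚ.* x v)) ⟩
    (adjℚ graph ⊡ x) u ℚ.+ sumℚ (λ v → 3ℚ ℚ.* (δ u v ℚ.* x v))
      ≡⟨ sumℚ-+ (λ v → adjℚ graph u v ℚ.* x v) (λ v → 3ℚ ℚ.* (δ u v ℚ.* x v)) ⟨
    sumℚ (λ v → adjℚ graph u v ℚ.* x v ℚ.+ 3ℚ ℚ.* (δ u v ℚ.* x v))
      ≡⟨ sumℚ-cong (λ v → trans
           (ℚS.solve 4 (λ a t d x → a ℚS.:* x ℚS.:+ t ℚS.:* (d ℚS.:* x) ℚS.:= (a ℚS.:+ t ℚS.:* d) ℚS.:* x) refl
             (adjℚ graph u v) 3ℚ (δ u v) (x v))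
           (trans (cong (ℚ._* x v) (entry u v)) (sumℚ-*ʳ (x v) (λ i → indicator i (coord i u) v)))) ⟩
    sumℚ (λ v → sumℚ λ i → indicator i (coord i u) v ℚ.* x v)
      ≡⟨ sumℚ-comm (λ v i → indicator i (coord i u) v ℚ.* x v) ⟩
    sumℚ (λ i → inner (indicator i (coord i u)) x)
      -- The one line of class i through u is expanded into a sum over all lines of the class,
      -- weighted by their indicators at u.
      ≡⟨ sumℚ-cong (λ i → sum-δ (coord i u) (λ y → inner (indicator i y) x)) ⟨
    sumℚ (λ i → sumℚ λ y → indicator i y u ℚ.* inner (indicator i y) x)
      ≡⟨ sumℚ-cong (λ i → sumℚ-cong λ y → ℚ.*-comm (indicator i y u) (inner (indicator i y) x)) ⟩
    sumℚ (λ i → sumℚ λ y → inner (indicator i y) x ℚ.* indicator i y u) ∎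
    where open ≡-Reasoning

module _ {n N} (M M′ : Net n N) where
  private
    module L = Lines M
    module L′ = Lines M′

    family : (Fin 3 → Fin n → Fin N → ℚ) → Fin (3 * n) → Fin N → ℚ
    family l a = uncurry l (remQuot n a)

    isometry : Σ[ Q ∈ Orthogonal N ] (∀ a u → (matrix Q ⊡ family L.indicator a) u ≡ family L′.indicator a u)
    isometry = witt (3 * n) (family L.indicator) (family L′.indicator) λ a b →
      let i , x = remQuot n a
          j , y = remQuot n b
      in trans (L.gram i j x y) (sym (L′.gram i j x y))

    Q : Orthogonal N
    Q = proj₁ isometry

    onLines : ∀ i y u → (matrix Q ⊡ L.indicator i y) u ≡ L′.indicator i y u
    onLines i y u = subst (λ (i , y) → (matrix Q ⊡ L.indicator i y) u ≡ L′.indicator i y u)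
      (Fin.remQuot-combine {3} i y) (proj₂ isometry (combine i y) u)

    A A′ : Fin N → Fin N → ℚ
    A  = adjℚ (NetGraph.graph M)
    A′ = adjℚ (NetGraph.graph M′)

  -- For lines l with images l′ = Ql, Q(A + 3I)x = Σ ⟨l, x⟩ Ql = Σ ⟨Ql, Qx⟩ Ql = Σ ⟨l′, Qx⟩ l′ = (A′
  -- + 3I)Qx, and 3Qx cancels.
  orthogonallySimilar : Σ[ Q ∈ Orthogonal N ] ∀ x u → (matrix Q ⊡ (A ⊡ x)) u ≡ (A′ ⊡ (matrix Q ⊡ x)) u
  orthogonallySimilar = Q , λ x u → GroupProperties.∙-cancelʳ ℚ.+-0-group (L.3ℚ ℚ.* (matrix Q ⊡ x) u) _ _ (begin
    (matrix Q ⊡ (A ⊡ x)) u ℚ.+ L.3ℚ ℚ.* (matrix Q ⊡ x) u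
      ≡⟨ cong ((matrix Q ⊡ (A ⊡ x)) u ℚ.+_) (⊡-scale (matrix Q) L.3ℚ x u) ⟨
    (matrix Q ⊡ (A ⊡ x)) u ℚ.+ (matrix Q ⊡ (λ v → L.3ℚ ℚ.* x v)) u
      ≡⟨ ⊡-+ (matrix Q) (A ⊡ x) (λ v → L.3ℚ ℚ.* x v) u ⟨
    (matrix Q ⊡ (λ v → (A ⊡ x) v ℚ.+ L.3ℚ ℚ.* x v)) u
      ≡⟨ ⊡-cong (matrix Q) (L.adjacency-by-lines x) u ⟩
    (matrix Q ⊡ (λ v → sumℚ λ i → sumℚ λ y → inner (L.indicator i y) x ℚ.* L.indicator i y v)) u
      ≡⟨ ⊡-sum (matrix Q) (λ i v → sumℚ λ y → inner (L.indicator i y) x ℚ.* L.indicator i y v) u ⟩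
    sumℚ (λ i → (matrix Q ⊡ (λ v → sumℚ λ y → inner (L.indicator i y) x ℚ.* L.indicator i y v)) u)
      ≡⟨ sumℚ-cong (λ i → ⊡-sum (matrix Q) (λ y v → inner (L.indicator i y) x ℚ.* L.indicator i y v) u) ⟩
    sumℚ (λ i → sumℚ λ y → (matrix Q ⊡ (λ v → inner (L.indicator i y) x ℚ.* L.indicator i y v)) u)
      ≡⟨ sumℚ-cong (λ i → sumℚ-cong λ y → trans (⊡-scale (matrix Q) (inner (L.indicator i y) x) (L.indicator i y) u)
           (cong₂ ℚ._*_ (coefficient x i y) (onLines i y u))) ⟩
    sumℚ (λ i → sumℚ λ y → inner (L′.indicator i y) (matrix Q ⊡ x) ℚ.* L′.indicator i y u)
      ≡⟨ L′.adjacency-by-lines (matrix Q ⊡ x) u ⟨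
    (A′ ⊡ (matrix Q ⊡ x)) u ℚ.+ L.3ℚ ℚ.* (matrix Q ⊡ x) u ∎)
    where
    open ≡-Reasoning

    coefficient : ∀ x i y → inner (L.indicator i y) x ≡ inner (L′.indicator i y) (matrix Q ⊡ x)
    coefficient x i y = trans (sym (Orthogonal.isometry Q (L.indicator i y) x))
      (sumℚ-cong λ v → cong (ℚ._* (matrix Q ⊡ x) v) (onLines i y v))

-- Cospectrality over ℝ

private
  module ℚ≤ = ℚ.≤-Reasoning

half-positive : ∀ {ε} → 0ℚ ℚ.< ε → 0ℚ ℚ.< ε ℚ.* ½
half-positive {ε} 0<ε = subst (ℚ._< ε ℚ.* ½) (ℚ.*-zeroˡ ½) (ℚ.*-monoˡ-<-pos ½ 0<ε)

half+half : ∀ ε → ε ℚ.* ½ ℚ.+ ε ℚ.* ½ ≡ ε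
half+half ε = trans (sym (ℚ.*-distribˡ-+ ε ½ ½)) (ℚ.*-identityʳ ε)

-- The relation `_≈ℝ_` on bare sequences, where the proofs of convergence do not occur.
_~_ : (ℕ → ℚ) → (ℕ → ℚ) → Set
s ~ t = ∀ ε → 0ℚ ℚ.< ε → ∃[ N ] ∀ m → N ≤ m → ℚ.∣ s m ℚ.- t m ∣ ℚ.≤ ε

≐⇒≈ : ∀ {s t} → (∀ m → s m ≡ t m) → s ~ t
≐⇒≈ {s} {t} eq ε 0<ε = 0 , λ m _ → ℚ.≤-trans
  (ℚ.≤-reflexive (cong ℚ.∣_∣ (trans (cong (ℚ._- t m) (eq m)) (ℚ.+-inverseʳ (t m))))) (ℚ.<⇒≤ 0<ε)

≈-sym : ∀ {x y} → x ≈ℝ y → y ≈ℝ x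
≈-sym {x} {y} x≈y ε 0<ε = let N , h = x≈y ε 0<ε in N , λ m N≤m → subst (ℚ._≤ ε)
  (trans (sym (ℚ.∣-p∣≡∣p∣ (seq x m ℚ.- seq y m))) (cong ℚ.∣_∣
    (ℚS.solve 2 (λ a b → ℚS.:- (a ℚS.:- b) ℚS.:= b ℚS.:- a) refl (seq x m) (seq y m)))) (h m N≤m)

private
  triangle-≤ : ∀ a b {p q} → ℚ.∣ a ∣ ℚ.≤ p → ℚ.∣ b ∣ ℚ.≤ q → ℚ.∣ a ℚ.+ b ∣ ℚ.≤ p ℚ.+ q
  triangle-≤ a b a≤p b≤q = ℚ.≤-trans (ℚ.∣p+q∣≤∣p∣+∣q∣ a b) (ℚ.+-mono-≤ a≤p b≤q)

  by-halves : ∀ {a b c d : ℕ → ℚ} (e : ℕ → ℚ) → (∀ m → (a m ℚ.- b m) ℚ.+ (c m ℚ.- d m) ≡ e m) →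
    a ~ b → c ~ d →
    ∀ ε → 0ℚ ℚ.< ε → ∃[ N ] ∀ m → N ≤ m → ℚ.∣ e m ∣ ℚ.≤ ε
  by-halves {a} {b} {c} {d} e eq ab cd ε 0<ε =
    let M , hM = ab (ε ℚ.* ½) (half-positive 0<ε)
        N , hN = cd (ε ℚ.* ½) (half-positive 0<ε)
    in M ℕ.⊔ N , λ m ≤m → subst₂ (λ e ε → ℚ.∣ e ∣ ℚ.≤ ε) (eq m) (half+half ε)
      (triangle-≤ (a m ℚ.- b m) (c m ℚ.- d m)
        (hM m (ℕ.≤-trans (ℕ.m≤m⊔n M N) ≤m)) (hN m (ℕ.≤-trans (ℕ.m≤n⊔m M N) ≤m)))

≈-trans : ∀ {x y z} → x ≈ℝ y → y ≈ℝ z → x ≈ℝ z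
≈-trans {x} {y} {z} = by-halves {seq x} {seq y} {seq y} {seq z} (λ m → seq x m ℚ.- seq z m) λ m →
  ℚS.solve 3 (λ a b c → (a ℚS.:- b) ℚS.:+ (b ℚS.:- c) ℚS.:= a ℚS.:- c) refl (seq x m) (seq y m) (seq z m)

+ℝ-cong : ∀ {x x′ y y′} → x ≈ℝ x′ → y ≈ℝ y′ → x +ℝ y ≈ℝ x′ +ℝ y′
+ℝ-cong {x} {x′} {y} {y′} = by-halves {seq x} {seq x′} {seq y} {seq y′}
  (λ m → (seq x m ℚ.+ seq y m) ℚ.- (seq x′ m ℚ.+ seq y′ m)) λ m →
  ℚS.solve 4 (λ a a′ b b′ → (a ℚS.:- a′) ℚS.:+ (b ℚS.:- b′) ℚS.:= (a ℚS.:+ b) ℚS.:- (a′ ℚS.:+ b′)) refl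
    (seq x m) (seq x′ m) (seq y m) (seq y′ m)

fromℚ-*-cong : ∀ q {x y} → x ≈ℝ y → fromℚ q *ℝ x ≈ℝ fromℚ q *ℝ y
fromℚ-*-cong q {x} {y} x≈y ε 0<ε = let N , h = x≈y (ℚ.1/ c ℚ.* ε) δ-pos in N , λ m N≤m → begin
  ℚ.∣ q ℚ.* seq x m ℚ.- q ℚ.* seq y m ∣
    ≡⟨ cong ℚ.∣_∣ (ℚS.solve 3 (λ q a b → q ℚS.:* a ℚS.:- q ℚS.:* b ℚS.:= q ℚS.:* (a ℚS.:- b)) refl q (seq x m) (seq y m)) ⟩
  ℚ.∣ q ℚ.* (seq x m ℚ.- seq y m) ∣
    ≡⟨ ℚ.∣p*q∣≡∣p∣*∣q∣ q (seq x m ℚ.- seq y m) ⟩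
  ℚ.∣ q ∣ ℚ.* ℚ.∣ seq x m ℚ.- seq y m ∣
    ≤⟨ ℚ.*-monoʳ-≤-nonNeg ℚ.∣ seq x m ℚ.- seq y m ∣ {{ℚ.nonNegative (ℚ.0≤∣p∣ (seq x m ℚ.- seq y m))}} ∣q∣≤c ⟩
  c ℚ.* ℚ.∣ seq x m ℚ.- seq y m ∣
    ≤⟨ ℚ.*-monoˡ-≤-nonNeg c {{ℚ.pos⇒nonNeg c}} (h m N≤m) ⟩
  c ℚ.* (ℚ.1/ c ℚ.* ε)
    ≡⟨ sym (ℚ.*-assoc c (ℚ.1/ c) ε) ⟩
  (c ℚ.* ℚ.1/ c) ℚ.* ε
    ≡⟨ cong (ℚ._* ε) (ℚ.*-inverseʳ c) ⟩
  1ℚ ℚ.* ε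
    ≡⟨ ℚ.*-identityˡ ε ⟩
  ε ∎
  where
  open ℚ≤

  -- A bound for |q| that is at least 1 and so can be divided by, even if q = 0.
  c : ℚ
  c = 1ℚ ℚ.+ ℚ.∣ q ∣

  instance
    c-pos : ℚ.Positive c
    c-pos = ℚ.positive (ℚ.+-mono-<-≤ (ℚ.positive⁻¹ 1ℚ) (ℚ.0≤∣p∣ q))

    c-nonZero : ℚ.NonZero c
    c-nonZero = ℚ.pos⇒nonZero c

  ∣q∣≤c : ℚ.∣ q ∣ ℚ.≤ c
  ∣q∣≤c = subst (ℚ._≤ c) (ℚ.+-identityˡ ℚ.∣ q ∣) (ℚ.+-monoˡ-≤ ℚ.∣ q ∣ (ℚ.<⇒≤ (ℚ.positive⁻¹ 1ℚ)))

  δ-pos : 0ℚ ℚ.< ℚ.1/ c ℚ.* ε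
  δ-pos = subst (ℚ._< ℚ.1/ c ℚ.* ε) (ℚ.*-zeroʳ (ℚ.1/ c)) (ℚ.*-monoʳ-<-pos (ℚ.1/ c) {{ℚ.1/pos⇒pos c}} 0<ε)

∑-cong : ∀ {n} {f g : Fin n → ℝ} → (∀ i → f i ≈ℝ g i) → ∑ f ≈ℝ ∑ g
∑-cong {zero}  f≈g = ≐⇒≈ {seq 0ℝ} {seq 0ℝ} λ _ → refl
∑-cong {suc n} {f} {g} f≈g = +ℝ-cong {f zero} {g zero} {∑ (f ∘ suc)} {∑ (g ∘ suc)} (f≈g zero) (∑-cong (λ i → f≈g (suc i)))

sample : ∀ {N} → ℕ → Vector ℝ N → Fin N → ℚ
sample m x v = seq (x v) m

-- Real arithmetic is termwise, so the m-th term of an expression is that expression in the m-th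
-- terms. Through this the identities proved over ℚ pass to real vectors.
seq-∑ : ∀ {n} (f : Fin n → ℝ) m → seq (∑ f) m ≡ sumℚ (λ i → seq (f i) m)
seq-∑ {zero}  f m = sym (sumℚ-nil (λ i → seq (f i) m))
seq-∑ {suc n} f m = trans (cong (seq (f zero) m ℚ.+_) (seq-∑ (f ∘ suc) m)) (sym (sumℚ-suc (λ i → seq (f i) m)))

seq-· : ∀ {N} (A : Matrix N) x u m → seq ((A · x) u) m ≡ ((λ u v → seq (A u v) m) ⊡ sample m x) u
seq-· A x u m = seq-∑ (λ v → A u v *ℝ x v) m

real : ∀ {N} → (Fin N → Fin N → ℚ) → Matrix N
real Q u v = fromℚ (Q u v)

real-cong : ∀ {N} (Q : Fin N → Fin N → ℚ) {x y} → x ≋ y → (real Q · x) ≋ (real Q · y)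
real-cong Q {x} {y} x≋y u = ∑-cong λ v → fromℚ-*-cong (Q u v) {x v} {y v} (x≋y v)

seq-adjacency : ∀ {N} (G : Graph N) x u m → seq ((adjacencyMatrix G · x) u) m ≡ (adjℚ G ⊡ sample m x) u
seq-adjacency G x u m = trans (seq-· (adjacencyMatrix G) x u m)
  (sumℚ-cong λ v → cong (ℚ._* sample m x v) (entry (adj G u v)))
  where
  entry : ∀ b → seq (if b then 1ℝ else 0ℝ) m ≡ [ b ]ℚ
  entry true  = refl
  entry false = refl

seq-combination : ∀ {N k} (c : Vector ℝ k) (b : Vector (Vector ℝ N) k) v m →
  seq (combination c b v) m ≡ sumℚ λ i → sample m c i ℚ.* sample m (b i) v
seq-combination c b v m = seq-∑ (λ i → c i *ℝ b i v) m

_ᵗʳ : ∀ {N} → Orthogonal N → Orthogonal N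
Q ᵗʳ = record { matrix = matrix Q ᵀ ; inverseˡ = Orthogonal.inverseʳ Q ; inverseʳ = Orthogonal.inverseˡ Q }

Intertwines : ∀ {N} → Orthogonal N → Graph N → Graph N → Set
Intertwines Q G H = ∀ x u → (matrix Q ⊡ (adjℚ G ⊡ x)) u ≡ (adjℚ H ⊡ (matrix Q ⊡ x)) u

intertwines-ᵗʳ : ∀ {N} (Q : Orthogonal N) {G H} → Intertwines Q G H → Intertwines (Q ᵗʳ) H G
intertwines-ᵗʳ Q {G} {H} h x u = trans
  (⊡-cong (matrix Q ᵀ) (λ v → trans (⊡-cong (adjℚ H) (λ w → sym (Orthogonal.inverseʳ Q x w)) v)
    (sym (h (matrix Q ᵀ ⊡ x) v))) u)
  (Orthogonal.inverseˡ Q (adjℚ G ⊡ (matrix Q ᵀ ⊡ x)) u)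

module _ {N} (Q : Orthogonal N) where
  private
    infixr 7 _$_
    _$_ : Orthogonal N → Vector ℝ N → Vector ℝ N
    P $ x = real (matrix P) · x

    cancel : ∀ (P : Orthogonal N) x → (P ᵗʳ $ (P $ x)) ≋ x
    cancel P x u = ≐⇒≈ λ m → trans (seq-· (real (matrix P ᵀ)) (P $ x) u m)
      (trans (⊡-cong (matrix P ᵀ) (λ v → seq-· (real (matrix P)) x v m) u) (Orthogonal.inverseˡ P (sample m x) u))

    on-combination : ∀ (P : Orthogonal N) {k} (c : Vector ℝ k) b →
      (P $ combination c b) ≋ combination c (λ i → P $ b i)
    on-combination P c b u = ≐⇒≈ λ m → begin
      seq ((P $ combination c b) u) m
        ≡⟨ seq-· (real (matrix P)) (combination c b) u m ⟩
      (matrix P ⊡ sample m (combination c b)) u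
        ≡⟨ ⊡-cong (matrix P) (λ v → seq-combination c b v m) u ⟩
      (matrix P ⊡ (λ v → sumℚ λ i → sample m c i ℚ.* sample m (b i) v)) u
        ≡⟨ ⊡-sum (matrix P) (λ i v → sample m c i ℚ.* sample m (b i) v) u ⟩
      sumℚ (λ i → (matrix P ⊡ (λ v → sample m c i ℚ.* sample m (b i) v)) u)
        ≡⟨ sumℚ-cong (λ i → trans (⊡-scale (matrix P) (sample m c i) (sample m (b i)) u)
             (cong (sample m c i ℚ.*_) (sym (seq-· (real (matrix P)) (b i) u m)))) ⟩
      sumℚ (λ i → sample m c i ℚ.* sample m (P $ b i) u)
        ≡⟨ seq-combination c (λ i → P $ b i) u m ⟨
      seq (combination c (λ i → P $ b i) u) m ∎
      where open ≡-Reasoning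

    on-eigenspace : ∀ (P : Orthogonal N) {G H} → Intertwines P G H → ∀ λ′ x →
      Eigenspace (adjacencyMatrix G) λ′ x → Eigenspace (adjacencyMatrix H) λ′ (P $ x)
    on-eigenspace P {G} {H} h λ′ x eigen u = ≈-trans {(adjacencyMatrix H · (P $ x)) u} {(P $ (adjacencyMatrix G · x)) u} {(λ′ ⋆ (P $ x)) u} (≐⇒≈ moved)
      (≈-trans {(P $ (adjacencyMatrix G · x)) u} {(P $ (λ′ ⋆ x)) u} {(λ′ ⋆ (P $ x)) u} (real-cong (matrix P) {adjacencyMatrix G · x} {λ′ ⋆ x} eigen u) (≐⇒≈ scaled))
      where
      moved : ∀ m → seq ((adjacencyMatrix H · (P $ x)) u) m ≡ seq ((P $ (adjacencyMatrix G · x)) u) m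
      moved m = begin
        seq ((adjacencyMatrix H · (P $ x)) u) m      ≡⟨ seq-adjacency H (P $ x) u m ⟩
        (adjℚ H ⊡ sample m (P $ x)) u                ≡⟨ ⊡-cong (adjℚ H) (λ v → seq-· (real (matrix P)) x v m) u ⟩
        (adjℚ H ⊡ (matrix P ⊡ sample m x)) u         ≡⟨ h (sample m x) u ⟨
        (matrix P ⊡ (adjℚ G ⊡ sample m x)) u         ≡⟨ ⊡-cong (matrix P) (λ v → seq-adjacency G x v m) u ⟨
        (matrix P ⊡ sample m (adjacencyMatrix G · x)) u ≡⟨ seq-· (real (matrix P)) (adjacencyMatrix G · x) u m ⟨
        seq ((P $ (adjacencyMatrix G · x)) u) m      ∎
        where open ≡-Reasoning

      scaled : ∀ m → seq ((P $ (λ′ ⋆ x)) u) m ≡ seq ((λ′ ⋆ (P $ x)) u) m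
      scaled m = trans (seq-· (real (matrix P)) (λ′ ⋆ x) u m)
        (trans (⊡-scale (matrix P) (seq λ′ m) (sample m x) u)
          (cong (seq λ′ m ℚ.*_) (sym (seq-· (real (matrix P)) x u m))))

    on-zero : ∀ (P : Orthogonal N) → (P $ 𝟎) ≋ 𝟎
    on-zero P u = ≐⇒≈ λ m → trans (seq-· (real (matrix P)) 𝟎 u m)
      (trans (sumℚ-cong λ v → ℚ.*-zeroʳ (matrix P u v)) sumℚ-zero)

  -- The basis is moved by Q. Independence is tested after moving a vanishing combination back by
  -- the transpose, and a vector of the target eigenspace is expanded after moving it back.
  intertwined⇒dimension : ∀ {G H} → Intertwines Q G H → ∀ λ′ k →
    HasDimension (Eigenspace (adjacencyMatrix G) λ′) k → HasDimension (Eigenspace (adjacencyMatrix H) λ′) k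
  intertwined⇒dimension {G} {H} h λ′ k (b , eigen , independent , spans) =
    (λ i → Q $ b i) ,
    (λ i → on-eigenspace Q {G} {H} h λ′ (b i) (eigen i)) ,
    (λ c zero-combination → independent c λ v →
      ≈-trans {combination c b v} {(Q ᵗʳ $ (Q $ combination c b)) v} {0ℝ}
        (≈-sym {(Q ᵗʳ $ (Q $ combination c b)) v} {combination c b v} (cancel Q (combination c b) v))
        (≈-trans {(Q ᵗʳ $ (Q $ combination c b)) v} {(Q ᵗʳ $ 𝟎) v} {0ℝ} (real-cong (matrix Q ᵀ) {Q $ combination c b} {𝟎} (λ u →
          ≈-trans {(Q $ combination c b) u} {combination c (λ i → Q $ b i) u} {0ℝ} (on-combination Q c b u) (zero-combination u)) v) (on-zero (Q ᵗʳ) v))) ,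
    λ x eigen-x → let c , eq = spans (Q ᵗʳ $ x) (on-eigenspace (Q ᵗʳ) {H} {G} (intertwines-ᵗʳ Q {G} {H} h) λ′ x eigen-x) in
      c , λ v → ≈-trans {x v} {(Q $ (Q ᵗʳ $ x)) v} {combination c (λ i → Q $ b i) v} (≈-sym {(Q $ (Q ᵗʳ $ x)) v} {x v} (cancel (Q ᵗʳ) x v))
        (≈-trans {(Q $ (Q ᵗʳ $ x)) v} {(Q $ combination c b) v} {combination c (λ i → Q $ b i) v} (real-cong (matrix Q) {Q ᵗʳ $ x} {combination c b} eq v) (on-combination Q c b v))

netGraphs-cospectral : ∀ {n N} (M M′ : Net n N) → Cospectral (NetGraph.graph M) (NetGraph.graph M′)
netGraphs-cospectral M M′ λ′ k = let Q , h = orthogonallySimilar M M′ in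
  mk⇔ (intertwined⇒dimension Q {NetGraph.graph M} {NetGraph.graph M′} h λ′ k)
      (intertwined⇒dimension (Q ᵗʳ) {NetGraph.graph M′} {NetGraph.graph M}
        (intertwines-ᵗʳ Q {NetGraph.graph M} {NetGraph.graph M′} h) λ′ k)

-- Distances between graphs

count-cong : ∀ {n} {p q : Fin n → Bool} → (∀ i → p i ≡ q i) → count p ≡ count q
count-cong {p = p} {q} eq = trans (count≡sum p) (trans (ℕ-Sum.sum-cong-≗ (λ i → cong 𝟙 (eq i))) (sym (count≡sum q)))

count-∘-≤ : ∀ {N} (f : Fin N → Fin N) → (∀ {i j} → f i ≡ f j → i ≡ j) → ∀ p → count (p ∘ f) ≤ count p
count-∘-≤ {N} f f-injective p = injection⇒≤count (f ∘ List.lookup hits)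
  (λ {i} {j} eq → lookup-injective (Unique.filter⁺ (Bool.T? ∘ p ∘ f) (Unique.allFin⁺ N)) i j (f-injective eq))
  (λ i → T⇒≡ (proj₂ (∈-filter⁻ (Bool.T? ∘ p ∘ f) {xs = allFin N} (∈-lookup i))))
  where
  hits : List (Fin N)
  hits = filterᵇ (p ∘ f) (allFin N)

count-∘ : ∀ {N} (f : Fin N → Fin N) → (∀ {i j} → f i ≡ f j → i ≡ j) → ∀ p → count (p ∘ f) ≡ count p
count-∘ {N} f f-injective p = ℕ.≤-antisym (count-∘-≤ f f-injective p)
  (ℕ.≤-trans (ℕ.≤-reflexive (count-cong λ i → cong p (sym (proj₂ (onto i)))))
    (count-∘-≤ (proj₁ ∘ onto) (λ {i} {j} eq → trans (sym (proj₂ (onto i))) (trans (cong f eq) (proj₂ (onto j)))) (p ∘ f)))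
  where
  onto : ∀ y → ∃[ x ] f x ≡ y
  onto = injective⇒surjective f f-injective

_≗ᴳ_ : ∀ {N} → Graph N → Graph N → Set
G ≗ᴳ H = ∀ u v → adj G u v ≡ adj H u v

latinLike-^ : ∀ {n k N} {G : Graph N} (π : Fin N ↣ Fin N) → LatinLike n k G → LatinLike n k (G ^ π)
latinLike-^ {n} {k} {N} {G} π g = record
  { regular     = λ x → let u , eq = onto x in subst (λ x → degree (G ^ π) x ≡ k) eq
      (trans (sym (count-∘ ψ ψ-injective (adj (G ^ π) (ψ u))))
        (trans (count-cong λ v → adj-^ G π u v) (regular g u)))
  ; adjacent    = λ {x} {y} a → let u , p = onto x ; v , q = onto y in
      subst (n ≤_) (sym (common-^ p q)) (adjacent g (trans (sym (adj-^ G π u v)) (subst₂ (λ x y → adj (G ^ π) x y ≡ true) (sym p) (sym q) a)))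
  ; nonadjacent = λ {x} {y} x≢y a → let u , p = onto x ; v , q = onto y in
      subst (_≤ 6) (sym (common-^ p q)) (nonadjacent g (λ u≡v → x≢y (trans (sym p) (trans (cong ψ u≡v) q)))
        (trans (sym (adj-^ G π u v)) (subst₂ (λ x y → adj (G ^ π) x y ≡ false) (sym p) (sym q) a)))
  }
  where
  ψ = Injection.to π
  ψ-injective = Injection.injective π

  onto : ∀ y → ∃[ x ] ψ x ≡ y
  onto = injective⇒surjective ψ ψ-injective

  common-^ : ∀ {u v x y} → ψ u ≡ x → ψ v ≡ y → common (G ^ π) x y ≡ common G u v
  common-^ {u} {v} refl refl = trans (sym (count-∘ ψ ψ-injective (both (G ^ π) (ψ u) (ψ v))))
    (count-cong λ w → cong₂ _∧_ (adj-^ G π u w) (adj-^ G π v w))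

-- Every change at v is the edge from v to some w, counted by `μE` with the smaller end first; v
-- being fixed, the ordered pair still determines w.
distanceAt≤μE : ∀ {N} (G H : Graph N) v → distanceAt G H v ≤ μE G H
distanceAt≤μE {N} G H v = injection⇒≤length _ (orient ∘ List.lookup hits)
  (λ {i} {j} eq → lookup-injective (Unique.filter⁺ (Bool.T? ∘ differ G H v) (Unique.allFin⁺ N)) i j (orient-injective eq))
  (λ i → ∈-filter⁺ _ (∈-cartesianProduct⁺ (∈-allFin _) (∈-allFin _))
    (oriented _ (T⇒≡ (proj₂ (∈-filter⁻ (Bool.T? ∘ differ G H v) {xs = allFin N} (∈-lookup i))))))
  where
  hits : List (Fin N)
  hits = filterᵇ (differ G H v) (allFin N)

  orient : Fin N → Fin N × Fin N
  orient w with v Fin.<? w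
  ... | yes _ = v , w
  ... | no _  = w , v

  orient-injective : ∀ {w w′} → orient w ≡ orient w′ → w ≡ w′
  orient-injective {w} {w′} eq with v Fin.<? w | v Fin.<? w′
  ... | yes _ | yes _ = cong proj₂ eq
  ... | yes _ | no _  = trans (cong proj₂ eq) (cong proj₁ eq)
  ... | no _  | yes _ = trans (cong proj₁ eq) (cong proj₂ eq)
  ... | no _  | no _  = cong proj₁ eq

  irreflexive-differ : differ G H v v ≢ true
  irreflexive-differ eq rewrite irreflexive G v | irreflexive H v = contradiction eq λ ()

  oriented : ∀ w → differ G H v w ≡ true → let x , y = orient w in
    T (does (x Fin.<? y) ∧ ((adj G x y ∧ not (adj H x y)) ∨ (adj H x y ∧ not (adj G x y))))
  oriented w eq with v Fin.<? w
  ... | yes v<w = ≡⇒T (cong₂ _∧_ (dec-true (v Fin.<? w) v<w) eq)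
  ... | no v≮w = ≡⇒T (cong₂ _∧_ (dec-true (w Fin.<? v) w<v)
    (trans (cong₂ (λ a b → (a ∧ not b) ∨ (b ∧ not a)) (symmetric G w v) (symmetric H w v)) eq))
    where
    w<v : w Fin′.< v
    w<v with Fin.<-cmp v w
    ... | tri< v<w _ _ = contradiction v<w v≮w
    ... | tri≈ _ refl _ = contradiction eq irreflexive-differ
    ... | tri> _ _ w<v = w<v

∧-not-self : ∀ a → (a ∧ not a) ∨ (a ∧ not a) ≡ false
∧-not-self true  = refl
∧-not-self false = refl

differ-≗ : ∀ {N} (G H : Graph N) → G ≗ᴳ H → ∀ u v → differ G H u v ≡ false
differ-≗ G H eq u v = trans (cong (λ a → (a ∧ not (adj H u v)) ∨ (adj H u v ∧ not a)) (eq u v)) (∧-not-self (adj H u v))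

μE-≗ : ∀ {N} (G H : Graph N) → G ≗ᴳ H → μE G H ≡ 0
μE-≗ {N} G H eq = cong length (List.filter-none _ {xs = cartesianProduct (allFin N) (allFin N)}
  (All.tabulate λ { {u , v} _ t → absurd (does (u Fin.<? v)) (differ-≗ G H eq u v) t }))
  where
  absurd : ∀ a {b} → b ≡ false → ¬ T (a ∧ b)
  absurd true  refl ()
  absurd false refl ()

maxDegree-regular : ∀ {k N} (G : Graph N) → Fin N → (∀ v → degree G v ≡ k) → maxDegree G ≡ k
maxDegree-regular {k} {N} G v reg = ℕ.≤-antisym
  (max≤v⁺ z≤n (All.map⁺ (All.universal (λ u → ℕ.≤-reflexive (reg u)) (allFin N))))
  (v≤max⁺ 0 (List.map (degree G) (allFin N)) (inj₂ (Any.map (λ { refl → ℕ.≤-reflexive (sym (reg v)) })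
    (∈-map⁺ (degree G) (∈-allFin v)))))

castℚ≡ : ∀ n → castℚ n ≡ ℤ.+ n ℚ./ 1
castℚ≡ zero    = refl
castℚ≡ (suc n) = trans (cong (1ℚ ℚ.+_) (trans (castℚ≡ n) (ℚ.normalize-coprime {n} {0} (coprime-sym (1-coprimeTo n)))))
  (cong (ℚ._/ 1) (cong (ℤ._+_ (ℤ.+ 1)) (ℤ.*-identityʳ (ℤ.+ n))))

3m/3≡castℚ : ∀ m → ℤ.+ (3 * m) ℚ./ 3 ≡ castℚ m
3m/3≡castℚ m = trans (ℚ.fromℚᵘ-cong {ℚᵘ.mkℚᵘ (ℤ.+ (3 * m)) 2} {ℚᵘ.mkℚᵘ (ℤ.+ m) 0} (ℚᵘ.*≡*
  (trans (ℤ.*-identityʳ (ℤ.+ (3 * m))) (trans (cong ℤ.+_ (ℕ.*-comm 3 m)) (ℤ.pos-* m 3))))) (sym (castℚ≡ m))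

castℚ-+ : ∀ a b → castℚ (a + b) ≡ castℚ a ℚ.+ castℚ b
castℚ-+ zero    b = sym (ℚ.+-identityˡ (castℚ b))
castℚ-+ (suc a) b = trans (cong (1ℚ ℚ.+_) (castℚ-+ a b)) (sym (ℚ.+-assoc 1ℚ (castℚ a) (castℚ b)))

castℚ≥0 : ∀ n → 0ℚ ℚ.≤ castℚ n
castℚ≥0 zero    = ℚ.≤-refl
castℚ≥0 (suc n) = ℚ.+-mono-≤ (ℚ.<⇒≤ (ℚ.positive⁻¹ 1ℚ)) (castℚ≥0 n)

castℚ-mono-≤ : ∀ {a b} → a ≤ b → castℚ a ℚ.≤ castℚ b
castℚ-mono-≤ {b = b} z≤n = castℚ≥0 b
castℚ-mono-≤ (s≤s a≤b) = ℚ.+-monoʳ-≤ 1ℚ (castℚ-mono-≤ a≤b)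

<⇒≱ℚ : ∀ {p q} → p ℚ.< q → ¬ (q ℚ.≤ p)
<⇒≱ℚ p<q q≤p = ℚ.<-irrefl refl (ℚ.<-≤-trans p<q q≤p)

castℚ-cancel-≤ : ∀ {a b} → castℚ a ℚ.≤ castℚ b → a ≤ b
castℚ-cancel-≤ {a} {b} h with a ℕ.≤? b
... | yes a≤b = a≤b
... | no a≰b = contradiction (ℚ.≤-trans (castℚ-mono-≤ (ℕ.≰⇒> a≰b)) h) (<⇒≱ℚ (subst (ℚ._< 1ℚ ℚ.+ castℚ b)
  (ℚ.+-identityˡ (castℚ b)) (ℚ.+-monoˡ-< (castℚ b) (ℚ.positive⁻¹ 1ℚ))))

≤ℝ-trans : ∀ {x y z} → x ≤ℝ y → y ≤ℝ z → x ≤ℝ z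
≤ℝ-trans {x} {y} {z} x≤y y≤z ε 0<ε =
  let M , hM = x≤y (ε ℚ.* ½) (half-positive 0<ε)
      N , hN = y≤z (ε ℚ.* ½) (half-positive 0<ε)
  in M ℕ.⊔ N , λ m ≤m → ℚ.≤-trans (hM m (ℕ.≤-trans (ℕ.m≤m⊔n M N) ≤m))
    (ℚ.≤-trans (ℚ.+-monoˡ-≤ (ε ℚ.* ½) (hN m (ℕ.≤-trans (ℕ.m≤n⊔m M N) ≤m)))
      (ℚ.≤-reflexive (trans (ℚ.+-assoc (seq z m) (ε ℚ.* ½) (ε ℚ.* ½)) (cong (seq z m ℚ.+_) (half+half ε)))))

0<difference : ∀ {p q} → p ℚ.< q → 0ℚ ℚ.< q ℚ.- p
0<difference {p} {q} p<q = subst (ℚ._< q ℚ.- p) (ℚ.+-inverseʳ p) (ℚ.+-monoˡ-< (ℚ.- p) p<q)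

p≤p+ε : ∀ p {ε} → 0ℚ ℚ.< ε → p ℚ.≤ p ℚ.+ ε
p≤p+ε p {ε} 0<ε = subst (ℚ._≤ p ℚ.+ ε) (ℚ.+-identityʳ p) (ℚ.+-monoʳ-≤ p (ℚ.<⇒≤ 0<ε))

fromℚ-mono-≤ : ∀ {p q} → p ℚ.≤ q → fromℚ p ≤ℝ fromℚ q
fromℚ-mono-≤ {p} {q} p≤q ε 0<ε = 0 , λ _ _ → ℚ.≤-trans p≤q (p≤p+ε q 0<ε)

fromℚ-cancel-≤ : ∀ {p q} → fromℚ p ≤ℝ fromℚ q → p ℚ.≤ q
fromℚ-cancel-≤ {p} {q} h with p ℚ.≤? q
... | yes p≤q = p≤q
... | no p≰q = contradiction (proj₂ (h ε 0<ε) _ ℕ.≤-refl) (<⇒≱ℚ (subst (ℚ._< p) (ℚ.+-identityʳ (q ℚ.+ ε)) (subst (q ℚ.+ ε ℚ.+ 0ℚ ℚ.<_) recombine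
      (ℚ.+-monoʳ-< (q ℚ.+ ε) 0<ε))))
  where
  ε : ℚ
  ε = (p ℚ.- q) ℚ.* ½

  0<ε : 0ℚ ℚ.< ε
  0<ε = half-positive (0<difference (ℚ.≰⇒> p≰q))

  recombine : q ℚ.+ ε ℚ.+ ε ≡ p
  recombine = trans (ℚ.+-assoc q ε ε) (trans (cong (q ℚ.+_) (half+half (p ℚ.- q)))
    (ℚS.solve 2 (λ q p → q ℚS.:+ (p ℚS.:- q) ℚS.:= p) refl q p))

sumℚ-mono-≤ : ∀ {N} {f g : Fin N → ℚ} → (∀ i → f i ℚ.≤ g i) → sumℚ f ℚ.≤ sumℚ g
sumℚ-mono-≤ {zero} {f} {g} f≤g = ℚ.≤-reflexive (trans (sumℚ-nil f) (sym (sumℚ-nil g)))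
sumℚ-mono-≤ {suc N} {f} {g} f≤g = subst₂ ℚ._≤_ (sym (sumℚ-suc f)) (sym (sumℚ-suc g))
  (ℚ.+-mono-≤ (f≤g zero) (sumℚ-mono-≤ (λ i → f≤g (suc i))))

term≤sumℚ : ∀ {N} {f : Fin N → ℚ} → (∀ i → 0ℚ ℚ.≤ f i) → ∀ v → f v ℚ.≤ sumℚ f
term≤sumℚ {f = f} 0≤f v = subst (ℚ._≤ sumℚ f) (sum-δ v f) (sumℚ-mono-≤ below)
  where
  below : ∀ i → δ v i ℚ.* f i ℚ.≤ f i
  below i with does (v Fin.≟ i)
  ... | true  = ℚ.≤-reflexive (ℚ.*-identityˡ (f i))
  ... | false = subst (ℚ._≤ f i) (sym (ℚ.*-zeroˡ (f i))) (0≤f i)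

seq-‖‖ : ∀ {N} (x : Vector ℝ N) m → seq ‖ x ‖₁ m ≡ sumℚ (λ v → ℚ.∣ sample m x v ∣)
seq-‖‖ x m = seq-∑ (λ v → ∣ x v ∣ℝ) m

difference : ∀ {N} → Graph N → Graph N → Matrix N
difference G H = adjacencyMatrix G ⊖ adjacencyMatrix H

basis : ∀ {N} → Fin N → Vector ℝ N
basis v w = fromℚ (δ v w)

module _ {N} (G H : Graph N) where

  -- The difference applied to a basis vector is its column at v, with entries 1 or -1 exactly at
  -- the changes. Through these ratios μ₁ bounds the number of changes at each vertex.
  column-norm : ∀ (v : Fin N) m → seq ‖ difference G H · basis v ‖₁ m ≡ castℚ (distanceAt G H v)
  column-norm v m = begin
    seq ‖ difference G H · basis v ‖₁ m
      ≡⟨ seq-‖‖ (difference G H · basis v) m ⟩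
    sumℚ (λ u → ℚ.∣ sample m (difference G H · basis v) u ∣)
      ≡⟨ sumℚ-cong (λ u → trans (cong ℚ.∣_∣ (trans (seq-· (difference G H) (basis v) u m)
           (trans (sumℚ-cong λ w → ℚ.*-comm (seq (difference G H u w) m) (δ v w))
             (sum-δ v (λ w → seq (difference G H u w) m)))))
           (trans (entry (adj G u v) (adj H u v))
             (cong₂ (λ a b → [ (a ∧ not b) ∨ (b ∧ not a) ]ℚ) (symmetric G u v) (symmetric H u v)))) ⟩
    sumℚ (λ u → [ differ G H v u ]ℚ)
      ≡⟨ sumℚ-[] (differ G H v) ⟩
    castℚ (distanceAt G H v) ∎
    where
    open ≡-Reasoning

    entry : ∀ a b → ℚ.∣ seq (if a then 1ℝ else 0ℝ) m ℚ.- seq (if b then 1ℝ else 0ℝ) m ∣ ≡ [ (a ∧ not b) ∨ (b ∧ not a) ]ℚ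
    entry true  true  = refl
    entry true  false = refl
    entry false true  = refl
    entry false false = refl

  basis-norm : ∀ (v : Fin N) m → seq ‖ basis v ‖₁ m ≡ 1ℚ
  basis-norm v m = trans (seq-‖‖ (basis v) m) (trans (sumℚ-cong entry) (sum-δ v (λ _ → 1ℚ)))
    where
    entry : ∀ w → ℚ.∣ δ v w ∣ ≡ δ v w ℚ.* 1ℚ
    entry w with does (v Fin.≟ w)
    ... | true  = refl
    ... | false = refl

  basis≢𝟎 : ∀ (v : Fin N) → ¬ (basis v ≋ 𝟎)
  basis≢𝟎 v basis≋𝟎 with basis≋𝟎 v ½ (ℚ.positive⁻¹ ½)
  ... | N , h = <⇒≱ℚ (ℚ.*<* (ℤ.+<+ (s≤s (s≤s z≤n)))) (subst (λ d → ℚ.∣ d ℚ.- 0ℚ ∣ ℚ.≤ ½) (cong [_]ℚ (dec-true (v Fin.≟ v) refl)) (h N ℕ.≤-refl))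

  column-ratio : ∀ (v : Fin N) → IsRatio G H (fromℚ (castℚ (distanceAt G H v)))
  column-ratio v = basis v , basis≢𝟎 v , ≐⇒≈ λ m →
    trans (cong (castℚ (distanceAt G H v) ℚ.*_) (basis-norm v m))
      (trans (ℚ.*-identityʳ (castℚ (distanceAt G H v))) (sym (column-norm v m)))

  column≤μ₁ : ∀ {d} → Isμ₁ G H d → ∀ v → fromℚ (castℚ (distanceAt G H v)) ≤ℝ d
  column≤μ₁ (bound , _) v = bound (fromℚ (castℚ (distanceAt G H v))) (column-ratio v)

  μ₁≥0 : ∀ {d} → Isμ₁ G H d → Fin N → 0ℝ ≤ℝ d
  μ₁≥0 {d} sup v = ≤ℝ-trans {0ℝ} {fromℚ (castℚ (distanceAt G H v))} {d}
    (fromℚ-mono-≤ (castℚ≥0 (distanceAt G H v))) (column≤μ₁ {d} sup v)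

  -- If q were bounded below by a positive rational, q ‖x‖₁ ≈ 0 would force x ≈ 0.
  ≗⇒ratio≤0 : G ≗ᴳ H → ∀ q → IsRatio G H q → q ≤ℝ 0ℝ
  ≗⇒ratio≤0 G≗H q (x , x≢𝟎 , q‖x‖≈) ε 0<ε = decide (seq q n₀ ℚ.≤? ε ℚ.* ½)
    where
    -- Beyond this index q moves by at most ε/2, so the undecidable comparison of q with 0 is
    -- replaced by one of a single rational term with ε/2.
    n₀ : ℕ
    n₀ = proj₁ (cauchy q (ε ℚ.* ½) (half-positive 0<ε))

    close : ∀ n → n₀ ≤ n → ℚ.∣ seq q n ℚ.- seq q n₀ ∣ ℚ.≤ ε ℚ.* ½
    close n n₀≤n = proj₂ (cauchy q (ε ℚ.* ½) (half-positive 0<ε)) n n₀ n₀≤n ℕ.≤-refl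

    p≤∣p∣ : ∀ p → p ℚ.≤ ℚ.∣ p ∣
    p≤∣p∣ p with ℚ.≤-total 0ℚ p
    ... | inj₁ 0≤p = ℚ.≤-reflexive (sym (ℚ.0≤p⇒∣p∣≡p 0≤p))
    ... | inj₂ p≤0 = ℚ.≤-trans p≤0 (ℚ.0≤∣p∣ p)

    annihilated : ∀ m → seq ‖ difference G H · x ‖₁ m ≡ 0ℚ
    annihilated m = trans (seq-‖‖ (difference G H · x) m) (trans (sumℚ-cong (λ u → cong ℚ.∣_∣
      (trans (seq-· (difference G H) x u m) (trans (sumℚ-cong (λ v → trans (cong (ℚ._* sample m x v) (entry u v))
        (ℚ.*-zeroˡ (sample m x v)))) sumℚ-zero)))) sumℚ-zero)
      where
      entry : ∀ u v → seq (difference G H u v) m ≡ 0ℚ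
      entry u v rewrite G≗H u v = ℚ.+-inverseʳ (seq (adjacencyMatrix H u v) m)

    decide : Dec (seq q n₀ ℚ.≤ ε ℚ.* ½) → ∃[ M ] ∀ n → M ≤ n → seq q n ℚ.≤ 0ℚ ℚ.+ ε
    decide (yes small) = n₀ , λ n n₀≤n → ℚ.≤-trans
      (ℚ.≤-reflexive (ℚS.solve 2 (λ a b → a ℚS.:= (a ℚS.:- b) ℚS.:+ b) refl (seq q n) (seq q n₀)))
      (ℚ.≤-trans (ℚ.+-mono-≤ (ℚ.≤-trans (p≤∣p∣ (seq q n ℚ.- seq q n₀)) (close n n₀≤n)) small)
        (ℚ.≤-reflexive (trans (half+half ε) (sym (ℚ.+-identityˡ ε)))))
    decide (no large) = contradiction x≋𝟎 x≢𝟎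
      where
      -- A positive lower bound for all terms of q from `n₀` on.
      c : ℚ
      c = seq q n₀ ℚ.- ε ℚ.* ½

      0<c : 0ℚ ℚ.< c
      0<c = 0<difference (ℚ.≰⇒> large)

      instance
        c-pos : ℚ.Positive c
        c-pos = ℚ.positive 0<c

      c≤q : ∀ n → n₀ ≤ n → c ℚ.≤ seq q n
      c≤q n n₀≤n = subst (c ℚ.≤_)
        (ℚS.solve 2 (λ a b → (a ℚS.:- b) ℚS.:+ b ℚS.:= a) refl (seq q n) (ε ℚ.* ½))
        (ℚ.≤-trans (ℚ.≤-reflexive (ℚS.solve 3 (λ a b e → b ℚS.:- e ℚS.:= (a ℚS.:- e) ℚS.:+ (b ℚS.:- a)) refl
            (seq q n) (seq q n₀) (ε ℚ.* ½)))
          (ℚ.+-monoʳ-≤ (seq q n ℚ.- ε ℚ.* ½) (ℚ.≤-trans (p≤∣p∣ (seq q n₀ ℚ.- seq q n))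
            (subst (ℚ._≤ ε ℚ.* ½) (trans (sym (ℚ.∣-p∣≡∣p∣ (seq q n ℚ.- seq q n₀))) (cong ℚ.∣_∣
              (ℚS.solve 2 (λ a b → ℚS.:- (a ℚS.:- b) ℚS.:= b ℚS.:- a) refl (seq q n) (seq q n₀)))) (close n n₀≤n)))))

      ‖x‖ : ℕ → ℚ
      ‖x‖ n = seq ‖ x ‖₁ n

      coordinate≤ : ∀ v n → ℚ.∣ sample n x v ∣ ℚ.≤ ‖x‖ n
      coordinate≤ v n = subst (ℚ.∣ sample n x v ∣ ℚ.≤_) (sym (seq-‖‖ x n)) (term≤sumℚ (λ i → ℚ.0≤∣p∣ (sample n x i)) v)

      x≋𝟎 : x ≋ 𝟎
      x≋𝟎 v η 0<η = n₀ ℕ.⊔ M , λ n ≤n → subst (λ d → ℚ.∣ d ∣ ℚ.≤ η) (sym (ℚ.+-identityʳ (sample n x v)))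
        (ℚ.≤-trans (coordinate≤ v n) (ℚ.*-cancelˡ-≤-pos c (bound n (ℕ.≤-trans (ℕ.m≤m⊔n n₀ M) ≤n) (ℕ.≤-trans (ℕ.m≤n⊔m n₀ M) ≤n))))
        where
        -- With the tolerance cη one gets c‖x‖ ≤ q‖x‖ ≤ cη, and c cancels.
        0<cη : 0ℚ ℚ.< c ℚ.* η
        0<cη = subst (ℚ._< c ℚ.* η) (ℚ.*-zeroʳ c) (ℚ.*-monoʳ-<-pos c 0<η)

        M : ℕ
        M = proj₁ (q‖x‖≈ (c ℚ.* η) 0<cη)

        bound : ∀ n → n₀ ≤ n → M ≤ n → c ℚ.* ‖x‖ n ℚ.≤ c ℚ.* η
        bound n n₀≤n M≤n = ℚ.≤-trans
          (ℚ.*-monoʳ-≤-nonNeg (‖x‖ n) {{ℚ.nonNegative (ℚ.≤-trans (ℚ.0≤∣p∣ (sample n x v)) (coordinate≤ v n))}} (c≤q n n₀≤n))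
          (ℚ.≤-trans (p≤∣p∣ (seq q n ℚ.* ‖x‖ n))
            (subst (λ d → ℚ.∣ d ∣ ℚ.≤ c ℚ.* η) (trans (cong (λ t → seq q n ℚ.* ‖x‖ n ℚ.- t) (annihilated n))
              (ℚ.+-identityʳ (seq q n ℚ.* ‖x‖ n))) (proj₂ (q‖x‖≈ (c ℚ.* η) 0<cη) n M≤n)))

  -- The vertex supplies a nonnegative ratio lying below every upper bound; with no vertices every
  -- real would be an upper bound.
  ≗⇒Isμ₁ : G ≗ᴳ H → Fin N → Isμ₁ G H 0ℝ
  ≗⇒Isμ₁ G≗H v = ≗⇒ratio≤0 G≗H , λ u upper → ≤ℝ-trans {0ℝ} {fromℚ (castℚ (distanceAt G H v))} {u}
    (fromℚ-mono-≤ (castℚ≥0 (distanceAt G H v))) (upper (fromℚ (castℚ (distanceAt G H v))) (column-ratio v))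

-- Small distances and isomorphism of net graphs

module _ {m N} (M M′ : Net (suc m) N) (v₀ : Fin N) where
  private
    G H : Graph N
    G = NetGraph.graph M
    H = NetGraph.graph M′

  GraphsIsomorphic : Set
  GraphsIsomorphic = Σ[ π ∈ Fin N ↣ Fin N ] (G ^ π) ≗ᴳ H

  netGraph-maxDegree : ∀ (M : Net (suc m) N) → maxDegree (NetGraph.graph M) ≡ 3 * m
  netGraph-maxDegree M = maxDegree-regular (NetGraph.graph M) v₀ (netGraph-degree M)

  cospectralPair : CospectralPair
  cospectralPair = record
    { G          = G
    ; H          = H
    ; cospectral = netGraphs-cospectral M M′
    ; maxDegreeG = netGraph-maxDegree M
    ; maxDegreeH = netGraph-maxDegree M′
    }

  close⇒isomorphic : ∀ π → (∀ v → 5 + distanceAt (G ^ π) H v ≤ suc m) → GraphsIsomorphic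
  close⇒isomorphic π close = π , rigid-≡ {k = 3 * m} (latinLike-^ π (netGraph-latinLike M)) (netGraph-latinLike M′) close

  isomorphic⇒δE≤ : GraphsIsomorphic → ∀ {r} → 0ℝ ≤ℝ r → δE[ G , H ]≤ r
  isomorphic⇒δE≤ (π , eq) 0≤r = 0 , ((π , μE-≗ (G ^ π) H eq) , λ _ _ → z≤n) , 0≤r

  δE≤⇒isomorphic : ∀ {r} → (∀ d → fromℕ d ≤ℝ r → 5 + d ≤ suc m) → δE[ G , H ]≤ r → GraphsIsomorphic
  δE≤⇒isomorphic small (d , ((π , μ≡d) , _) , d≤r) = close⇒isomorphic π λ v →
    ℕ.≤-trans (ℕ.+-monoʳ-≤ 5 (ℕ.≤-trans (distanceAt≤μE (G ^ π) H v) (ℕ.≤-reflexive μ≡d))) (small d d≤r)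

  threshold : ℚ
  threshold = ℤ.+ (3 * m) ℚ./ 3 ℚ.- ℤ.+ 4 ℚ./ 1

  threshold+4 : threshold ℚ.+ castℚ 4 ≡ castℚ m
  threshold+4 = trans (cong (λ t → t ℚ.- ℤ.+ 4 ℚ./ 1 ℚ.+ castℚ 4) (3m/3≡castℚ m))
    (trans (ℚ.+-assoc (castℚ m) (ℚ.- (ℤ.+ 4 ℚ./ 1)) (castℚ 4)) (ℚ.+-identityʳ (castℚ m)))

  -- The minimum has to be exhibited, and it is 0: attained at the isomorphism, and below every μ₁.
  -- The condition 4 ≤ m makes the threshold nonnegative.
  isomorphic⇒δ₁≤ : 4 ≤ m → GraphsIsomorphic → δ₁[ G , H ]≤ fromℚ threshold
  isomorphic⇒δ₁≤ 4≤m (π , eq) = 0ℝ , ((π , ≗⇒Isμ₁ (G ^ π) H eq v₀) , λ e (π′ , sup) → μ₁≥0 (G ^ π′) H {e} sup v₀) ,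
    fromℚ-mono-≤ {0ℚ} {threshold} (subst₂ ℚ._≤_ (ℚ.+-inverseʳ (castℚ 4)) (trans (cong (ℚ._- castℚ 4) (sym threshold+4))
      (ℚS.solve 2 (λ t f → t ℚS.:+ f ℚS.:- f ℚS.:= t) refl threshold (castℚ 4)))
      (ℚ.+-monoˡ-≤ (ℚ.- castℚ 4) (castℚ-mono-≤ 4≤m)))

  δ₁≤⇒isomorphic : δ₁[ G , H ]≤ fromℚ threshold → GraphsIsomorphic
  δ₁≤⇒isomorphic (d , ((π , sup) , _) , d≤r) = close⇒isomorphic π λ v → s≤s (subst (_≤ m) (ℕ.+-comm (distanceAt (G ^ π) H v) 4)
    (castℚ-cancel-≤ (subst₂ ℚ._≤_ (sym (castℚ-+ (distanceAt (G ^ π) H v) 4)) threshold+4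
      (ℚ.+-monoˡ-≤ (castℚ 4) (fromℚ-cancel-≤ {castℚ (distanceAt (G ^ π) H v)} {threshold} (≤ℝ-trans {fromℚ (castℚ (distanceAt (G ^ π) H v))} {d} {fromℚ threshold}
        (column≤μ₁ (G ^ π) H {d} sup v) d≤r))))))

-- Programs computing functions of trees

-- Kept as syntax: substitution composes bounds, and the absence of subtraction makes every
-- polynomial monotone.
data Polynomial : Set where
  X       : Polynomial
  con     : ℕ → Polynomial
  _⊕_ _⊗_ : Polynomial → Polynomial → Polynomial

infixl 6 _⊕_
infixl 7 _⊗_

⟦_⟧ : Polynomial → ℕ → ℕ
⟦ X ⟧     s = s
⟦ con k ⟧ s = k
⟦ p ⊕ q ⟧ s = ⟦ p ⟧ s + ⟦ q ⟧ s
⟦ p ⊗ q ⟧ s = ⟦ p ⟧ s * ⟦ q ⟧ s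

_⟪_⟫ : Polynomial → Polynomial → Polynomial
X       ⟪ r ⟫ = r
con k   ⟪ r ⟫ = con k
(p ⊕ q) ⟪ r ⟫ = p ⟪ r ⟫ ⊕ q ⟪ r ⟫
(p ⊗ q) ⟪ r ⟫ = p ⟪ r ⟫ ⊗ q ⟪ r ⟫

⟪⟫-eval : ∀ p r s → ⟦ p ⟪ r ⟫ ⟧ s ≡ ⟦ p ⟧ (⟦ r ⟧ s)
⟪⟫-eval X       r s = refl
⟪⟫-eval (con k) r s = refl
⟪⟫-eval (p ⊕ q) r s = cong₂ _+_ (⟪⟫-eval p r s) (⟪⟫-eval q r s)
⟪⟫-eval (p ⊗ q) r s = cong₂ _*_ (⟪⟫-eval p r s) (⟪⟫-eval q r s)

⟦⟧-mono : ∀ p {s t} → s ≤ t → ⟦ p ⟧ s ≤ ⟦ p ⟧ t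
⟦⟧-mono X       s≤t = s≤t
⟦⟧-mono (con k) s≤t = ℕ.≤-refl
⟦⟧-mono (p ⊕ q) s≤t = ℕ.+-mono-≤ (⟦⟧-mono p s≤t) (⟦⟧-mono q s≤t)
⟦⟧-mono (p ⊗ q) s≤t = ℕ.*-mono-≤ (⟦⟧-mono p s≤t) (⟦⟧-mono q s≤t)

≤⟪⟫ : ∀ p r s {k t} → k ≤ ⟦ p ⟧ t → t ≤ ⟦ r ⟧ s → k ≤ ⟦ p ⟪ r ⟫ ⟧ s
≤⟪⟫ p r s k≤ t≤ = ℕ.≤-trans k≤ (ℕ.≤-trans (⟦⟧-mono p t≤) (ℕ.≤-reflexive (sym (⟪⟫-eval p r s))))

-- For s ≥ 1 powers of s increase with the exponent, so for a sum it suffices to add both the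
-- coefficients and the exponents.
monomial-bound : ∀ p → ∃[ c ] ∃[ d ] ∀ s → 1 ≤ s → ⟦ p ⟧ s ≤ c * s ℕ.^ d
monomial-bound X       = 1 , 1 , λ s _ → ℕ.≤-reflexive (sym (trans (ℕ.+-identityʳ (s * 1)) (ℕ.*-identityʳ s)))
monomial-bound (con k) = k , 0 , λ s _ → ℕ.≤-reflexive (sym (ℕ.*-identityʳ k))
monomial-bound (p ⊕ q) with monomial-bound p | monomial-bound q
... | c , d , hp | c′ , d′ , hq = c + c′ , d + d′ , λ s 1≤s → ℕ.≤-trans
  (ℕ.+-mono-≤ (ℕ.≤-trans (hp s 1≤s) (ℕ.*-monoʳ-≤ c (raise s 1≤s (ℕ.m≤m+n d d′))))
              (ℕ.≤-trans (hq s 1≤s) (ℕ.*-monoʳ-≤ c′ (raise s 1≤s (ℕ.m≤n+m d′ d)))))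
  (ℕ.≤-reflexive (sym (ℕ.*-distribʳ-+ (s ℕ.^ (d + d′)) c c′)))
  where
  raise : ∀ s → 1 ≤ s → ∀ {a b} → a ≤ b → s ℕ.^ a ≤ s ℕ.^ b
  raise (suc s) _ = ℕ.^-monoʳ-≤ (suc s)
monomial-bound (p ⊗ q) with monomial-bound p | monomial-bound q
... | c , d , hp | c′ , d′ , hq = c * c′ , d + d′ , λ s 1≤s → ℕ.≤-trans
  (ℕ.*-mono-≤ (hp s 1≤s) (hq s 1≤s))
  (ℕ.≤-reflexive (trans (solve 4 (λ a b x y → (a :* x) :* (b :* y) := (a :* b) :* (x :* y)) refl c c′ (s ℕ.^ d) (s ℕ.^ d′))
    (cong (c * c′ *_) (sym (ℕ.^-distribˡ-+-* s d d′)))))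
  where open +-*-Solver

1≤size : ∀ t → 1 ≤ size t
1≤size nil        = s≤s z≤n
1≤size (cons s t) = s≤s z≤n

size-head : ∀ t → size (head t) ≤ size t
size-head nil        = ℕ.≤-refl
size-head (cons s t) = ℕ.m≤n⇒m≤1+n (ℕ.m≤m+n (size s) (size t))

size-tail : ∀ t → size (tail t) ≤ size t
size-tail nil        = ℕ.≤-refl
size-tail (cons s t) = ℕ.m≤n⇒m≤1+n (ℕ.m≤n+m (size t) (size s))

update-≡ : ∀ σ x t → (σ [ x ↦ t ]) x ≡ t
update-≡ σ x t rewrite dec-true (x ℕ.≟ x) refl = refl

update-≢ : ∀ σ {x y} t → x ≢ y → (σ [ x ↦ t ]) y ≡ σ y
update-≢ σ {x} {y} t x≢y rewrite dec-false (x ℕ.≟ y) x≢y = refl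

-- The frame k is what makes programs composable: values saved in variables above it survive the
-- run.
Runs : Command → ℕ → Store → Tree → ℕ → Set
Runs C k σ t T = ∃[ S ] ∃[ τ ] ⟨ C , σ ⟩⇓[ S ] τ × τ 0 ≡ t × (∀ y → k < y → τ y ≡ σ y) × S ≤ T

-- Argument and result are held in variable 0.  The size of the result needs a
-- bound of its own, since by sharing it can exceed the running time.
record Computes (f : Tree → Tree) : Set where
  field
    program : Command
    frame   : ℕ
    time    : Polynomial
    growth  : Polynomial
    runs    : ∀ σ t → σ 0 ≡ t → Runs program frame σ (f t) (⟦ time ⟧ (size t))
    grows   : ∀ t → size (f t) ≤ ⟦ growth ⟧ (size t)

open Computes public

above⇒≢ : ∀ {k y} → k < y → k ≢ y
above⇒≢ k<y refl = ℕ.<-irrefl refl k<y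

above-0 : ∀ {k y} → k < y → 0 ≢ y
above-0 (s≤s _) ()

private
  assign : ∀ e (f : Tree → Tree) (p : Polynomial) →
    (∀ σ → eval σ e ≡ f (σ 0)) → (∀ t → size (f t) ≤ ⟦ p ⟧ (size t)) → Computes f
  assign e f p sem grow = record
    { program = 0 ≔ e ; frame = 0 ; time = con (suc (cost e)) ; growth = p
    ; runs    = λ σ t eq → _ , _ , ⇓-assign , trans (sem σ) (cong f eq) , (λ y 0<y → update-≢ σ _ (above⇒≢ 0<y)) , ℕ.≤-refl
    ; grows   = grow
    }

idᶜ : Computes id
idᶜ = assign (var 0) id X (λ _ → refl) (λ _ → ℕ.≤-refl)

nilᶜ : Computes (λ _ → nil)
nilᶜ = assign nil (λ _ → nil) (con 1) (λ _ → refl) (λ _ → ℕ.≤-refl)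

headᶜ : Computes head
headᶜ = assign (hd (var 0)) head X (λ _ → refl) size-head

tailᶜ : Computes tail
tailᶜ = assign (tl (var 0)) tail X (λ _ → refl) size-tail

infixr 9 _∘ᶜ_

_∘ᶜ_ : ∀ {f g} → Computes g → Computes f → Computes (g ∘ f)
_∘ᶜ_ {f} {g} G F = record
  { program = program F ⨾ program G
  ; frame   = frame F ℕ.⊔ frame G
  ; time    = time F ⊕ time G ⟪ growth F ⟫
  ; growth  = growth G ⟪ growth F ⟫
  ; runs    = λ σ t eq →
      let S , τ , r , e , fr , S≤ = runs F σ t eq
          T , ρ , r′ , e′ , fr′ , T≤ = runs G τ (f t) e
      in S + T , ρ , ⇓-seq r r′ , e′
       , (λ y k<y → trans (fr′ y (ℕ.≤-trans (s≤s (ℕ.m≤n⊔m (frame F) (frame G))) k<y))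
                          (fr y (ℕ.≤-trans (s≤s (ℕ.m≤m⊔n (frame F) (frame G))) k<y)))
       , ℕ.+-mono-≤ S≤ (≤⟪⟫ (time G) (growth F) (size t) T≤ (grows F t))
  ; grows   = λ t → ≤⟪⟫ (growth G) (growth F) (size t) (grows G (f t)) (grows F t)
  }

module _ {f g} (F : Computes f) (G : Computes g) where
  private
    k a b : ℕ
    k = frame F ℕ.⊔ frame G
    a = suc k
    b = suc a

    Fk : ∀ {y} → k < y → frame F < y
    Fk = ℕ.≤-trans (s≤s (ℕ.m≤m⊔n (frame F) (frame G)))

    Gk : ∀ {y} → k < y → frame G < y
    Gk = ℕ.≤-trans (s≤s (ℕ.m≤n⊔m (frame F) (frame G)))

    a<b : a < b
    a<b = ℕ.n<1+n a

  ⟨_,_⟩ᶜ : Computes (λ t → cons (f t) (g t))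
  ⟨_,_⟩ᶜ = record
    { program = a ≔ var 0 ⨾ program F ⨾ b ≔ var 0 ⨾ 0 ≔ var a ⨾ program G ⨾ 0 ≔ cons (var b) (var 0)
    ; frame   = b
    -- Three copies of a variable at cost 2 each, and the final `cons` at cost 4.
    ; time    = con 10 ⊕ (time F ⊕ time G)
    ; growth  = con 1 ⊕ (growth F ⊕ growth G)
    ; runs    = correct
    ; grows   = λ t → s≤s (ℕ.+-mono-≤ (grows F t) (grows G t))
    }
    where
    correct : ∀ σ t → σ 0 ≡ t → Runs _ b σ (cons (f t) (g t)) (10 + (⟦ time F ⟧ (size t) + ⟦ time G ⟧ (size t)))
    correct σ t eq =
      let σ₁ = σ [ a ↦ σ 0 ]
          S , σ₂ , rF , eF , frF , S≤ = runs F σ₁ t eq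
          σ₃ = σ₂ [ b ↦ σ₂ 0 ]
          saved : σ₃ a ≡ t
          saved = trans (update-≢ σ₂ (σ₂ 0) (above⇒≢ a<b ∘ sym)) (trans (frF a (Fk ℕ.≤-refl))
            (trans (update-≡ σ a (σ 0)) eq))
          σ₄ = σ₃ [ 0 ↦ σ₃ a ]
          T , σ₅ , rG , eG , frG , T≤ = runs G σ₄ t saved
          first : σ₅ b ≡ f t
          first = trans (frG b (Gk (ℕ.m≤n⇒m≤1+n ℕ.≤-refl))) (trans (update-≡ σ₂ b (σ₂ 0)) eF)
      in _ , σ₅ [ 0 ↦ cons (σ₅ b) (σ₅ 0) ]
       , ⇓-seq ⇓-assign (⇓-seq rF (⇓-seq ⇓-assign (⇓-seq ⇓-assign (⇓-seq rG ⇓-assign))))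
       , cong₂ cons first eG
       , (λ y b<y → let a<y = ℕ.<-trans a<b b<y ; k<y = ℕ.<-trans (ℕ.n<1+n k) a<y in
           trans (update-≢ σ₅ _ (above-0 b<y)) (trans (frG y (Gk k<y)) (trans (update-≢ σ₃ _ (above-0 b<y))
             (trans (update-≢ σ₂ _ (above⇒≢ b<y)) (trans (frF y (Fk k<y)) (update-≢ σ _ (above⇒≢ a<y)))))))
       , ℕ.≤-trans (ℕ.≤-reflexive (solve 2 (λ S T → con′ 2 :+ (S :+ (con′ 2 :+ (con′ 2 :+ (T :+ con′ 4))))
            := con′ 10 :+ (S :+ T)) refl S T)) (ℕ.+-monoʳ-≤ 10 (ℕ.+-mono-≤ S≤ T≤))
      where open +-*-Solver using (solve; _:+_; _:=_) renaming (con to con′)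

  if_thenᶜ_elseᶜ_ : ∀ {c} → Computes c → Computes (λ t → if isCons (c t) then f t else g t)
  if_thenᶜ_elseᶜ_ {c} B = record
    { program = u ≔ var 0 ⨾ program B ⨾ v ≔ var 0 ⨾ 0 ≔ var u ⨾ when var v then program F else program G
    ; frame   = v
    ; time    = con 10 ⊕ (time B ⊕ (time F ⊕ time G))
    ; growth  = growth F ⊕ growth G
    ; runs    = correct
    ; grows   = grow
    }
    where
    l u v : ℕ
    l = k ℕ.⊔ frame B
    u = suc l
    v = suc u

    kl : ∀ {y} → l < y → k < y
    kl = ℕ.≤-trans (s≤s (ℕ.m≤m⊔n k (frame B)))

    Bl : ∀ {y} → l < y → frame B < y
    Bl = ℕ.≤-trans (s≤s (ℕ.m≤n⊔m k (frame B)))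

    grow : ∀ t → size (if isCons (c t) then f t else g t) ≤ ⟦ growth F ⟧ (size t) + ⟦ growth G ⟧ (size t)
    grow t with isCons (c t)
    ... | true  = ℕ.≤-trans (grows F t) (ℕ.m≤m+n _ _)
    ... | false = ℕ.≤-trans (grows G t) (ℕ.m≤n+m _ _)

    correct : ∀ σ t → σ 0 ≡ t → Runs _ v σ (if isCons (c t) then f t else g t)
      (10 + (⟦ time B ⟧ (size t) + (⟦ time F ⟧ (size t) + ⟦ time G ⟧ (size t))))
    correct σ t eq with runs B (σ [ u ↦ σ 0 ]) t eq
    ... | S , σ₂ , rB , eB , frB , S≤ = branch (isCons (c t)) refl
      where
      open +-*-Solver using (solve; _:+_; _:=_) renaming (con to con′)

      σ₃ σ₄ : Store
      σ₃ = σ₂ [ v ↦ σ₂ 0 ]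
      σ₄ = σ₃ [ 0 ↦ σ₃ u ]

      saved : σ₄ 0 ≡ t
      saved = trans (update-≢ σ₂ (σ₂ 0) (above⇒≢ (ℕ.n<1+n u) ∘ sym)) (trans (frB u (Bl ℕ.≤-refl))
        (trans (update-≡ σ u (σ 0)) eq))

      tested : σ₄ v ≡ c t
      tested = trans (update-≡ σ₂ v (σ₂ 0)) eB

      kept : ∀ y → v < y → σ₄ y ≡ σ y
      kept y v<y = let u<y = ℕ.<-trans (ℕ.n<1+n u) v<y in
        trans (update-≢ σ₃ _ (above-0 v<y)) (trans (update-≢ σ₂ _ (above⇒≢ v<y))
          (trans (frB y (Bl (ℕ.<-trans (ℕ.n<1+n l) u<y))) (update-≢ σ _ (above⇒≢ u<y))))

      beyond : ∀ {y} → v < y → k < y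
      beyond v<y = kl (ℕ.<-trans (ℕ.n<1+n l) (ℕ.<-trans (ℕ.n<1+n u) v<y))

      branch : ∀ bit → isCons (c t) ≡ bit → Runs _ v σ (if bit then f t else g t)
        (10 + (⟦ time B ⟧ (size t) + (⟦ time F ⟧ (size t) + ⟦ time G ⟧ (size t))))
      branch true e with runs F σ₄ t saved
      ... | T , τ , rF , eF , frF , T≤ = _ , τ
        , ⇓-seq ⇓-assign (⇓-seq rB (⇓-seq ⇓-assign (⇓-seq ⇓-assign (⇓-then (trans (cong isCons tested) e) rF))))
        , eF , (λ y v<y → trans (frF y (Fk (beyond v<y))) (kept y v<y))
        , ℕ.≤-trans (ℕ.≤-reflexive (solve 2 (λ S T → con′ 2 :+ (S :+ (con′ 2 :+ (con′ 2 :+ (con′ 2 :+ T))))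
             := con′ 8 :+ (S :+ T)) refl S T))
           (ℕ.+-mono-≤ {8} {10} (ℕ.m≤m+n 8 2) (ℕ.+-mono-≤ S≤ (ℕ.≤-trans T≤ (ℕ.m≤m+n _ _))))
      branch false e with runs G σ₄ t saved
      ... | T , τ , rG , eG , frG , T≤ = _ , τ
        , ⇓-seq ⇓-assign (⇓-seq rB (⇓-seq ⇓-assign (⇓-seq ⇓-assign (⇓-else (trans (cong isCons tested) e) rG))))
        , eG , (λ y v<y → trans (frG y (Gk (beyond v<y))) (kept y v<y))
        , ℕ.≤-trans (ℕ.≤-reflexive (solve 2 (λ S T → con′ 2 :+ (S :+ (con′ 2 :+ (con′ 2 :+ (con′ 2 :+ T))))
             := con′ 8 :+ (S :+ T)) refl S T))
           (ℕ.+-mono-≤ {8} {10} (ℕ.m≤m+n 8 2) (ℕ.+-mono-≤ S≤ (ℕ.≤-trans T≤ (ℕ.m≤n+m _ _))))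

-- The fixed environment `e` is passed to every step, in place of the closures that programs on
-- trees do not have.
foldrᵗ : (Tree → Tree) → Tree → Tree → Tree → Tree
foldrᵗ g e a nil         = a
foldrᵗ g e a (cons x xs) = g (cons e (cons (foldrᵗ g e a xs) x))

private
  revOnto : Tree → Tree → Tree
  revOnto nil         xs = xs
  revOnto (cons y ys) xs = revOnto ys (cons y xs)

  append : Tree → Tree → Tree
  append nil         zs = zs
  append (cons y ys) zs = cons y (append ys zs)

  append-nil : ∀ ys → append ys nil ≡ ys
  append-nil nil         = refl
  append-nil (cons y ys) = cong (cons y) (append-nil ys)

  revOnto-revOnto : ∀ ys xs zs → revOnto (revOnto ys xs) zs ≡ revOnto xs (append ys zs)
  revOnto-revOnto nil         xs zs = refl
  revOnto-revOnto (cons y ys) xs zs = revOnto-revOnto ys (cons y xs) zs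

  reverse-reverse : ∀ l → revOnto (revOnto l nil) nil ≡ l
  reverse-reverse l = trans (revOnto-revOnto l nil nil) (append-nil l)

  size-shift : ∀ y ys xs → size ys + size (cons y xs) ≡ size (cons y ys) + size xs
  size-shift y ys xs = solve 3 (λ y ys xs → ys :+ (con′ 1 :+ (y :+ xs)) := con′ 1 :+ (y :+ ys) :+ xs) refl (size y) (size ys) (size xs)
    where open +-*-Solver using (solve; _:+_; _:=_) renaming (con to con′)

  size-revOnto : ∀ ys xs → 1 + size (revOnto ys xs) ≡ size ys + size xs
  size-revOnto nil         xs = refl
  size-revOnto (cons y ys) xs = trans (size-revOnto ys (cons y xs)) (size-shift y ys xs)

  size-reverse : ∀ l → size (revOnto l nil) ≡ size l
  size-reverse l = ℕ.suc-injective (trans (size-revOnto l nil) (ℕ.+-comm (size l) 1))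

-- The list is first reversed, so that its last entry is combined first.
module _ {g} (G : Computes g) (B : Polynomial)
  (bounded : ∀ e a l → size (foldrᵗ g e a l) ≤ ⟦ B ⟧ (size (cons e (cons a l)))) where
  private
    k e a l r : ℕ
    k = frame G
    e = 1 + k
    a = 2 + k
    l = 3 + k
    r = 4 + k

    distinct : ∀ {i j} → i ≢ j → i + k ≢ j + k
    distinct {i} {j} i≢j eq = i≢j (ℕ.+-cancelʳ-≡ k i j eq)

    reversing folding : Command
    reversing = while var l loop (r ≔ cons (hd (var l)) (var r) ⨾ l ≔ tl (var l))
    folding   = while var r loop
      (0 ≔ cons (var e) (cons (var a) (hd (var r))) ⨾ program G ⨾ a ≔ var 0 ⨾ r ≔ tl (var r))

    -- A round costs 10: the test 2, the assignments 5 and 3. The number of rounds is at most the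
    -- size of the list.
    reverses : ∀ ys xs σ → σ l ≡ ys → σ r ≡ xs → ∃[ T ] ∃[ τ ] ⟨ reversing , σ ⟩⇓[ T ] τ ×
      τ r ≡ revOnto ys xs × (∀ y → y ≢ l → y ≢ r → τ y ≡ σ y) × T ≤ size ys * 10
    reverses nil xs σ el er = _ , σ , ⇓-stop (cong isCons el) , er , (λ _ _ _ → refl) , s≤s (s≤s z≤n)
    reverses (cons y ys) xs σ el er =
      let σ₁ = σ [ r ↦ cons (head (σ l)) (σ r) ]
          σ₁l = trans (update-≢ σ {r} {l} (cons (head (σ l)) (σ r)) (distinct λ ())) el
          σ₂ = σ₁ [ l ↦ tail (σ₁ l) ]
          T , τ , run , er′ , kept , T≤ = reverses ys (cons y xs) σ₂
            (trans (update-≡ σ₁ l (tail (σ₁ l))) (cong tail σ₁l))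
            (trans (update-≢ σ₁ {l} {r} (tail (σ₁ l)) (distinct λ ())) (trans (update-≡ σ r (cons (head (σ l)) (σ r)))
              (cong₂ (λ u v → cons (head u) v) el er)))
      in _ , τ , ⇓-loop (cong isCons el) (⇓-seq ⇓-assign ⇓-assign) run , er′
       , (λ z z≢l z≢r → trans (kept z z≢l z≢r) (trans (update-≢ σ₁ (tail (σ₁ l)) (z≢l ∘ sym))
            (update-≢ σ (cons (head (σ l)) (σ r)) (z≢r ∘ sym))))
       , ℕ.≤-trans (ℕ.+-monoʳ-≤ 10 T≤) (ℕ.+-monoʳ-≤ 10 (ℕ.*-monoˡ-≤ 10 (ℕ.m≤n+m (size ys) (size y))))

    module _ (env acc : Tree) (L V : ℕ)
      (step : ∀ x xs → size x ≤ L → size xs ≤ L → ⟦ time G ⟧ (size (cons env (cons (foldrᵗ g env acc xs) x))) ≤ V) where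

      -- Invariant: the accumulator is the fold over the suffix `xs` already treated, and `r` holds
      -- the rest in reverse. A round costs 14 = 2 + 7 + 2 + 3 besides the call of the step, and the
      -- sum of the sizes of both parts stays constant.
      folds : ∀ ys xs σ → σ e ≡ env → σ a ≡ foldrᵗ g env acc xs → σ r ≡ ys → size ys + size xs ≤ 1 + L →
        ∃[ T ] ∃[ τ ] ⟨ folding , σ ⟩⇓[ T ] τ × τ a ≡ foldrᵗ g env acc (revOnto ys xs) ×
          (∀ y → r < y → τ y ≡ σ y) × T ≤ size ys * (14 + V)
      folds nil xs σ ee ea er _ = _ , σ , ⇓-stop (cong isCons er) , ea , (λ _ _ → refl) , s≤s (s≤s z≤n)
      folds (cons y ys) xs σ ee ea er sizes =
        let input = cons env (cons (foldrᵗ g env acc xs) y)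
            σ₁ = σ [ 0 ↦ cons (σ e) (cons (σ a) (head (σ r))) ]
            S , σ₂ , runG , e₀ , fr , S≤ = runs G σ₁ input (cong₂ cons ee (cong₂ cons ea (cong head er)))
            σ₃ = σ₂ [ a ↦ σ₂ 0 ]
            σ₄ = σ₃ [ r ↦ tail (σ₃ r) ]
            σ₂e = trans (fr e (ℕ.n<1+n k)) ee
            σ₂r = trans (fr r (ℕ.m≤n+m (suc k) 3)) er
            σ₃r = trans (update-≢ σ₂ {a} {r} (σ₂ 0) (distinct λ ())) σ₂r
            T , τ , run , ea′ , kept , T≤ = folds ys (cons y xs) σ₄
              (trans (update-≢ σ₃ {r} {e} (tail (σ₃ r)) (distinct λ ())) (trans (update-≢ σ₂ {a} {e} (σ₂ 0) (distinct λ ())) σ₂e))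
              (trans (update-≢ σ₃ {r} {a} (tail (σ₃ r)) (distinct λ ())) (trans (update-≡ σ₂ a (σ₂ 0)) e₀))
              (trans (update-≡ σ₃ r (tail (σ₃ r))) (cong tail σ₃r))
              (ℕ.≤-trans (ℕ.≤-reflexive (size-shift y ys xs)) sizes)
            y≤L : size y ≤ L
            y≤L = ℕ.≤-pred (ℕ.≤-trans (ℕ.≤-trans (s≤s (ℕ.m≤m+n (size y) (size ys))) (ℕ.m≤m+n _ (size xs))) sizes)
            xs≤L : size xs ≤ L
            xs≤L = ℕ.≤-pred (ℕ.≤-trans (ℕ.+-monoˡ-≤ (size xs) (1≤size (cons y ys))) sizes)
        in _ , τ
         , ⇓-loop (cong isCons er) (⇓-seq ⇓-assign (⇓-seq runG (⇓-seq ⇓-assign ⇓-assign))) run , ea′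
         , (λ z r<z → let a<z = ℕ.<-trans (ℕ.n<1+n a) (ℕ.<-trans (ℕ.n<1+n l) r<z)
                          k<z = ℕ.<-trans (ℕ.n<1+n k) (ℕ.<-trans (ℕ.n<1+n e) a<z)
              in trans (kept z r<z) (trans (update-≢ σ₃ (tail (σ₃ r)) (above⇒≢ r<z))
                (trans (update-≢ σ₂ (σ₂ 0) (above⇒≢ a<z)) (trans (fr z k<z) (update-≢ σ _ (above-0 r<z))))))
         , ℕ.≤-trans (ℕ.≤-reflexive (solve 2 (λ S T → con′ 2 :+ ((con′ 7 :+ (S :+ con′ 5)) :+ T) := (con′ 14 :+ S) :+ T) refl S T))
            (ℕ.+-mono-≤ (ℕ.+-monoʳ-≤ 14 (ℕ.≤-trans S≤ (step y xs y≤L xs≤L)))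
              (ℕ.≤-trans T≤ (ℕ.*-monoˡ-≤ (14 + V) (ℕ.m≤n+m (size ys) (size y)))))
        where open +-*-Solver using (solve; _:+_; _:=_) renaming (con to con′)

    fold : Tree → Tree
    fold t = foldrᵗ g (head t) (head (tail t)) (tail (tail t))

    triple intermediate stepTime : Polynomial
    triple       = con 3 ⊕ con 3 ⊗ X
    intermediate = B ⟪ triple ⟫
    stepTime     = time G ⟪ con 3 ⊕ (X ⊕ (intermediate ⊕ X)) ⟫

    size-triple : ∀ {p q o s} → p ≤ s → q ≤ s → o ≤ 1 + s → 1 + (p + (1 + (q + o))) ≤ ⟦ triple ⟧ s
    size-triple {s = s} p≤ q≤ o≤ = ℕ.≤-trans (s≤s (ℕ.+-mono-≤ p≤ (s≤s (ℕ.+-mono-≤ q≤ o≤))))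
      (ℕ.≤-reflexive (solve 1 (λ s → con′ 1 :+ (s :+ (con′ 1 :+ (s :+ (con′ 1 :+ s)))) := con′ 3 :+ con′ 3 :* s) refl s))
      where open +-*-Solver using (solve; _:+_; _:*_; _:=_) renaming (con to con′)

    intermediate-bound : ∀ t xs → size xs ≤ 1 + size t →
      size (foldrᵗ g (head t) (head (tail t)) xs) ≤ ⟦ intermediate ⟧ (size t)
    intermediate-bound t xs xs≤ = ≤⟪⟫ B triple (size t) (bounded (head t) (head (tail t)) xs)
      (size-triple (size-head t) (ℕ.≤-trans (size-head (tail t)) (size-tail t)) xs≤)

    step-bound : ∀ t x xs → size x ≤ 1 + size t → size xs ≤ 1 + size t →
      ⟦ time G ⟧ (size (cons (head t) (cons (foldrᵗ g (head t) (head (tail t)) xs) x))) ≤ ⟦ stepTime ⟧ (size t)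
    step-bound t x xs x≤ xs≤ = ≤⟪⟫ (time G) (con 3 ⊕ (X ⊕ (intermediate ⊕ X))) (size t) ℕ.≤-refl
      (ℕ.≤-trans (s≤s (ℕ.+-mono-≤ (size-head t) (s≤s (ℕ.+-mono-≤ (intermediate-bound t xs xs≤) x≤))))
        (ℕ.≤-reflexive (solve 2 (λ s i → con′ 1 :+ (s :+ (con′ 1 :+ (i :+ (con′ 1 :+ s)))) := con′ 3 :+ (s :+ (i :+ s))) refl
          (size t) (⟦ intermediate ⟧ (size t)))))
      where open +-*-Solver using (solve; _:+_; _:=_) renaming (con to con′)

    correct : ∀ σ t → σ 0 ≡ t → Runs
      (e ≔ hd (var 0) ⨾ a ≔ hd (tl (var 0)) ⨾ l ≔ tl (tl (var 0)) ⨾ r ≔ nil ⨾ reversing ⨾ folding ⨾ 0 ≔ var a)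
      r σ (fold t) (15 + (size t * 10 + size t * (14 + ⟦ stepTime ⟧ (size t))))
    correct σ t eq =
      let σ₁ = σ [ e ↦ head (σ 0) ]
          σ₂ = σ₁ [ a ↦ head (tail (σ 0)) ]
          σ₃ = σ₂ [ l ↦ tail (tail (σ 0)) ]
          σ₄ = σ₃ [ r ↦ nil ]
          list = tail (tail t)
          S , σ₅ , run₁ , er , kept₁ , S≤ = reverses list nil σ₄
            (trans (update-≢ σ₃ {r} {l} nil (distinct λ ())) (trans (update-≡ σ₂ l (tail (tail (σ 0)))) (cong (tail ∘ tail) eq)))
            (update-≡ σ₃ r nil)
          σ₅e = trans (kept₁ e (distinct λ ()) (distinct λ ())) (trans (update-≢ σ₃ {r} {e} nil (distinct λ ()))
            (trans (update-≢ σ₂ {l} {e} _ (distinct λ ())) (trans (update-≢ σ₁ {a} {e} _ (distinct λ ()))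
              (trans (update-≡ σ e (head (σ 0))) (cong head eq)))))
          σ₅a = trans (kept₁ a (distinct λ ()) (distinct λ ())) (trans (update-≢ σ₃ {r} {a} nil (distinct λ ()))
            (trans (update-≢ σ₂ {l} {a} _ (distinct λ ())) (trans (update-≡ σ₁ a (head (tail (σ 0)))) (cong (head ∘ tail) eq))))
          list≤ = ℕ.≤-trans (size-tail (tail t)) (size-tail t)
          reversed≤ = ℕ.≤-trans (ℕ.≤-reflexive (size-reverse list)) list≤
          T , σ₆ , run₂ , ea , kept₂ , T≤ = folds (head t) (head (tail t)) (1 + size t) (⟦ stepTime ⟧ (size t)) (step-bound t)
            (revOnto list nil) nil σ₅ σ₅e σ₅a er
            (ℕ.≤-trans (ℕ.≤-reflexive (ℕ.+-comm _ 1)) (s≤s (ℕ.m≤n⇒m≤1+n reversed≤)))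
      in _ , σ₆ [ 0 ↦ σ₆ a ]
       , ⇓-seq ⇓-assign (⇓-seq ⇓-assign (⇓-seq ⇓-assign (⇓-seq ⇓-assign (⇓-seq run₁ (⇓-seq run₂ ⇓-assign)))))
       , trans ea (cong (foldrᵗ g (head t) (head (tail t))) (reverse-reverse list))
       , (λ y r<y → let l<y = ℕ.<-trans (ℕ.n<1+n l) r<y
                        a<y = ℕ.<-trans (ℕ.n<1+n a) l<y
                        e<y = ℕ.<-trans (ℕ.n<1+n e) a<y
            in trans (update-≢ σ₆ _ (above-0 r<y)) (trans (kept₂ y r<y)
              (trans (kept₁ y (above⇒≢ l<y ∘ sym) (above⇒≢ r<y ∘ sym)) (trans (update-≢ σ₃ nil (above⇒≢ r<y))
                (trans (update-≢ σ₂ _ (above⇒≢ l<y)) (trans (update-≢ σ₁ _ (above⇒≢ a<y)) (update-≢ σ _ (above⇒≢ e<y))))))))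
       , ℕ.≤-trans (ℕ.≤-reflexive (solve 2 (λ S T → con′ 3 :+ (con′ 4 :+ (con′ 4 :+ (con′ 2 :+ (S :+ (T :+ con′ 2)))))
            := con′ 15 :+ (S :+ T)) refl S T))
          (ℕ.+-monoʳ-≤ 15 (ℕ.+-mono-≤ (ℕ.≤-trans S≤ (ℕ.*-monoˡ-≤ 10 list≤))
            (ℕ.≤-trans T≤ (ℕ.*-monoˡ-≤ (14 + ⟦ stepTime ⟧ (size t)) reversed≤))))
      where open +-*-Solver using (solve; _:+_; _:=_) renaming (con to con′)

  -- Iterating a polynomial-time step can produce exponentially large trees, hence the hypothesis
  -- `bounded`. As it covers every list, it also bounds the intermediate accumulators, which are
  -- folds over suffixes.
  foldrᶜ : Computes (λ t → foldrᵗ g (head t) (head (tail t)) (tail (tail t)))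
  foldrᶜ = record
    { frame   = r
    ; time    = con 15 ⊕ (X ⊗ con 10 ⊕ X ⊗ (con 14 ⊕ stepTime))
    ; growth  = intermediate
    ; runs    = correct
    ; grows   = λ t → intermediate-bound t (tail (tail t))
        (ℕ.m≤n⇒m≤1+n (ℕ.≤-trans (size-tail (tail t)) (size-tail t)))
    }

-- Computing the graph of a Cayley table

module _ {g} (G : Computes g) (h : Polynomial)
  (additive : ∀ e a x → size (g (cons e (cons a x))) ≤ size a + ⟦ h ⟧ (size (cons e x))) where

  -- The amount added by a step depends on the environment and the entry but not on the accumulator,
  -- so the increments add up instead of compounding.
  foldrᵗ-additive : ∀ e a l → size (foldrᵗ g e a l) ≤ size a + size l * ⟦ h ⟧ (size (cons e l))
  foldrᵗ-additive e a l = bound l ℕ.≤-refl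
    where
    W : ℕ
    W = ⟦ h ⟧ (size (cons e l))

    bound : ∀ xs → size xs ≤ size l → size (foldrᵗ g e a xs) ≤ size a + size xs * W
    bound nil         _   = ℕ.m≤m+n (size a) _
    bound (cons x xs) ≤l = begin
      size (g (cons e (cons (foldrᵗ g e a xs) x)))             ≤⟨ additive e (foldrᵗ g e a xs) x ⟩
      size (foldrᵗ g e a xs) + ⟦ h ⟧ (size (cons e x))         ≤⟨ ℕ.+-mono-≤ (bound xs xs≤)
                                                                    (⟦⟧-mono h (s≤s (ℕ.+-monoʳ-≤ (size e) x≤))) ⟩
      size a + size xs * W + W                                 ≡⟨ solve 3 (λ a x w → a :+ x :* w :+ w := a :+ (con′ 1 :+ x) :* w)
                                                                    refl (size a) (size xs) W ⟩
      size a + (1 + size xs) * W                               ≤⟨ ℕ.+-monoʳ-≤ (size a) (ℕ.*-monoˡ-≤ W (s≤s (ℕ.m≤n+m (size xs) (size x)))) ⟩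
      size a + size (cons x xs) * W                            ∎
      where
      open ℕ.≤-Reasoning
      open +-*-Solver using (solve; _:+_; _:*_; _:=_) renaming (con to con′)

      xs≤ : size xs ≤ size l
      xs≤ = ℕ.≤-trans (size-tail (cons x xs)) ≤l

      x≤ : size x ≤ size l
      x≤ = ℕ.≤-trans (size-head (cons x xs)) ≤l

  additiveFoldrᶜ : Computes (λ t → foldrᵗ g (head t) (head (tail t)) (tail (tail t)))
  additiveFoldrᶜ = foldrᶜ G (X ⊕ X ⊗ h) λ e a l → ℕ.≤-trans (foldrᵗ-additive e a l)
    (ℕ.+-mono-≤ (a≤ e a l) (ℕ.*-mono-≤ (l≤ e a l) (⟦⟧-mono h (s≤s (ℕ.+-monoʳ-≤ (size e) (ℕ.m≤n⇒m≤1+n (ℕ.m≤n+m (size l) (size a))))))))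
    where
    a≤ : ∀ e a l → size a ≤ size (cons e (cons a l))
    a≤ e a l = ℕ.≤-trans (size-head (cons a l)) (size-tail (cons e (cons a l)))

    l≤ : ∀ e a l → size l ≤ size (cons e (cons a l))
    l≤ e a l = ℕ.≤-trans (size-tail (cons a l)) (size-tail (cons e (cons a l)))

module _ (f : Tree → Tree) where
  mapᵗ : Tree → Tree → Tree
  mapᵗ e = foldrᵗ (λ t → cons (f (cons (head t) (tail (tail t)))) (head (tail t))) e nil

  mapᵗ-encodeList : ∀ e xs → mapᵗ e (encodeList xs) ≡ encodeList (List.map (λ x → f (cons e x)) xs)
  mapᵗ-encodeList e []       = refl
  mapᵗ-encodeList e (x ∷ xs) = cong (cons (f (cons e x))) (mapᵗ-encodeList e xs)

  mapᶜ : Computes f → Computes (λ t → mapᵗ (head t) (tail t))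
  mapᶜ F = additiveFoldrᶜ
    ⟨ F ∘ᶜ ⟨ headᶜ , tailᶜ ∘ᶜ tailᶜ ⟩ᶜ , headᶜ ∘ᶜ tailᶜ ⟩ᶜ (con 1 ⊕ growth F)
    (λ e a x → ℕ.≤-trans (ℕ.≤-reflexive (ℕ.+-comm (1 + size (f (cons e x))) (size a)))
      (ℕ.+-monoʳ-≤ (size a) (s≤s (grows F (cons e x)))))
    ∘ᶜ ⟨ headᶜ , ⟨ nilᶜ , tailᶜ ⟩ᶜ ⟩ᶜ

-- The list `x` serves as a unary counter, so the same program is truncated subtraction on numbers
-- and indexing on lists.
dropᵗ : Tree → Tree → Tree
dropᵗ x y = foldrᵗ (λ t → tail (head (tail t))) nil y x

dropᶜ : Computes (λ t → dropᵗ (head t) (tail t))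
dropᶜ = additiveFoldrᶜ (tailᶜ ∘ᶜ headᶜ ∘ᶜ tailᶜ) (con 0)
  (λ e a x → ℕ.≤-trans (size-tail a) (ℕ.m≤m+n (size a) 0))
  ∘ᶜ ⟨ nilᶜ , ⟨ tailᶜ , headᶜ ⟩ᶜ ⟩ᶜ

drop-encodeℕ : ∀ i j → dropᵗ (encodeℕ i) (encodeℕ j) ≡ encodeℕ (j ∸ i)
drop-encodeℕ zero    j = refl
drop-encodeℕ (suc i) j = trans (cong tail (drop-encodeℕ i j)) (trans (tail-encodeℕ (j ∸ i)) (cong encodeℕ (ℕ.pred[m∸n]≡m∸[1+n] j i)))
  where
  tail-encodeℕ : ∀ k → tail (encodeℕ k) ≡ encodeℕ (ℕ.pred k)
  tail-encodeℕ zero    = refl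
  tail-encodeℕ (suc k) = refl

drop-tabulate : ∀ {n} (f : Fin n → Tree) i → head (dropᵗ (encodeℕ (toℕ i)) (encodeList (tabulate f))) ≡ f i
drop-tabulate f zero    = refl
drop-tabulate f (suc i) = trans (cong head (drop-tail (encodeℕ (toℕ i)) _)) (drop-tabulate (f ∘ suc) i)
  where
  drop-tail : ∀ x y → tail (dropᵗ x y) ≡ dropᵗ x (tail y)
  drop-tail nil         y = refl
  drop-tail (cons _ xs) y = cong tail (drop-tail xs y)

yes′ : Tree
yes′ = cons nil nil

yesᶜ : Computes (λ _ → yes′)
yesᶜ = ⟨ nilᶜ , nilᶜ ⟩ᶜ

notᵗ : Tree → Tree
notᵗ t = if isCons t then nil else yes′

notᶜ : Computes notᵗ
notᶜ = if_thenᶜ_elseᶜ_ nilᶜ yesᶜ idᶜ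

-- Both truncated differences are tested, so this compares lengths: it decides equality of unary
-- numbers and also of the numbers of rows of two tables.
equalᵗ : Tree → Tree → Tree
equalᵗ x y = if isCons (dropᵗ x y) then nil else notᵗ (dropᵗ y x)

equalᶜ : Computes (λ t → equalᵗ (head t) (tail t))
equalᶜ = if_thenᶜ_elseᶜ_ nilᶜ (notᶜ ∘ᶜ dropᶜ ∘ᶜ ⟨ tailᶜ , headᶜ ⟩ᶜ) dropᶜ

equal-encodeℕ : ∀ i j → equalᵗ (encodeℕ i) (encodeℕ j) ≡ encodeBool (does (i ℕ.≟ j))
equal-encodeℕ i j rewrite drop-encodeℕ i j | drop-encodeℕ j i = decide (i ℕ.≟ j)
  where
  decide : ∀ (d : Dec (i ≡ j)) → (if isCons (encodeℕ (j ∸ i)) then nil else notᵗ (encodeℕ (i ∸ j))) ≡ encodeBool (does d)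
  decide (yes refl) rewrite ℕ.n∸n≡0 i = refl
  decide (no i≢j) with j ∸ i in e | i ∸ j in e′
  ... | suc _ | _     = refl
  ... | zero  | suc _ = refl
  ... | zero  | zero  = contradiction (ℕ.≤-antisym (ℕ.m∸n≡0⇒m≤n e′) (ℕ.m∸n≡0⇒m≤n e)) i≢j

equal-Fin : ∀ {n} (i j : Fin n) → equalᵗ (encodeℕ (toℕ i)) (encodeℕ (toℕ j)) ≡ encodeBool (does (i Fin.≟ j))
equal-Fin i j = trans (equal-encodeℕ (toℕ i) (toℕ j))
  (cong encodeBool (does-⇔ (mk⇔ Fin.toℕ-injective (cong toℕ)) (toℕ i ℕ.≟ toℕ j) (i Fin.≟ j)))

entryᵗ : Tree → Tree → Tree
entryᵗ T u = head (dropᵗ (tail u) (head (dropᵗ (head u) T)))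

entryᶜ : Computes (λ t → entryᵗ (head t) (tail t))
entryᶜ = headᶜ ∘ᶜ dropᶜ ∘ᶜ ⟨ tailᶜ ∘ᶜ tailᶜ , headᶜ ∘ᶜ dropᶜ ∘ᶜ ⟨ headᶜ ∘ᶜ tailᶜ , headᶜ ⟩ᶜ ⟩ᶜ

entry-encodeTable : ∀ {n} (f : Fin n → Fin n → Tree) i j →
  entryᵗ (encodeTable f) (cons (encodeℕ (toℕ i)) (encodeℕ (toℕ j))) ≡ f i j
entry-encodeTable f i j = trans (cong (λ r → head (dropᵗ (encodeℕ (toℕ j)) r))
  (drop-tabulate (λ i → encodeList (tabulate (f i))) i)) (drop-tabulate (f i) j)

-- Only pairs with equal first components need the test that they are distinct; in the other
-- branches this is known already.
adjacentᵗ : Tree → Tree → Tree → Tree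
adjacentᵗ T u v =
  if isCons (equalᵗ (head u) (head v)) then notᵗ (equalᵗ (tail u) (tail v)) else
  if isCons (equalᵗ (tail u) (tail v)) then yes′ else
  equalᵗ (entryᵗ T u) (entryᵗ T v)

cellᵗ : Tree → Tree
cellᵗ t = adjacentᵗ (head (head t)) (tail (head t)) (tail t)

cellᶜ : Computes cellᵗ
cellᶜ = if_thenᶜ_elseᶜ_ (notᶜ ∘ᶜ tails)
  (if_thenᶜ_elseᶜ_ yesᶜ (equalᶜ ∘ᶜ ⟨ entryᶜ ∘ᶜ headᶜ , entryᶜ ∘ᶜ ⟨ headᶜ ∘ᶜ headᶜ , tailᶜ ⟩ᶜ ⟩ᶜ) tails)
  (equalᶜ ∘ᶜ ⟨ headᶜ ∘ᶜ tailᶜ ∘ᶜ headᶜ , headᶜ ∘ᶜ tailᶜ ⟩ᶜ)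
  where
  tails : Computes (λ t → equalᵗ (tail (tail (head t))) (tail (tail t)))
  tails = equalᶜ ∘ᶜ ⟨ tailᶜ ∘ᶜ tailᶜ ∘ᶜ headᶜ , tailᶜ ∘ᶜ tailᶜ ⟩ᶜ

private
  prepend : Tree → Tree
  prepend t = cons (cons (head t) (tail (tail t))) (head (tail t))

  prepends : Tree → Tree
  prepends t = foldrᵗ prepend (tail (tail t)) (head (tail t)) (head t)

  prependᶜ : Computes prepend
  prependᶜ = ⟨ ⟨ headᶜ , tailᶜ ∘ᶜ tailᶜ ⟩ᶜ , headᶜ ∘ᶜ tailᶜ ⟩ᶜ

  prepend-additive : ∀ e a x → size (prepend (cons e (cons a x))) ≤ size a + ⟦ con 1 ⊕ X ⟧ (size (cons e x))
  prepend-additive e a x = ℕ.≤-reflexive (ℕ.+-comm (1 + size (cons e x)) (size a))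

  prependsᶜ : Computes prepends
  prependsᶜ = additiveFoldrᶜ prependᶜ (con 1 ⊕ X) prepend-additive
    ∘ᶜ ⟨ tailᶜ ∘ᶜ tailᶜ , ⟨ headᶜ ∘ᶜ tailᶜ , headᶜ ⟩ᶜ ⟩ᶜ

  prepends-additive : ∀ e a x → size (prepends (cons e (cons a x))) ≤ size a + ⟦ X ⊗ (con 1 ⊕ X) ⟧ (size (cons e x))
  prepends-additive e a x = ℕ.≤-trans (foldrᵗ-additive prependᶜ (con 1 ⊕ X) prepend-additive x a e)
    (ℕ.+-monoʳ-≤ (size a) (ℕ.*-mono-≤ (size-head (cons e x)) (s≤s (s≤s (ℕ.≤-reflexive (ℕ.+-comm (size x) (size e)))))))

pairsᵗ : Tree → Tree
pairsᵗ l = foldrᵗ prepends l nil l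

pairsᶜ : Computes pairsᵗ
pairsᶜ = additiveFoldrᶜ prependsᶜ (X ⊗ (con 1 ⊕ X)) prepends-additive ∘ᶜ ⟨ idᶜ , ⟨ nilᶜ , idᶜ ⟩ᶜ ⟩ᶜ

pairs-encodeList : ∀ xs → pairsᵗ (encodeList xs) ≡ encodeList (List.cartesianProductWith cons xs xs)
pairs-encodeList xs = prepends-encodeList xs
  where
  prepend-encodeList : ∀ x as ys → foldrᵗ prepend x (encodeList as) (encodeList ys) ≡ encodeList (List.map (cons x) ys List.++ as)
  prepend-encodeList x as []       = refl
  prepend-encodeList x as (y ∷ ys) = cong (cons (cons x y)) (prepend-encodeList x as ys)

  prepends-encodeList : ∀ zs → foldrᵗ prepends (encodeList xs) nil (encodeList zs) ≡ encodeList (List.cartesianProductWith cons zs xs)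
  prepends-encodeList []       = refl
  prepends-encodeList (z ∷ zs) = trans (cong (λ a → foldrᵗ prepend z a (encodeList xs)) (prepends-encodeList zs)) (prepend-encodeList z _ xs)

tabulate-+ : ∀ {A : Set} m {n} (f : Fin (m + n) → A) →
  tabulate f ≡ tabulate (λ i → f (i Fin′.↑ˡ n)) List.++ tabulate (λ i → f (m Fin′.↑ʳ i))
tabulate-+ zero    f = refl
tabulate-+ (suc m) f = cong (f zero ∷_) (tabulate-+ m (f ∘ suc))

-- The product lists pairs in the order of `remQuot`, so the rows and columns that the program
-- writes come in the order of the vertices in `Fin (n * n)`.
cartesianProductWith-tabulate : ∀ {A B C : Set} {m n} (h : A → B → C) (f : Fin m → A) (g : Fin n → B) →
  List.cartesianProductWith h (tabulate f) (tabulate g) ≡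
  tabulate (λ k → h (f (proj₁ (remQuot {m} n k))) (g (proj₂ (remQuot {m} n k))))
cartesianProductWith-tabulate {m = zero}  h f g = refl
cartesianProductWith-tabulate {m = suc m} {n} h f g = sym (trans (tabulate-+ n _) (cong₂ List._++_
  (trans (List.tabulate-cong λ j → cong (λ p → h (f (proj₁ p)) (g (proj₂ p))) (Fin.remQuot-combine {suc m} zero j))
    (sym (List.map-tabulate g (h (f zero)))))
  (trans (List.tabulate-cong λ k → cong (λ p → h (f (proj₁ p)) (g (proj₂ p))) (later k))
    (sym (cartesianProductWith-tabulate h (f ∘ suc) g)))))
  where
  later : ∀ k → remQuot {suc m} n (n Fin′.↑ʳ k) ≡ (suc (proj₁ (remQuot {m} n k)) , proj₂ (remQuot {m} n k))
  later k rewrite Fin.splitAt-↑ʳ n (m * n) k = refl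

spine : Tree → ℕ
spine nil        = 0
spine (cons _ t) = suc (spine t)

spine≤size : ∀ t → spine t ≤ size t
spine≤size nil        = z≤n
spine≤size (cons s t) = s≤s (ℕ.≤-trans (spine≤size t) (ℕ.m≤n+m (size t) (size s)))

private
  successors : Tree → Tree
  successors = mapᵗ (λ t → cons nil (tail t)) nil

  size-successors : ∀ t → size (successors t) ≡ 2 * spine t + size t
  size-successors nil        = refl
  size-successors (cons s t) = trans (cong (λ k → 3 + (size s + k)) (size-successors t))
    (solve 3 (λ s l t → con′ 3 :+ (s :+ (con′ 2 :* l :+ t)) := con′ 2 :* (con′ 1 :+ l) :+ (con′ 1 :+ (s :+ t))) refl (size s) (spine t) (size t))
    where open +-*-Solver using (solve; _:+_; _:*_; _:=_) renaming (con to con′)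

  spine-successors : ∀ t → spine (successors t) ≡ spine t
  spine-successors nil        = refl
  spine-successors (cons s t) = cong suc (spine-successors t)

  successorsᶜ : Computes successors
  successorsᶜ = mapᶜ (λ t → cons nil (tail t)) ⟨ nilᶜ , tailᶜ ⟩ᶜ ∘ᶜ ⟨ nilᶜ , idᶜ ⟩ᶜ

  -- The range 0, ..., k is 0 followed by the successors of 0, ..., k - 1.
  extend : Tree → Tree
  extend t = cons nil (successors (head (tail t)))

  spine-extend : ∀ e a l → spine (foldrᵗ extend e a l) ≡ spine l + spine a
  spine-extend e a nil         = refl
  spine-extend e a (cons x xs) = cong suc (trans (spine-successors (foldrᵗ extend e a xs)) (spine-extend e a xs))

  -- Since a step enlarges every entry of the accumulator, `foldrᵗ-additive` does not apply. The
  -- increase is 2 for each entry and 2 for the new one, and there are never more than M entries.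
  size-extend : ∀ e a l M → spine l + spine a ≤ M → size (foldrᵗ extend e a l) ≤ size a + size l * (2 + 2 * M)
  size-extend e a nil         M _ = ℕ.m≤m+n (size a) _
  size-extend e a (cons x xs) M h = begin
    2 + size (successors A)                        ≡⟨ cong (2 +_) (size-successors A) ⟩
    2 + (2 * spine A + size A)                     ≤⟨ ℕ.+-monoʳ-≤ 2 (ℕ.+-mono-≤ (ℕ.*-monoʳ-≤ 2 spine≤) (size-extend e a xs M smaller)) ⟩
    2 + (2 * M + (size a + size xs * (2 + 2 * M))) ≡⟨ solve 3 (λ m a x → con′ 2 :+ (con′ 2 :* m :+ (a :+ x :* (con′ 2 :+ con′ 2 :* m)))
                                                        := a :+ (con′ 1 :+ x) :* (con′ 2 :+ con′ 2 :* m)) refl M (size a) (size xs) ⟩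
    size a + (1 + size xs) * (2 + 2 * M)           ≤⟨ ℕ.+-monoʳ-≤ (size a) (ℕ.*-monoˡ-≤ (2 + 2 * M) (s≤s (ℕ.m≤n+m (size xs) (size x)))) ⟩
    size a + size (cons x xs) * (2 + 2 * M)        ∎
    where
    open ℕ.≤-Reasoning
    open +-*-Solver using (solve; _:+_; _:*_; _:=_) renaming (con to con′)

    A : Tree
    A = foldrᵗ extend e a xs

    smaller : spine xs + spine a ≤ M
    smaller = ℕ.≤-trans (ℕ.n≤1+n _) h

    spine≤ : spine A ≤ M
    spine≤ = ℕ.≤-trans (ℕ.≤-reflexive (spine-extend e a xs)) smaller

indicesᵗ : Tree → Tree
indicesᵗ = foldrᵗ extend nil nil

indicesᶜ : Computes indicesᵗ
indicesᶜ = foldrᶜ (⟨ nilᶜ , successorsᶜ ∘ᶜ headᶜ ∘ᶜ tailᶜ ⟩ᶜ) (X ⊕ X ⊗ (con 2 ⊕ con 2 ⊗ X))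
  (λ e a l → ℕ.≤-trans
    (size-extend e a l (size (cons e (cons a l))) (ℕ.≤-trans (ℕ.+-mono-≤ (spine≤size l) (spine≤size a))
      (ℕ.≤-trans (ℕ.≤-reflexive (ℕ.+-comm (size l) (size a))) (ℕ.≤-trans (ℕ.n≤1+n _) (size-tail (cons e (cons a l)))))))
    (ℕ.+-mono-≤ (ℕ.≤-trans (size-head (cons a l)) (size-tail (cons e (cons a l))))
      (ℕ.*-monoˡ-≤ _ (ℕ.≤-trans (size-tail (cons a l)) (size-tail (cons e (cons a l)))))))
  ∘ᶜ ⟨ nilᶜ , ⟨ nilᶜ , idᶜ ⟩ᶜ ⟩ᶜ

indices-tabulate : ∀ {n} (f : Fin n → Tree) →
  indicesᵗ (encodeList (tabulate f)) ≡ encodeList (tabulate {n = n} (encodeℕ ∘ toℕ))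
indices-tabulate {zero}  f = refl
indices-tabulate {suc n} f = cong (cons nil) (trans (cong successors (indices-tabulate (f ∘ suc)))
  (trans (mapᵗ-encodeList (λ t → cons nil (tail t)) nil _) (cong encodeList (List.map-tabulate {n = n} (encodeℕ ∘ toℕ) (cons nil)))))

rowᵗ : Tree → Tree
rowᵗ t = mapᵗ cellᵗ (cons (head (head t)) (tail t)) (tail (head t))

rowᶜ : Computes rowᵗ
rowᶜ = mapᶜ cellᵗ cellᶜ ∘ᶜ ⟨ ⟨ headᶜ ∘ᶜ headᶜ , tailᶜ ⟩ᶜ , tailᶜ ∘ᶜ headᶜ ⟩ᶜ

graphᵗ : Tree → Tree
graphᵗ T = mapᵗ rowᵗ (cons T (pairsᵗ (indicesᵗ T))) (pairsᵗ (indicesᵗ T))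

graphᶜ : Computes graphᵗ
graphᶜ = mapᶜ rowᵗ rowᶜ ∘ᶜ ⟨ ⟨ idᶜ , pairsᶜ ∘ᶜ indicesᶜ ⟩ᶜ , pairsᶜ ∘ᶜ indicesᶜ ⟩ᶜ

module _ {n} (Γ : GroupOn n) where
  open GroupOn Γ
  open NetGraph (cayleyNet Γ)

  private
    label : Fin (n * n) → Tree
    label u = cons (encodeℕ (toℕ (proj₁ (remQuot {n} n u)))) (encodeℕ (toℕ (proj₂ (remQuot {n} n u))))

    adjacent-label : ∀ u v → adjacentᵗ (cayleyTable finite) (label u) (label v) ≡ encodeBool (adj graph u v)
    adjacent-label u v
      rewrite entry-encodeTable (λ a b → encodeℕ (toℕ (a ∙ b))) (proj₁ (remQuot {n} n u)) (proj₂ (remQuot {n} n u))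
            | entry-encodeTable (λ a b → encodeℕ (toℕ (a ∙ b))) (proj₁ (remQuot {n} n v)) (proj₂ (remQuot {n} n v))
            | equal-Fin (proj₁ (remQuot {n} n u)) (proj₁ (remQuot {n} n v))
            | equal-Fin (proj₂ (remQuot {n} n u)) (proj₂ (remQuot {n} n v))
            | equal-Fin (proj₁ (remQuot {n} n u) ∙ proj₂ (remQuot {n} n u)) (proj₁ (remQuot {n} n v) ∙ proj₂ (remQuot {n} n v))
      = cases (u Fin.≟ v) (proj₁ (remQuot {n} n u) Fin.≟ proj₁ (remQuot {n} n v)) (proj₂ (remQuot {n} n u) Fin.≟ proj₂ (remQuot {n} n v))
          (proj₁ (remQuot {n} n u) ∙ proj₂ (remQuot {n} n u) Fin.≟ proj₁ (remQuot {n} n v) ∙ proj₂ (remQuot {n} n v))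
      where
      cases : ∀ (p : Dec (u ≡ v)) (a : Dec (proj₁ (remQuot {n} n u) ≡ proj₁ (remQuot {n} n v)))
        (b : Dec (proj₂ (remQuot {n} n u) ≡ proj₂ (remQuot {n} n v)))
        (c : Dec (proj₁ (remQuot {n} n u) ∙ proj₂ (remQuot {n} n u) ≡ proj₁ (remQuot {n} n v) ∙ proj₂ (remQuot {n} n v))) →
        (if isCons (encodeBool (does a)) then notᵗ (encodeBool (does b)) else
         if isCons (encodeBool (does b)) then yes′ else encodeBool (does c)) ≡
        encodeBool (not (does p) ∧ (does a ∨ (does b ∨ (does c ∨ false))))
      cases (yes refl) (yes _) (yes _) c = refl
      cases (no u≢v)   (yes a) (yes b) c = contradiction (Net.coord-unique (cayleyNet Γ) {0F} {1F} (λ ()) a b) u≢v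
      cases (yes refl) (no ¬a) b       c = contradiction refl ¬a
      cases (yes refl) (yes _) (no ¬b) c = contradiction refl ¬b
      cases (no _)     (yes _) (no _)  c = refl
      cases (no _)     (no _)  (yes _) c = refl
      cases (no _)     (no _)  (no _) (yes _) = refl
      cases (no _)     (no _)  (no _) (no _)  = refl

    vertices : pairsᵗ (indicesᵗ (cayleyTable finite)) ≡ encodeList (tabulate label)
    vertices = trans (cong pairsᵗ (indices-tabulate λ a → encodeList (tabulate λ b → encodeℕ (toℕ (a ∙ b)))))
      (trans (pairs-encodeList (tabulate {n = n} (encodeℕ ∘ toℕ)))
        (cong encodeList (cartesianProductWith-tabulate {m = n} cons (encodeℕ ∘ toℕ) (encodeℕ ∘ toℕ))))

  graph-cayleyTable : graphᵗ (cayleyTable finite) ≡ encodeGraph graph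
  graph-cayleyTable = trans (cong (λ V → mapᵗ rowᵗ (cons (cayleyTable finite) V) V) vertices)
    (trans (mapᵗ-encodeList rowᵗ _ (tabulate label)) (cong encodeList (trans (List.map-tabulate label (λ u → rowᵗ (cons (cons (cayleyTable finite) (encodeList (tabulate label))) u)))
      (List.tabulate-cong λ u → trans (mapᵗ-encodeList cellᵗ (cons (cayleyTable finite) (label u)) (tabulate label))
        (cong encodeList (trans (List.map-tabulate label (λ v → cellᵗ (cons (cons (cayleyTable finite) (label u)) v))) (List.tabulate-cong (adjacent-label u))))))))

-- The reduction

evalCong : ∀ {σ τ : Store} → (∀ y → σ y ≡ τ y) → ∀ e → eval σ e ≡ eval τ e
evalCong eq (var x)    = eq x
evalCong eq nil        = refl
evalCong eq (cons e f) = cong₂ cons (evalCong eq e) (evalCong eq f)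
evalCong eq (hd e)     = cong head (evalCong eq e)
evalCong eq (tl e)     = cong tail (evalCong eq e)

-- Stores are functions, so agreement at every variable is not propositional equality. This carries
-- the run of the assumed algorithm from `initial` to the store that the reduction leaves behind.
⇓-cong : ∀ {C σ σ′ T τ} → (∀ y → σ y ≡ σ′ y) → ⟨ C , σ ⟩⇓[ T ] τ → ∃[ τ′ ] ⟨ C , σ′ ⟩⇓[ T ] τ′ × (∀ y → τ y ≡ τ′ y)
⇓-cong eq ⇓-skip = _ , ⇓-skip , eq
⇓-cong eq (⇓-assign {x = x} {e = e}) = _ , ⇓-assign , λ y → cong₂ (λ t s → if does (x ℕ.≟ y) then t else s) (evalCong eq e) (eq y)
⇓-cong eq (⇓-seq r r′) =
  let _ , s , eq′ = ⇓-cong eq r ; _ , s′ , eq″ = ⇓-cong eq′ r′ in _ , ⇓-seq s s′ , eq″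
⇓-cong eq (⇓-then {e = e} c r) =
  let _ , s , eq′ = ⇓-cong eq r in _ , ⇓-then (trans (cong isCons (sym (evalCong eq e))) c) s , eq′
⇓-cong eq (⇓-else {e = e} c r) =
  let _ , s , eq′ = ⇓-cong eq r in _ , ⇓-else (trans (cong isCons (sym (evalCong eq e))) c) s , eq′
⇓-cong eq (⇓-stop {e = e} c) = _ , ⇓-stop (trans (cong isCons (sym (evalCong eq e))) c) , eq
⇓-cong eq (⇓-loop {e = e} c r r′) =
  let _ , s , eq′ = ⇓-cong eq r ; _ , s′ , eq″ = ⇓-cong eq′ r′ in
  _ , ⇓-loop (trans (cong isCons (sym (evalCong eq e))) c) s s′ , eq″

clear : ℕ → Command
clear zero    = skip
clear (suc k) = suc k ≔ nil ⨾ clear k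

-- The assumed algorithm is guaranteed only on an initial store, so the scratch variables, all
-- within the frame, are reset before it is called.
clear-runs : ∀ k σ → (∀ y → k < y → σ y ≡ nil) →
  ∃[ S ] ∃[ τ ] ⟨ clear k , σ ⟩⇓[ S ] τ × (∀ y → τ y ≡ initial (σ 0) y) × S ≤ 1 + 2 * k
clear-runs zero σ above = _ , σ , ⇓-skip , (λ { zero → refl ; (suc y) → above (suc y) (s≤s z≤n) }) , ℕ.≤-refl
clear-runs (suc k) σ above =
  let S , τ , r , eq , S≤ = clear-runs k (σ [ suc k ↦ nil ]) above′
  in _ , τ , ⇓-seq ⇓-assign r , eq , ℕ.≤-trans (ℕ.+-monoʳ-≤ 2 S≤)
       (ℕ.≤-reflexive (solve 1 (λ k → con′ 2 :+ (con′ 1 :+ con′ 2 :* k) := con′ 1 :+ con′ 2 :* (con′ 1 :+ k)) refl k))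
  where
  open +-*-Solver using (solve; _:+_; _:*_; _:=_) renaming (con to con′)

  above′ : ∀ y → k < y → (σ [ suc k ↦ nil ]) y ≡ nil
  above′ y k<y with suc k ℕ.≟ y
  ... | yes refl = update-≡ σ (suc k) nil
  ... | no k≢y = trans (update-≢ σ nil k≢y) (above y (ℕ.≤∧≢⇒< k<y k≢y))

-- Table lookup for small groups

Fits : ℕ → Tree → Set
Fits K       nil        = ⊤
Fits zero    (cons s t) = ⊥
Fits (suc K) (cons s t) = Fits K s × Fits K t

Fits-mono : ∀ {K L} t → K ≤ L → Fits K t → Fits L t
Fits-mono nil        K≤L       h         = h
Fits-mono (cons s t) (s≤s K≤L) (hs , ht) = Fits-mono s K≤L hs , Fits-mono t K≤L ht

-- A decision tree that reads a value of height at most K by tests for nil. The continuation `D` is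
-- expanded when the program is built, so each leaf holds the code for one value and an arbitrary
-- function on finitely many trees costs constant time.
dispatch : ℕ → Expr → (Tree → Command) → Command
dispatch zero    e D = D nil
dispatch (suc K) e D = when e then dispatch K (hd e) (λ s → dispatch K (tl e) (λ t → D (cons s t))) else D nil

overhead : ℕ → Expr → ℕ
overhead zero    e = 0
overhead (suc K) e = suc (cost e) + (overhead K (hd e) + overhead K (tl e))

dispatch-runs : ∀ K e D {σ τ S} t → eval σ e ≡ t → Fits K t → ⟨ D t , σ ⟩⇓[ S ] τ →
  ∃[ T ] ⟨ dispatch K e D , σ ⟩⇓[ T ] τ × T ≤ overhead K e + S
dispatch-runs zero    e D nil eq fits r = _ , r , ℕ.≤-refl
dispatch-runs (suc K) e D {S = S} nil eq fits r = _ , ⇓-else (cong isCons eq) r ,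
  ℕ.+-monoˡ-≤ S (ℕ.m≤m+n (suc (cost e)) _)
dispatch-runs (suc K) e D {S = S} (cons s t) eq (fs , ft) r =
  let T , r′ , T≤  = dispatch-runs K (tl e) (λ t → D (cons s t)) t (cong tail eq) ft r
      U , r″ , U≤ = dispatch-runs K (hd e) (λ s → dispatch K (tl e) (λ t → D (cons s t))) s (cong head eq) fs r′
  in _ , ⇓-then (cong isCons eq) r″ , ℕ.≤-trans (ℕ.+-monoʳ-≤ (suc (cost e)) (ℕ.≤-trans U≤ (ℕ.+-monoʳ-≤ (overhead K (hd e)) T≤)))
       (ℕ.≤-reflexive (solve 4 (λ c h t s → c :+ (h :+ (t :+ s)) := c :+ (h :+ t) :+ s) refl
         (suc (cost e)) (overhead K (hd e)) (overhead K (tl e)) S))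
  where open +-*-Solver using (solve; _:+_; _:=_)

answer : Bool → Command
answer true  = 0 ≔ cons nil nil
answer false = 0 ≔ nil

answer-runs : ∀ b σ → ∃[ S ] ∃[ τ ] ⟨ answer b , σ ⟩⇓[ S ] τ × isCons (τ 0) ≡ b × S ≤ 4
answer-runs true  σ = _ , _ , ⇓-assign , refl , ℕ.≤-refl
answer-runs false σ = _ , _ , ⇓-assign , refl , s≤s (s≤s z≤n)

fits-encodeℕ : ∀ k → Fits k (encodeℕ k)
fits-encodeℕ zero    = tt
fits-encodeℕ (suc k) = tt , fits-encodeℕ k

fits-encodeList : ∀ {n K} (f : Fin n → Tree) → (∀ i → Fits K (f i)) → Fits (n + K) (encodeList (tabulate f))
fits-encodeList {zero}      f fits = tt
fits-encodeList {suc n} {K} f fits = Fits-mono (f zero) (ℕ.m≤n+m K n) (fits zero) , fits-encodeList (f ∘ suc) (fits ∘ suc)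

tableDepth : ℕ → ℕ
tableDepth k = k + (k + k)

fits-cayleyTable : ∀ {k} Γ → FiniteGroup.order Γ ≤ k → Fits (tableDepth k) (cayleyTable Γ)
fits-cayleyTable {k} Γ n≤k = Fits-mono (cayleyTable Γ) (ℕ.+-monoˡ-≤ (k + k) n≤k)
  (fits-encodeList _ λ a → Fits-mono (encodeList (tabulate (row a))) (ℕ.+-monoˡ-≤ k n≤k)
    (fits-encodeList (row a) λ b → Fits-mono (row a b) (ℕ.≤-trans (ℕ.<⇒≤ (Fin.toℕ<n (a ∙ b))) n≤k) (fits-encodeℕ (toℕ (a ∙ b)))))
  where
  open FiniteGroup Γ
  row : Fin order → Fin order → Tree
  row a b = encodeℕ (toℕ (a ∙ b))

spine-encodeList : ∀ {n} (f : Fin n → Tree) → spine (encodeList (tabulate f)) ≡ n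
spine-encodeList {zero}  f = refl
spine-encodeList {suc n} f = cong suc (spine-encodeList (f ∘ suc))

spine-encodeℕ : ∀ k → spine (encodeℕ k) ≡ k
spine-encodeℕ zero    = refl
spine-encodeℕ (suc k) = cong suc (spine-encodeℕ k)

groupOn : (Γ : FiniteGroup) → GroupOn (FiniteGroup.order Γ)
groupOn Γ = record { isGroup = FiniteGroup.isGroup Γ }

-- The lookup table has to decide isomorphism from the trees alone; n and m are
-- separate parameters because the order of a group is only provably the length
-- of its table.
module _ (n m : ℕ) (T T′ : Tree) where
  Entry : ∀ {k} → Tree → Fin k → Fin k → Fin k → Set
  Entry T i j l = spine (entryᵗ T (cons (encodeℕ (toℕ i)) (encodeℕ (toℕ j)))) ≡ toℕ l

  Embedding : (Fin n → Fin m) → Set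
  Embedding f = (∀ i j → f i ≡ f j → i ≡ j) × (∀ i j l → Entry T i j l → Entry T′ (f i) (f j) (f l))

  -- Maps are coded by `finToFun` as elements of a finite type, which makes the search for one
  -- decidable.
  IsomorphicTables : Set
  IsomorphicTables = n ≡ m × ∃[ k ] Embedding (finToFun {m} {n} k)

  embedding? : ∀ f → Dec (Embedding f)
  embedding? f =
    (Fin.all? λ i → Fin.all? λ j → (f i Fin.≟ f j) →-dec (i Fin.≟ j)) ×-dec
    (Fin.all? λ i → Fin.all? λ j → Fin.all? λ l → (_ ℕ.≟ toℕ l) →-dec (_ ℕ.≟ toℕ (f l)))

  isomorphicTables? : Dec IsomorphicTables
  isomorphicTables? = (n ℕ.≟ m) ×-dec Fin.any? λ k → embedding? (finToFun k)

  Embedding-cong : ∀ {f g} → (∀ i → f i ≡ g i) → Embedding f → Embedding g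
  Embedding-cong eq (inj , hom) =
    (λ i j e → inj i j (trans (eq i) (trans e (sym (eq j))))) ,
    λ i j l e → subst₂ (λ x y → spine (entryᵗ T′ (cons (encodeℕ (toℕ x)) (encodeℕ (toℕ y)))) ≡ _) (eq i) (eq j)
      (trans (hom i j l e) (cong toℕ (eq l)))

Isomorphic⇒order : ∀ Γ Δ → Isomorphic Γ Δ → FiniteGroup.order Γ ≡ FiniteGroup.order Δ
Isomorphic⇒order Γ Δ (f , iso) = ℕ.≤-antisym (Fin.injective⇒≤ {f = f} injective)
  (Fin.injective⇒≤ {f = λ y → proj₁ (surjective y)} λ {x} {y} eq →
    trans (sym (proj₂ (surjective x) refl)) (trans (cong f eq) (proj₂ (surjective y) refl)))
  where open GroupMorphisms.IsGroupIsomorphism iso using (injective; surjective)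

entry-cayleyTable : ∀ Γ i j l → let open FiniteGroup Γ in
  Entry 0 0 nil nil (cayleyTable Γ) i j l ⇔ i ∙ j ≡ l
entry-cayleyTable Γ i j l = mk⇔
  (λ e → Fin.toℕ-injective (trans (sym computed) e))
  (λ e → trans computed (cong toℕ e))
  where
  open FiniteGroup Γ
  computed : spine (entryᵗ (cayleyTable Γ) (cons (encodeℕ (toℕ i)) (encodeℕ (toℕ j)))) ≡ toℕ (i ∙ j)
  computed = trans (cong spine (entry-encodeTable (λ a b → encodeℕ (toℕ (a ∙ b))) i j)) (spine-encodeℕ (toℕ (i ∙ j)))

isomorphicTables⇔ : ∀ Γ Δ → IsomorphicTables (FiniteGroup.order Γ) (FiniteGroup.order Δ) (cayleyTable Γ) (cayleyTable Δ) ⇔ Isomorphic Γ Δ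
isomorphicTables⇔ Γ Δ = mk⇔ (λ (eq , k , h) → to (groupOn Γ) (groupOn Δ) eq (finToFun k) h)
  (λ iso@(f , isIso) → let open GroupMorphisms.IsGroupIsomorphism isIso in
    Isomorphic⇒order Γ Δ iso , funToFin f , Embedding-cong n m (cayleyTable Γ) (cayleyTable Δ)
      (λ i → sym (Fin.finToFun-funToFin f i))
      ((λ i j e → injective e) , λ i j l e → Equivalence.from (entry-cayleyTable Δ (f i) (f j) (f l))
        (trans (sym (∙-homo i j)) (cong f (Equivalence.to (entry-cayleyTable Γ i j l) e)))))
  where
  n = FiniteGroup.order Γ
  m = FiniteGroup.order Δ

  to : ∀ {n m} (Γ : GroupOn n) (Δ : GroupOn m) → n ≡ m → (f : Fin n → Fin m) →
    Embedding n m (cayleyTable (GroupOn.finite Γ)) (cayleyTable (GroupOn.finite Δ)) f →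
    Isomorphic (GroupOn.finite Γ) (GroupOn.finite Δ)
  to Γ Δ refl f (inj , hom) = injectiveHomomorphism⇒Isomorphic Γ Δ f (inj _ _) λ a b →
    sym (Equivalence.to (entry-cayleyTable (GroupOn.finite Δ) (f a) (f b) _)
      (hom a b _ (Equivalence.from (entry-cayleyTable (GroupOn.finite Γ) a b _) refl)))

isomorphicTrees : Tree → Bool
isomorphicTrees t = does (isomorphicTables? (spine (head t)) (spine (tail t)) (head t) (tail t))

isomorphicTrees-reflects : ∀ Γ Δ → Reflects (Isomorphic Γ Δ) (isomorphicTrees (cons (cayleyTable Γ) (cayleyTable Δ)))
isomorphicTrees-reflects Γ Δ = subst (Reflects (Isomorphic Γ Δ))
  (cong₂ (λ n m → does (isomorphicTables? n m (cayleyTable Γ) (cayleyTable Δ)))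
    (sym (spine-encodeList {FiniteGroup.order Γ} _)) (sym (spine-encodeList {FiniteGroup.order Δ} _)))
  (proof (map′ (Equivalence.to e) (Equivalence.from e)
    (isomorphicTables? (FiniteGroup.order Γ) (FiniteGroup.order Δ) (cayleyTable Γ) (cayleyTable Δ))))
  where
  e = isomorphicTables⇔ Γ Δ

spine-tail : ∀ t → spine (tail t) ≡ ℕ.pred (spine t)
spine-tail nil        = refl
spine-tail (cons s t) = refl

spine-drop : ∀ x y → spine (dropᵗ x y) ≡ spine y ∸ spine x
spine-drop nil         y = refl
spine-drop (cons _ xs) y = trans (spine-tail (dropᵗ xs y))
  (trans (cong ℕ.pred (spine-drop xs y)) (ℕ.pred[m∸n]≡m∸[1+n] (spine y) (spine xs)))

isCons-spine : ∀ {t k} → spine t ≡ suc k → isCons t ≡ true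
isCons-spine {cons _ _} _ = refl

isCons-spine₀ : ∀ {t} → spine t ≡ 0 → isCons t ≡ false
isCons-spine₀ {nil} _ = refl

equal-spine : ∀ x y → spine x ≡ spine y → isCons (equalᵗ x y) ≡ true
equal-spine x y eq
  rewrite isCons-spine₀ {dropᵗ x y} (trans (spine-drop x y) (trans (cong (_∸ spine x) (sym eq)) (ℕ.n∸n≡0 (spine x))))
        | isCons-spine₀ {dropᵗ y x} (trans (spine-drop y x) (trans (cong (_∸ spine y) eq) (ℕ.n∸n≡0 (spine y)))) = refl

unequal-spine : ∀ x y → spine x ≢ spine y → isCons (equalᵗ x y) ≡ false
unequal-spine x y neq with ℕ.<-cmp (spine x) (spine y)
... | tri≈ _ eq _ = contradiction eq neq
... | tri< x<y _ _ rewrite isCons-spine {dropᵗ x y} (trans (spine-drop x y) (sym (ℕ.suc-pred _ {{ℕ.>-nonZero (ℕ.m<n⇒0<n∸m x<y)}}))) = refl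
... | tri> _ _ y<x rewrite isCons-spine {dropᵗ y x} (trans (spine-drop y x) (sym (ℕ.suc-pred _ {{ℕ.>-nonZero (ℕ.m<n⇒0<n∸m y<x)}})))
  with isCons (dropᵗ x y)
... | true  = refl
... | false = refl

tls : ℕ → Expr → Expr
tls zero    e = e
tls (suc k) e = tl (tls k e)

spine-tls : ∀ k e σ → spine (eval σ (tls k e)) ≡ spine (eval σ e) ∸ k
spine-tls zero    e σ = refl
spine-tls (suc k) e σ = trans (spine-tail (eval σ (tls k e)))
  (trans (cong ℕ.pred (spine-tls k e σ)) (ℕ.pred[m∸n]≡m∸[1+n] (spine (eval σ e)) k))

longer : ∀ k e σ → k < spine (eval σ e) → isCons (eval σ (tls k e)) ≡ true
longer k e σ k< = isCons-spine (trans (spine-tls k e σ) (sym (ℕ.suc-pred _ {{ℕ.>-nonZero (ℕ.m<n⇒0<n∸m k<)}})))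

notLonger : ∀ k e σ → spine (eval σ e) ≤ k → isCons (eval σ (tls k e)) ≡ false
notLonger k e σ ≤k = isCons-spine₀ (trans (spine-tls k e σ) (ℕ.m≤n⇒m∸n≡0 ≤k))

-- Groups of different orders give no graphs on a common vertex set, hence no instance; nil stands
-- for this outcome.
graphsᵗ : Tree → Tree
graphsᵗ t = if isCons (equalᵗ (head t) (tail t)) then cons nil (cons (graphᵗ (head t)) (graphᵗ (tail t))) else nil

abstract
  graphsᶜ : Computes graphsᵗ
  graphsᶜ = if_thenᶜ_elseᶜ_ ⟨ nilᶜ , ⟨ graphᶜ ∘ᶜ headᶜ , graphᶜ ∘ᶜ tailᶜ ⟩ᶜ ⟩ᶜ nilᶜ equalᶜ

power : Polynomial → ℕ → Polynomial
power p zero    = con 1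
power p (suc d) = p ⊗ power p d

power-eval : ∀ p d s → ⟦ power p d ⟧ s ≡ ⟦ p ⟧ s ℕ.^ d
power-eval p zero    s = refl
power-eval p (suc d) s = cong (⟦ p ⟧ s *_) (power-eval p d s)

cayleyGraph : ∀ {n} → GroupOn n → Graph (n * n)
cayleyGraph Γ = NetGraph.graph (cayleyNet Γ)

-- The form common to both distances. The instance is tied to the program by its encoding alone, so
-- the promise, such as cospectrality, is proved but never computed.
Reduces : (CospectralPair → Set) → ℕ → Set
Reduces Yes n₀ = ∀ {n} → n₀ < n → (Γ Δ : GroupOn n) → Σ[ p ∈ CospectralPair ]
  encodePair p ≡ cons (encodeGraph (cayleyGraph Γ)) (encodeGraph (cayleyGraph Δ)) ×
  (Yes p ⇔ Isomorphic (GroupOn.finite Γ) (GroupOn.finite Δ))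

-- Groups of order at most n₀ are looked up in a finite table.
module _ (Yes : CospectralPair → Set) (n₀ : ℕ) (reduces : Reduces Yes n₀)
  (C : Command) (c d : ℕ)
  (decides : ∀ p → ∃[ b ] C on encodePair p answers b within (c * size (encodePair p) ℕ.^ d) × Reflects (Yes p) b) where

  private
    depth : ℕ
    depth = suc (tableDepth n₀)

    first second : Expr
    first  = tls n₀ (hd (var 0))
    second = tls n₀ (tl (var 0))

    large table program′ : Command
    large    = program graphsᶜ ⨾ when var 0 then (0 ≔ tl (var 0) ⨾ clear (frame graphsᶜ) ⨾ C) else skip
    table    = dispatch depth (var 0) (λ t → answer (isomorphicTrees t))
    program′ = when first then large else (when second then answer false else table)

    tests : ℕ
    tests = suc (cost first) + suc (cost second)

    budget : Polynomial
    budget = con tests ⊕ (con (overhead depth (var 0) + 4) ⊕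
      (time graphsᶜ ⊕ (con (8 + 2 * frame graphsᶜ) ⊕ con c ⊗ power (growth graphsᶜ) d)))

    input : FiniteGroup → FiniteGroup → Tree
    input Γ Δ = cons (cayleyTable Γ) (cayleyTable Δ)

    spine-table : ∀ Γ → spine (cayleyTable Γ) ≡ FiniteGroup.order Γ
    spine-table Γ = spine-encodeList {FiniteGroup.order Γ} _

    Answers : Command → FiniteGroup → FiniteGroup → ℕ → Set
    Answers D Γ Δ T = ∃[ b ] D on input Γ Δ answers b within T × Reflects (Isomorphic Γ Δ) b

    largeBudget : Polynomial
    largeBudget = time graphsᶜ ⊕ (con (8 + 2 * frame graphsᶜ) ⊕ con c ⊗ power (growth graphsᶜ) d)

    large-answers : ∀ Γ Δ → n₀ < FiniteGroup.order Γ → Answers large Γ Δ (⟦ largeBudget ⟧ (size (input Γ Δ)))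
    large-answers Γ Δ n₀< with runs graphsᶜ (initial (input Γ Δ)) (input Γ Δ) refl
    ... | S , σ , r , σ0 , kept , S≤ with FiniteGroup.order Γ ℕ.≟ FiniteGroup.order Δ
    ...   | no neq = false
      , (_ , σ , ⇓-seq r (⇓-else (cong isCons nothing) ⇓-skip) , cong isCons nothing ,
          ℕ.+-mono-≤ S≤ (ℕ.≤-trans (ℕ.m≤m+n 3 _) (ℕ.m≤m+n (8 + 2 * frame graphsᶜ) _)))
      , ofⁿ (neq ∘ Isomorphic⇒order Γ Δ)
      where
      nothing : σ 0 ≡ nil
      nothing = trans σ0 (cong (λ b → if b then cons nil (cons (graphᵗ (cayleyTable Γ)) (graphᵗ (cayleyTable Δ))) else nil)
        (unequal-spine (cayleyTable Γ) (cayleyTable Δ) (λ eq → neq (trans (sym (spine-table Γ)) (trans eq (spine-table Δ))))))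
    ...   | yes eq = finish (pair (groupOn Γ) (groupOn Δ) eq n₀<)
      where
      Pair : Set
      Pair = Σ[ p ∈ CospectralPair ]
        encodePair p ≡ cons (graphᵗ (cayleyTable Γ)) (graphᵗ (cayleyTable Δ)) × (Yes p ⇔ Isomorphic Γ Δ)

      -- Stated for groups indexed by their orders, so that the equality of the orders can be
      -- matched with `refl`.
      pair : ∀ {n m} (Γ : GroupOn n) (Δ : GroupOn m) → n ≡ m → n₀ < n → Σ[ p ∈ CospectralPair ]
        encodePair p ≡ cons (graphᵗ (cayleyTable (GroupOn.finite Γ))) (graphᵗ (cayleyTable (GroupOn.finite Δ))) ×
        (Yes p ⇔ Isomorphic (GroupOn.finite Γ) (GroupOn.finite Δ))
      pair Γ Δ refl n₀< = let p , e , iff = reduces n₀< Γ Δ in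
        p , trans e (sym (cong₂ cons (graph-cayleyTable Γ) (graph-cayleyTable Δ))) , iff

      found : σ 0 ≡ cons nil (cons (graphᵗ (cayleyTable Γ)) (graphᵗ (cayleyTable Δ)))
      found = trans σ0 (cong (λ b → if b then cons nil (cons (graphᵗ (cayleyTable Γ)) (graphᵗ (cayleyTable Δ))) else nil)
        (equal-spine (cayleyTable Γ) (cayleyTable Δ) (trans (spine-table Γ) (trans eq (sym (spine-table Δ))))))

      finish : Pair → Answers large Γ Δ (⟦ largeBudget ⟧ (size (input Γ Δ)))
      finish (p , e , iff) with clear-runs (frame graphsᶜ) (σ [ 0 ↦ tail (σ 0) ])
        (λ y k<y → trans (update-≢ σ (tail (σ 0)) (above-0 k<y)) (trans (kept y k<y) (update-≢ (λ _ → nil) (input Γ Δ) (above-0 k<y))))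
      ... | U , τ , cleared , τ≗ , U≤ with decides p
      ... | b , (V , ρ , run , ρ0 , V≤) , reflects
        with ⇓-cong (λ y → sym (trans (τ≗ y) (cong (λ t → initial t y) (trans (cong tail found) (sym e))))) run
      ... | ρ′ , run′ , ρ≗ = b
        , (_ , ρ′ , ⇓-seq r (⇓-then (cong isCons found) (⇓-seq ⇓-assign (⇓-seq cleared run′)))
          , trans (cong isCons (sym (ρ≗ 0))) ρ0
          , ℕ.≤-trans (ℕ.≤-reflexive (solve 3 (λ S U V → S :+ (con′ 2 :+ (con′ 3 :+ (U :+ V))) := S :+ ((con′ 5 :+ U) :+ V)) refl S U V))
              (ℕ.+-mono-≤ S≤ (ℕ.+-mono-≤ (ℕ.≤-trans (ℕ.+-monoʳ-≤ 5 U≤) (ℕ.m≤n+m _ 2))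
                (ℕ.≤-trans V≤ (ℕ.*-monoʳ-≤ c (ℕ.≤-trans (ℕ.^-monoˡ-≤ d small) (ℕ.≤-reflexive (sym (power-eval (growth graphsᶜ) d _)))))))))
        , agree reflects
        where
        open +-*-Solver using (solve; _:+_; _:=_) renaming (con to con′)

        small : size (encodePair p) ≤ ⟦ growth graphsᶜ ⟧ (size (input Γ Δ))
        small = ℕ.≤-trans (ℕ.≤-reflexive (cong size (trans e (sym (cong tail (trans (sym σ0) found))))))
          (ℕ.≤-trans (size-tail (graphsᵗ (input Γ Δ))) (grows graphsᶜ (input Γ Δ)))

        agree : ∀ {b} → Reflects (Yes p) b → Reflects (Isomorphic Γ Δ) b
        agree (ofʸ y) = ofʸ (Equivalence.to iff y)
        agree (ofⁿ n) = ofⁿ (n ∘ Equivalence.from iff)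

    table-answers : ∀ Γ Δ → FiniteGroup.order Γ ≤ n₀ → FiniteGroup.order Δ ≤ n₀ →
      Answers table Γ Δ (overhead depth (var 0) + 4)
    table-answers Γ Δ Γ≤ Δ≤ =
      let S , τ , r , τ0 , S≤ = answer-runs (isomorphicTrees (input Γ Δ)) (initial (input Γ Δ))
          T , r′ , T≤ = dispatch-runs depth (var 0) (λ t → answer (isomorphicTrees t)) (input Γ Δ) refl
            (fits-cayleyTable Γ Γ≤ , fits-cayleyTable Δ Δ≤) r
      in _ , (T , τ , r′ , τ0 , ℕ.≤-trans T≤ (ℕ.+-monoʳ-≤ (overhead depth (var 0)) S≤)) , isomorphicTrees-reflects Γ Δ

    program-answers : ∀ Γ Δ → Answers program′ Γ Δ (⟦ budget ⟧ (size (input Γ Δ)))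
    program-answers Γ Δ with n₀ ℕ.<? FiniteGroup.order Γ | n₀ ℕ.<? FiniteGroup.order Δ
    ... | yes n₀<Γ | _ =
      let b , (S , τ , r , τ0 , S≤) , reflects = large-answers Γ Δ n₀<Γ in
      b , (_ , τ , ⇓-then (longer n₀ (hd (var 0)) _ (subst (n₀ <_) (sym (spine-table Γ)) n₀<Γ)) r , τ0 ,
        ℕ.+-mono-≤ (ℕ.m≤m+n (suc (cost first)) _) (ℕ.≤-trans S≤ (ℕ.m≤n+m _ (overhead depth (var 0) + 4)))) , reflects
    ... | no n₀≮Γ | yes n₀<Δ = false
      , (_ , _ , ⇓-else (notLonger n₀ (hd (var 0)) _ (subst (_≤ n₀) (sym (spine-table Γ)) (ℕ.≮⇒≥ n₀≮Γ)))
          (⇓-then (longer n₀ (tl (var 0)) _ (subst (n₀ <_) (sym (spine-table Δ)) n₀<Δ)) ⇓-assign) , refl ,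
          ℕ.≤-trans (ℕ.≤-reflexive (sym (ℕ.+-assoc (suc (cost first)) (suc (cost second)) 2)))
            (ℕ.+-monoʳ-≤ tests (ℕ.≤-trans (ℕ.≤-trans (s≤s (s≤s z≤n)) (ℕ.m≤n+m 4 (overhead depth (var 0)))) (ℕ.m≤m+n _ _))))
      , ofⁿ λ iso → n₀≮Γ (subst (n₀ <_) (sym (Isomorphic⇒order Γ Δ iso)) n₀<Δ)
    ... | no n₀≮Γ | no n₀≮Δ =
      let b , (S , τ , r , τ0 , S≤) , reflects = table-answers Γ Δ (ℕ.≮⇒≥ n₀≮Γ) (ℕ.≮⇒≥ n₀≮Δ) in
      b , (_ , τ , ⇓-else (notLonger n₀ (hd (var 0)) _ (subst (_≤ n₀) (sym (spine-table Γ)) (ℕ.≮⇒≥ n₀≮Γ)))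
          (⇓-else (notLonger n₀ (tl (var 0)) _ (subst (_≤ n₀) (sym (spine-table Δ)) (ℕ.≮⇒≥ n₀≮Δ))) r) , τ0 ,
          ℕ.≤-trans (ℕ.≤-reflexive (sym (ℕ.+-assoc (suc (cost first)) (suc (cost second)) S)))
            (ℕ.+-monoʳ-≤ tests (ℕ.≤-trans S≤ (ℕ.m≤m+n _ _)))) , reflects

  groupIsomorphism-decidable : DecidableInPolyTime GroupIsomorphism
  groupIsomorphism-decidable = let c′ , d′ , bound = monomial-bound budget in
    program′ , c′ , d′ , λ (Γ , Δ) →
      let b , (S , τ , r , τ0 , S≤) , reflects = program-answers Γ Δ in
      b , (S , τ , r , τ0 , ℕ.≤-trans S≤ (bound (size (input Γ Δ)) (1≤size (input Γ Δ)))) , reflects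

-- Thresholds for the two distances

castℚ-* : ∀ a b → castℚ (a * b) ≡ castℚ a ℚ.* castℚ b
castℚ-* zero    b = sym (ℚ.*-zeroˡ (castℚ b))
castℚ-* (suc a) b = trans (castℚ-+ b (a * b)) (trans (cong (castℚ b ℚ.+_) (castℚ-* a b))
  (ℚS.solve 2 (λ a b → b ℚS.:+ a ℚS.:* b ℚS.:= (ℚS.con 1ℚ ℚS.:+ a) ℚS.:* b) refl (castℚ a) (castℚ b)))

-- The growth condition on t is used only at the vertex numbers n · n, so no irrational root has to
-- be constructed.
square-root : ∀ n → IsSqrt (fromℕ (n * n)) (fromℕ n)
square-root n = fromℚ-mono-≤ {0ℚ} {ℤ.+ n ℚ./ 1} (subst (0ℚ ℚ.≤_) (castℚ≡ n) (castℚ≥0 n)) ,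
  ≐⇒≈ λ _ → trans (cong₂ ℚ._*_ (sym (castℚ≡ n)) (sym (castℚ≡ n))) (trans (sym (castℚ-* n n)) (castℚ≡ (n * n)))

≤half⇒ : ∀ {d n} → fromℕ d ≤ℝ fromℚ ½ *ℝ fromℕ n → d + d ≤ n
≤half⇒ {d} {n} h = castℚ-cancel-≤ (subst₂ ℚ._≤_ (sym (castℚ-+ d d)) (halves (castℚ n)) (ℚ.+-mono-≤ d≤ d≤))
  where
  d≤ : castℚ d ℚ.≤ ½ ℚ.* castℚ n
  d≤ = subst₂ (λ p q → p ℚ.≤ ½ ℚ.* q) (sym (castℚ≡ d)) (sym (castℚ≡ n)) (fromℚ-cancel-≤ {ℤ.+ d ℚ./ 1} {½ ℚ.* (ℤ.+ n ℚ./ 1)} h)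

  halves : ∀ q → ½ ℚ.* q ℚ.+ ½ ℚ.* q ≡ q
  halves = ℚS.solve 1 (λ q → ℚS.con ½ ℚS.:* q ℚS.:+ ℚS.con ½ ℚS.:* q ℚS.:= q) refl

module _ {m} (Γ Δ : GroupOn (suc m)) where
  private
    v₀ : Fin (suc m * suc m)
    v₀ = combine (GroupOn.ε Γ) (GroupOn.ε Γ)

  cayleyPair : CospectralPair
  cayleyPair = cospectralPair (cayleyNet Γ) (cayleyNet Δ) v₀

  editDistance⇔ : 5 ≤ suc m → ∀ {r} → 0ℝ ≤ℝ r → (∀ d → fromℕ d ≤ℝ r → 5 + d ≤ suc m) →
    δE[ cayleyGraph Γ , cayleyGraph Δ ]≤ r ⇔ Isomorphic (GroupOn.finite Γ) (GroupOn.finite Δ)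
  editDistance⇔ 5≤n {r} 0≤r small = mk⇔
    (λ h → let π , eq = δE≤⇒isomorphic (cayleyNet Γ) (cayleyNet Δ) v₀ {r} small h in cayleyGraphs-isomorphic⇒ Γ Δ 5≤n π eq)
    (λ iso → isomorphic⇒δE≤ (cayleyNet Γ) (cayleyNet Δ) v₀ (cayleyGraphs-isomorphic⇐ Γ Δ iso) {r} 0≤r)

  operatorDistance⇔ : 5 ≤ suc m →
    δ₁[ cayleyGraph Γ , cayleyGraph Δ ]≤ fromℚ (ℤ.+ (3 * m) ℚ./ 3 ℚ.- ℤ.+ 4 ℚ./ 1) ⇔
    Isomorphic (GroupOn.finite Γ) (GroupOn.finite Δ)
  operatorDistance⇔ 5≤n = mk⇔
    (λ h → let π , eq = δ₁≤⇒isomorphic (cayleyNet Γ) (cayleyNet Δ) v₀ h in cayleyGraphs-isomorphic⇒ Γ Δ 5≤n π eq)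
    (λ iso → isomorphic⇒δ₁≤ (cayleyNet Γ) (cayleyNet Δ) v₀ (ℕ.≤-pred 5≤n) (cayleyGraphs-isomorphic⇐ Γ Δ iso))

module _ (t : ℕ → ℝ) (t≥0 : ∀ n → 0ℝ ≤ℝ t n) (t-small : LittleO√ t) where
  private
    half-bound : ∃[ N ] ∀ n → N ≤ n → ∀ √n → IsSqrt (fromℕ n) √n → t n ≤ℝ fromℚ ½ *ℝ √n
    half-bound = t-small (fromℚ ½) (½ , ℚ.positive⁻¹ ½ , 0 , λ _ _ → ℚ.≤-reflexive (ℚ.+-identityˡ ½))

    -- With ε = 1/2 the growth condition gives 2d ≤ n; together with 10 ≤ n this yields 5 + d ≤ n.
    n₀ : ℕ
    n₀ = proj₁ half-bound ℕ.⊔ 9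

    distance-bound : ∀ {n} → n₀ < n → ∀ d → fromℕ d ≤ℝ t (n * n) → 5 + d ≤ n
    distance-bound {n@(suc _)} n₀<n d d≤t = ℕ.*-cancelˡ-≤ 2 (ℕ.≤-trans
      (ℕ.≤-reflexive (solve 1 (λ d → con′ 2 :* (con′ 5 :+ d) := con′ 10 :+ (d :+ d)) refl d))
      (ℕ.≤-trans (ℕ.+-mono-≤ (ℕ.≤-trans (s≤s (ℕ.m≤n⊔m (proj₁ half-bound) 9)) n₀<n) d+d≤n)
        (ℕ.≤-reflexive (cong (n +_) (sym (ℕ.+-identityʳ n))))))
      where
      open +-*-Solver using (solve; _:+_; _:*_; _:=_) renaming (con to con′)

      N≤n² : proj₁ half-bound ≤ n * n
      N≤n² = ℕ.≤-trans (ℕ.m≤m⊔n (proj₁ half-bound) 9) (ℕ.≤-trans (ℕ.<⇒≤ n₀<n) (ℕ.m≤m*n n n))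

      d+d≤n : d + d ≤ n
      d+d≤n = ≤half⇒ {d} {n} (≤ℝ-trans {fromℕ d} {t (n * n)} {fromℚ ½ *ℝ fromℕ n} d≤t
        (proj₂ half-bound (n * n) N≤n² (fromℕ n) (square-root n)))

  editDistance-reduces : Reduces (λ p → let open CospectralPair p in δE[ G , H ]≤ t n) n₀
  editDistance-reduces {suc m} n₀<n Γ Δ = cayleyPair Γ Δ , refl ,
    editDistance⇔ Γ Δ (ℕ.≤-trans (ℕ.m≤n⇒m≤o+n 5 ℕ.≤-refl) (ℕ.≤-trans (s≤s (ℕ.m≤n⊔m (proj₁ half-bound) 9)) n₀<n))
      {t (suc m * suc m)} (t≥0 (suc m * suc m)) (distance-bound n₀<n)

  editDistance⇒groupIsomorphism : DecidableInPolyTime (EditDistanceAtMost t) → DecidableInPolyTime GroupIsomorphism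
  editDistance⇒groupIsomorphism (C , c , d , decides) =
    groupIsomorphism-decidable _ n₀ editDistance-reduces C c d decides

-- The bound 4 < n provides the five points on a line that `NetIsomorphism` asks for and makes the
-- threshold nonnegative.
operatorDistance-reduces : Reduces (DecisionProblem.Yes OperatorDistanceSmall) 4
operatorDistance-reduces {suc m} 4<n Γ Δ = cayleyPair Γ Δ , refl , operatorDistance⇔ Γ Δ 4<n

theorem1p3 : (t : ℕ → ℝ) → (∀ n → 0ℝ ≤ℝ t n) → LittleO√ t →
    (DecidableInPolyTime (EditDistanceAtMost t) → DecidableInPolyTime GroupIsomorphism) ×
    (DecidableInPolyTime OperatorDistanceSmall → DecidableInPolyTime GroupIsomorphism)
theorem1p3 t t≥0 t-small = editDistance⇒groupIsomorphism t t≥0 t-small ,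
  λ (C , c , d , decides) → groupIsomorphism-decidable _ 4 operatorDistance-reduces C c d decides
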